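{- Let $P\subset\mathbb{R}^d$ be a simple $d$-polytope with $n>d+1\geq4$ vertices, $m$ facets, and $h$-vector $h(P)=(h_0,\dots,h_d)$. For a fixed generic objective function $c$ and an arbitrary normalization $\eta$, the number of coherent arborescences of $(P,c)$ with respect to $\eta$ is strictly less than $$1^{h_1}2^{h_2}\cdots d^{h_d}-2(n-m-2).$$
   Context: A $d$-polytope is simple if every vertex is incident to exactly $d$ edges. $c\in\mathbb{R}^d$ is generic for $P$ if $c^tu\neq c^tv$ for all edges $uv$; it orients each edge towards the endpoint with larger $c$-value and has a unique maximizing vertex $v_{opt}$. The entry $h_i$ of the $h$-vector is the number of vertices with in-degree $i$ in this orientation (for simple $P$ this is independent of the generic $c$). $\mathrm{Nb}_{P,c}(v)$ is the set of vertices $u$ adjacent to $v$ with $c^tu>c^tv$. A normalization is a function $\eta:\mathbb{R}^d\to\mathbb{R}$ with $\eta(u-v)\neq0$ whenever $u\in\mathrm{Nb}_{P,c}(v)$. A coherent arborescence of $(P,c)$ with respect to $\eta$ is a map $\mathcal{A}:V(P)\to V(P)$ for which there is a weight $w\in\mathbb{R}^d$ such that $\mathcal{A}(v_{opt})=v_{opt}$ and, for every $v\neq v_{opt}$, $\mathcal{A}(v)$ is the unique maximizer of $\frac{w^t(u-v)}{\eta(u-v)}$ over $u\in\mathrm{Nb}_{P,c}(v)$. -}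

module Defs where

open import Level using (0ℓ) renaming (suc to lsuc)
open import Algebra.Core using (Op₁; Op₂)
open import Algebra.Bundles using (CommutativeRing)
open import Algebra.Structures using (IsCommutativeRing)
import Algebra.Definitions.RawMonoid as RawMonoidOps
open import Data.Fin.Base using (Fin; toℕ) renaming (suc to fsuc)
open import Data.Nat.Base as ℕ using (ℕ; suc; pred)
open import Data.Product.Base using (Σ; Σ-syntax; ∃; ∃-syntax; _×_; _,_; proj₁; proj₂)
open import Data.Vec.Functional using (Vector; foldr)
import Data.Vec.Functional.Relation.Binary.Equality.Setoid as VecEquality
open import Function.Bundles using (Func; Bijection; _⟨$⟩_; _⇔_; mk⇔; Equivalence)
open import Function.Relation.Binary.Setoid.Equality using (_⇨_)
open import Relation.Binary.Bundles using (Setoid)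
open import Relation.Binary.Core using (Rel)
open import Relation.Binary.Structures using (IsStrictTotalOrder)
open import Relation.Binary.PropositionalEquality.Properties using () renaming (setoid to ≡-setoid)
import Relation.Binary.Construct.On as On
import Relation.Binary.Construct.StrictToNonStrict as StrictToNonStrict
open import Relation.Nullary.Negation using (¬_)
open import Relation.Unary using (Pred; _∈_; Satisfiable)

-- The real numbers, axiomatised as a Dedekind-complete ordered field, which
-- classically determines them up to unique isomorphism.

record RealField : Set (lsuc 0ℓ) where
  infix  4 _≈_ _<_ _≤_
  infixl 6 _+_ _-_
  infixl 7 _*_ _/_
  infix  8 -_ _⁻¹

  field
    Carrier            : Set
    _≈_ _<_            : Rel Carrier 0ℓ
    _+_ _*_            : Op₂ Carrier
    -_                 : Op₁ Carrier
    0# 1#              : Carrier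
    isCommutativeRing  : IsCommutativeRing _≈_ _+_ _*_ -_ 0# 1#
    isStrictTotalOrder : IsStrictTotalOrder _≈_ _<_
    0<1                : 0# < 1#
    +-monoˡ-<          : ∀ z {x y} → x < y → x + z < y + z
    *-pos              : ∀ {x y} → 0# < x → 0# < y → 0# < x * y
    -- The value of 0# ⁻¹ is unspecified.
    _⁻¹                : Op₁ Carrier
    ⁻¹-inverseʳ        : ∀ {x} → ¬ (x ≈ 0#) → x * x ⁻¹ ≈ 1#

  _≤_ : Rel Carrier 0ℓ
  _≤_ = StrictToNonStrict._≤_ _≈_ _<_

  UpperBound : Pred Carrier 0ℓ → Pred Carrier 0ℓ
  UpperBound S b = ∀ x → x ∈ S → x ≤ b

  field
    complete : (S : Pred Carrier 0ℓ) → Satisfiable S → ∃[ b ] UpperBound S b →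
               ∃[ s ] (UpperBound S s × (∀ b → UpperBound S b → s ≤ b))

  _-_ _/_ : Op₂ Carrier
  x - y = x + (- y)
  x / y = x * y ⁻¹

  commutativeRing : CommutativeRing 0ℓ 0ℓ
  commutativeRing = record { isCommutativeRing = isCommutativeRing }

  open CommutativeRing commutativeRing public using (setoid; +-rawMonoid)
  open RawMonoidOps +-rawMonoid public using (sum)

Subsetoid : (S : Setoid 0ℓ 0ℓ) → Pred (Setoid.Carrier S) 0ℓ → Setoid 0ℓ 0ℓ
Subsetoid S Q = On.setoid {B = Σ (Setoid.Carrier S) Q} S proj₁

-- Elements are counted up to the equality of the setoid.
HasSize : Setoid 0ℓ 0ℓ → ℕ → Set
HasSize S k = Bijection (≡-setoid (Fin k)) S

-- ∏ᵢ i ^ hᵢ over i = 1, …, d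
hProduct : ∀ {d} → Vector ℕ (suc d) → ℕ
hProduct {d} h = foldr ℕ._*_ 1 {d} (λ i → suc (toℕ i) ℕ.^ h (fsuc i))

module Polytopes (R : RealField) where
  open RealField R
  module ≋ = VecEquality setoid
  open ≋ using (_≋_) public

  Point : ℕ → Set
  Point d = Vector Carrier d

  infixl 6 _⊖_
  infix  7 _·_

  _·_ : ∀ {d} → Point d → Point d → Carrier
  x · y = sum (λ j → x j * y j)

  _⊖_ : ∀ {d} → Point d → Point d → Point d
  (x ⊖ y) j = x j - y j

  combination : ∀ {d k} → Vector Carrier k → Vector (Point d) k → Point d
  combination λs p j = sum (λ i → λs i * p i j)

  AffinelyIndependent : ∀ {d k} → Vector (Point d) k → Set
  AffinelyIndependent {k = k} p =
    (λs : Vector Carrier k) → sum λs ≈ 0# → combination λs p ≋ (λ _ → 0#) →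
    ∀ i → λs i ≈ 0#

  HasAffinelyIndependent : ∀ {d} → Pred (Point d) 0ℓ → ℕ → Set
  HasAffinelyIndependent {d} S k =
    Σ[ p ∈ Vector (Point d) k ] ((∀ i → p i ∈ S) × AffinelyIndependent p)

  -- The affine dimension; no k satisfies this for the empty set.
  HasDim : ∀ {d} → Pred (Point d) 0ℓ → ℕ → Set
  HasDim S k = HasAffinelyIndependent S (1 ℕ.+ k) × ¬ HasAffinelyIndependent S (2 ℕ.+ k)

  -- The polytope is the convex hull of the generators, which need be neither
  -- distinct nor vertices.
  record Polytope (d : ℕ) : Set where
    field
      {size}    : ℕ
      generator : Vector (Point d) size

  module _ {d : ℕ} where

    points : Polytope d → Pred (Point d) 0ℓ
    points P x = Σ[ λs ∈ Vector Carrier size ]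
      ((∀ i → 0# ≤ λs i) × sum λs ≈ 1# × x ≋ combination λs generator)
      where open Polytope P

    -- Presented by a valid inequality; the empty face and P itself are included.
    record Face (P : Polytope d) : Set where
      field
        normal : Point d
        offset : Carrier
        valid  : ∀ x → x ∈ points P → normal · x ≤ offset

    facePoints : ∀ {P} → Face P → Pred (Point d) 0ℓ
    facePoints {P} F x = x ∈ points P × normal · x ≈ offset
      where open Face F

    FaceSetoid : Polytope d → Setoid 0ℓ 0ℓ
    FaceSetoid P = record
      { Carrier       = Face P
      ; _≈_           = λ F G → ∀ x → x ∈ facePoints F ⇔ x ∈ facePoints G
      ; isEquivalence = record
        { refl  = λ x → mk⇔ (λ p → p) (λ p → p)
        ; sym   = λ e x → mk⇔ (Equivalence.from (e x)) (Equivalence.to (e x))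
        ; trans = λ e f x → mk⇔
            (λ p → Equivalence.to (f x) (Equivalence.to (e x) p))
            (λ p → Equivalence.from (e x) (Equivalence.from (f x) p))
        }
      }

    module _ (P : Polytope d) where

      IsVertex : Pred (Point d) 0ℓ
      IsVertex v = Σ[ F ∈ Face P ] (HasDim (facePoints F) 0 × v ∈ facePoints F)

      Vertices : Setoid 0ℓ 0ℓ
      Vertices = Subsetoid (≋.≋-setoid d) IsVertex

      Vertex : Set
      Vertex = Setoid.Carrier Vertices

      IsEdge IsFacet : Pred (Face P) 0ℓ
      IsEdge  F = HasDim (facePoints F) 1
      IsFacet F = HasDim (facePoints F) (pred d)

      Facets : Setoid 0ℓ 0ℓ
      Facets = Subsetoid (FaceSetoid P) IsFacet

      FullDimensional : Set
      FullDimensional = HasDim (points P) d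

      Simple : Set
      Simple = (v : Vertex) →
        HasSize (Subsetoid (FaceSetoid P) (λ F → IsEdge F × proj₁ v ∈ facePoints F)) d

      Adjacent : Rel Vertex 0ℓ
      Adjacent u v = ¬ (proj₁ u ≋ proj₁ v) ×
        Σ[ F ∈ Face P ] (IsEdge F × proj₁ u ∈ facePoints F × proj₁ v ∈ facePoints F)

      Generic : Pred (Point d) 0ℓ
      Generic c = (u v : Vertex) → Adjacent u v → ¬ (c · proj₁ u ≈ c · proj₁ v)

      Nb : Point d → Vertex → Pred Vertex 0ℓ
      Nb c v u = Adjacent u v × c · proj₁ v < c · proj₁ u

      IsOpt : Point d → Pred Vertex 0ℓ
      IsOpt c v = (u : Vertex) → c · proj₁ u ≤ c · proj₁ v

      HasInDegree : Point d → ℕ → Pred Vertex 0ℓ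
      HasInDegree c i v = HasSize (Subsetoid (FaceSetoid P) In) i
        where
        In : Pred (Face P) 0ℓ
        In F = IsEdge F × proj₁ v ∈ facePoints F ×
          Σ[ u ∈ Vertex ] (proj₁ u ∈ facePoints F × c · proj₁ u < c · proj₁ v)

      -- The h-vector of a simple polytope does not depend on the generic
      -- objective used to read it off, so it is tied to no particular one.
      IsHVector : Vector ℕ (suc d) → Set
      IsHVector h = Σ[ c ∈ Point d ] (Generic c ×
        (∀ i → HasSize (Subsetoid Vertices (HasInDegree c (toℕ i))) (h i)))

      IsNormalization : Point d → Pred (Func (≋.≋-setoid d) setoid) 0ℓ
      IsNormalization c η = (u v : Vertex) → Nb c v u → ¬ (η ⟨$⟩ (proj₁ u ⊖ proj₁ v) ≈ 0#)

      IsMaximizer : Pred Vertex 0ℓ → (Vertex → Carrier) → Pred Vertex 0ℓ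
      IsMaximizer S f u = u ∈ S × (∀ u′ → u′ ∈ S → f u′ ≤ f u)

      IsUniqueMaximizer : Pred Vertex 0ℓ → (Vertex → Carrier) → Pred Vertex 0ℓ
      IsUniqueMaximizer S f u = IsMaximizer S f u ×
        (∀ u′ → IsMaximizer S f u′ → proj₁ u′ ≋ proj₁ u)

      module _ (c : Point d) (η : Func (≋.≋-setoid d) setoid) where

        slope : Point d → Vertex → Vertex → Carrier
        slope w v u = (w · (proj₁ u ⊖ proj₁ v)) / (η ⟨$⟩ (proj₁ u ⊖ proj₁ v))

        IsCoherent : Pred (Func Vertices Vertices) 0ℓ
        IsCoherent A = Σ[ w ∈ Point d ]
          ((∀ v → IsOpt c v → proj₁ (A ⟨$⟩ v) ≋ proj₁ v) ×
           (∀ v → ¬ IsOpt c v → IsUniqueMaximizer (Nb c v) (slope w v) (A ⟨$⟩ v)))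

        CoherentArborescences : Setoid 0ℓ 0ℓ
        CoherentArborescences = Subsetoid (Vertices ⇨ Vertices) IsCoherent

{-# OPTIONS --safe #-}

-- An arborescence picks an out-edge at every vertex but the sink, so there are ∏ max(1, outdeg v)
-- of them.  This product is hProduct h: sending a face to its top vertex counts the k-faces as
-- Σ_v C(indeg v, k) for every generic objective, and inverting this triangular system shows that the
-- in-degree distribution is the same for c₀ (which reads off h) and −c (whose in-degrees are the
-- out-degrees of c).
--
-- Let the vertices of out-degree ≥ 2 number d + 1 + t.  At d + 1 of them, the differences of two slope
-- functionals satisfy a linear relation.  Choosing at each of these vertices between the two edges by
-- the sign of its coefficient, or by the opposite sign, is incompatible with every weight w, whatever
-- is chosen elsewhere; this gives 2(t + 1) incoherent arborescences.  Finally t + 1 ≥ n − m − 1,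
-- because each facet has one top vertex, the sink is on top of d facets, and each vertex of out-degree 1
-- is on top of one.
--
-- The geometry of a simple vertex v comes from Farkas' lemma: an irredundant set of generators of the
-- cone of P − v consists of exposed rays, hence of edges, and simplicity together with full dimension
-- makes them a basis; the faces at v are then cut out by the dual basis.

module Submission where

open import Defs
open import Level using (0ℓ)
open import Axiom.ExcludedMiddle using (ExcludedMiddle)
open import Algebra.Bundles using (CommutativeMonoid; CommutativeRing; RawRing)
import Algebra.Properties.CommutativeMonoid.Sum as MonoidSum
import Algebra.Properties.Ring as RingProperties
import Algebra.Properties.Semiring.Mult.TCOptimised as Multiples
import Algebra.Properties.Semiring.Sum as SemiringSum
import Algebra.Solver.Ring as RingSolver
open import Algebra.Solver.Ring.AlmostCommutativeRing
  using (fromCommutativeRing; _-Raw-AlmostCommutative⟶_)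
open import Data.Bool.Base using (Bool; true; false; T; if_then_else_; not; _xor_)
import Data.Bool.Properties as Bool
open import Data.Empty using (⊥; ⊥-elim)
open import Data.Fin.Base as Fin using (Fin; zero; suc; toℕ; punchIn; punchOut; _↑ˡ_; _↑ʳ_)
import Data.Fin.Properties as Fin
open import Data.Integer.Base as ℤ using (+_)
import Data.Integer.Properties as ℤ
open import Data.Maybe.Base using (Maybe; just; nothing)
open import Data.Nat.Base as ℕ using (ℕ; zero; suc; z≤n; s≤s)
import Data.Nat.Combinatorics as Binomial
import Data.Nat.Properties as ℕ
open import Data.Nat.Tactic.RingSolver using (solve-∀)
import Data.Integer.Tactic.RingSolver as ℤSolver
open import Data.Product.Base using (Σ; Σ-syntax; ∃; ∃-syntax; _×_; _,_; proj₁; proj₂)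
open import Data.Sum.Base using (_⊎_; inj₁; inj₂; [_,_]′)
import Data.Sum.Properties as Sum
open import Data.Unit.Base using (⊤; tt)
open import Data.Vec.Functional using (Vector; insertAt)
import Data.Vec.Functional.Properties as VecF
open import Function.Base using (_∘_; id; case_of_)
import Data.Product.Function.NonDependent.Propositional as ×F
import Data.Sum.Function.Propositional as ⊎F
open import Function.Properties.Inverse using (↔-trans; ↔-sym; ↔-refl; ↔⇒⤖)
open import Function.Bundles
  using (Func; Bijection; Equivalence; Inverse; _⟨$⟩_; _⇔_; _↔_; mk⇔; mk↔ₛ′)
open import Relation.Binary.Bundles using (Setoid)
open import Relation.Binary.Definitions using (tri<; tri≈; tri>)
open import Relation.Binary.PropositionalEquality as ≡ using (_≡_; _≢_)
open import Relation.Binary.Structures using (IsStrictTotalOrder)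
import Relation.Binary.Reasoning.Setoid as SetoidReasoning
open import Relation.Nullary.Decidable.Core using (Dec; yes; no; ⌊_⌋; toWitness; fromWitness)
open import Relation.Nullary.Negation.Core using (¬_; contradiction)

-- Slopes are linear in `w` whatever η is, since η only rescales each direction. Hence the d + 1
-- differences γ a are vectors in dimension d with a nontrivial relation Σ α a * γ a = 0. Coherence
-- forces a strict sign on every w · γ a. If these signs all agree with those of the α a, or are all
-- opposite, the terms α a * (w · γ a) have one common sign and are not all zero, yet they sum to
-- zero.
--
-- Only t + 1 completions at the other t branching vertices are counted, as the target is linear in
-- n - m. With at most d branching vertices no relation is available, but then n ≤ m + 1 and the
-- total number of arborescences suffices. In both cases N ≤ hProduct h - 2 (n - m - 1), two below
-- the stated bound.
--
-- Comparing objectives needs no face lattice: a k-face is given by a vertex with k of its edges,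
-- and two such descriptions agree when they cut out the same vertex set. Moving a face to its top
-- vertex for another objective is then injective, and using this in both directions gives equal
-- counts.

module SumSingle {c ℓ} (M : CommutativeMonoid c ℓ) where
  open CommutativeMonoid M
  open MonoidSum M

  sum-zero : ∀ {n} {f : Vector Carrier n} → (∀ i → f i ≈ ε) → sum f ≈ ε
  sum-zero {n} p = trans (sum-cong-≋ p) (sum-replicate-zero n)

  sum-single : ∀ {n} (f : Vector Carrier n) i → (∀ j → j ≢ i → f j ≈ ε) → sum f ≈ f i
  sum-single f zero p = trans (∙-congˡ (sum-zero (λ j → p (suc j) (λ ())))) (identityʳ _)
  sum-single f (suc i) p = trans (∙-congʳ (p zero (λ ())))
    (trans (identityˡ _) (sum-single (f ∘ suc) i (λ j j≢i → p (suc j) (j≢i ∘ Fin.suc-injective))))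

-- Ring normalisation over the ordered field.

module OrderedField (ℝ : RealField) where
  open RealField ℝ public
  open CommutativeRing commutativeRing public
    using (ring; semiring; +-commutativeMonoid; +-cong; +-congˡ; +-congʳ; *-cong; *-congˡ; *-congʳ;
           -‿cong; -‿inverseʳ; +-identityˡ; +-identityʳ; *-identityˡ; zeroˡ; zeroʳ; *-comm; +-comm)
    renaming (refl to ≈-refl; sym to ≈-sym; trans to ≈-trans; reflexive to ≈-reflexive)
  open IsStrictTotalOrder isStrictTotalOrder public
    using (compare; <-resp-≈; irrefl) renaming (trans to <-trans; asym to <-asym)
  open MonoidSum +-commutativeMonoid public
    using (sum-cong-≋; sum-remove; ∑-distrib-+; ∑-comm)
  open SumSingle +-commutativeMonoid public
  open SemiringSum semiring public using (*-distribˡ-sum; *-distribʳ-sum)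
  open RingProperties ring public using (-0#≈0#)
  module ≈R = SetoidReasoning setoid

  private
    open RingProperties ring using (-‿+-comm; ⁻¹-anti-homo-//; x[y-z]≈xy-xz; [y-z]x≈yx-zx; -‿distribʳ-*)
    open Multiples semiring using (×-homo-+; ×1-homo-*) renaming (_×_ to _·1_)

    almostRing = fromCommutativeRing commutativeRing

    -- The solver's coefficients are integers, written as formal differences of naturals.
    coefficients : RawRing 0ℓ 0ℓ
    coefficients = record
      { Carrier = ℕ × ℕ
      ; _≈_ = _≡_
      ; _+_ = λ (a , b) (c , d) → a ℕ.+ c , b ℕ.+ d
      ; _*_ = λ (a , b) (c , d) → a ℕ.* c ℕ.+ b ℕ.* d , a ℕ.* d ℕ.+ b ℕ.* c
      ; -_  = λ (a , b) → b , a
      ; 0#  = 0 , 0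
      ; 1#  = 1 , 0
      }

    val : ℕ → Carrier
    val a = a ·1 1#

    module _ where
      open ≈R
      open import Algebra.Properties.CommutativeSemigroup
        (CommutativeRing.+-commutativeSemigroup commutativeRing) using (interchange)

      sub-+ : ∀ a b c d → (a + c) - (b + d) ≈ (a - b) + (c - d)
      sub-+ a b c d = begin
        (a + c) + - (b + d)     ≈⟨ +-congˡ (-‿+-comm b d) ⟨
        (a + c) + (- b + - d)   ≈⟨ interchange a c (- b) (- d) ⟩
        (a - b) + (c - d)       ∎

      sub-* : ∀ a b c d → (a * c + b * d) - (a * d + b * c) ≈ (a - b) * (c - d)
      sub-* a b c d = begin
        (a * c + b * d) - (a * d + b * c)       ≈⟨ sub-+ (a * c) (a * d) (b * d) (b * c) ⟩
        (a * c - a * d) + (b * d - b * c)       ≈⟨ +-cong (x[y-z]≈xy-xz a c d) (x[y-z]≈xy-xz b d c) ⟨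
        a * (c - d) + b * (d - c)               ≈⟨ +-congˡ (*-congˡ (⁻¹-anti-homo-// c d)) ⟨
        a * (c - d) + b * - (c - d)             ≈⟨ +-congˡ (-‿distribʳ-* b (c - d)) ⟨
        a * (c - d) + - (b * (c - d))           ≈⟨ [y-z]x≈yx-zx (c - d) a b ⟨
        (a - b) * (c - d)                       ∎

    morphism : coefficients -Raw-AlmostCommutative⟶ almostRing
    morphism = record
      { ⟦_⟧    = λ (a , b) → val a - val b
      ; +-homo = λ (a , b) (c , d) → ≈-trans
          (+-cong (×-homo-+ 1# a c) (-‿cong (×-homo-+ 1# b d))) (sub-+ _ _ _ _)
      ; *-homo = λ (a , b) (c , d) → ≈-trans
          (+-cong (≈-trans (×-homo-+ 1# (a ℕ.* c) (b ℕ.* d)) (+-cong (×1-homo-* a c) (×1-homo-* b d)))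
            (-‿cong (≈-trans (×-homo-+ 1# (a ℕ.* d) (b ℕ.* c)) (+-cong (×1-homo-* a d) (×1-homo-* b c)))))
          (sub-* _ _ _ _)
      ; -‿homo = λ (a , b) → ≈-sym (⁻¹-anti-homo-// (val a) (val b))
      ; 0-homo = -‿inverseʳ 0#
      ; 1-homo = ≈-trans (+-congˡ -0#≈0#) (+-identityʳ 1#)
      }

    -- Coefficients are compared as integers, not as pairs: two differences agree once their cross
    -- sums do, so that for instance `1 , 1` is recognised as zero.
    coeff≟ : ∀ p q → Maybe (_-Raw-AlmostCommutative⟶_.⟦_⟧ morphism p ≈ _-Raw-AlmostCommutative⟶_.⟦_⟧ morphism q)
    coeff≟ (a , b) (c , d) with a ℕ.+ d ℕ.≟ c ℕ.+ b
    ... | no _ = nothing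
    ... | yes eq = just (begin
      val a - val b                          ≈⟨ cancel (val a) (val b) (val d) ⟨
      (val a + val d) - (val b + val d)      ≈⟨ +-congʳ (×-homo-+ 1# a d) ⟨
      val (a ℕ.+ d) - (val b + val d)        ≈⟨ +-congʳ (≈-reflexive (≡.cong val eq)) ⟩
      val (c ℕ.+ b) - (val b + val d)        ≈⟨ +-cong (×-homo-+ 1# c b) (-‿cong (+-comm _ _)) ⟩
      (val c + val b) - (val d + val b)      ≈⟨ cancel (val c) (val d) (val b) ⟩
      val c - val d                          ∎)
      where
      open ≈R
      cancel : ∀ x y z → (x + z) - (y + z) ≈ x - y
      cancel x y z = ≈-trans (sub-+ x y z z) (≈-trans (+-congˡ (-‿inverseʳ z)) (+-identityʳ _))

  open RingSolver coefficients almostRing morphism coeff≟ public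
    using (solve; _:=_; _:+_; _:*_; :-_; _:-_)

-- Order arithmetic and signs of finite sums.

module FieldOrder (ℝ : RealField) where
  open OrderedField ℝ public

  private
    variable
      x y z : Carrier
      n : ℕ

  pos-resp : x ≈ y → 0# < x → 0# < y
  pos-resp = proj₁ <-resp-≈

  nn-resp : x ≈ y → 0# ≤ x → 0# ≤ y
  nn-resp e (inj₁ p) = inj₁ (pos-resp e p)
  nn-resp e (inj₂ p) = inj₂ (≈-trans p e)

  <-irrefl : ¬ (x < x)
  <-irrefl = irrefl ≈-refl

  pos-diff : x < y → 0# < y - x
  pos-diff {x} p = proj₂ <-resp-≈ (-‿inverseʳ x) (+-monoˡ-< (- x) p)

  diff-pos : 0# < y - x → x < y
  diff-pos {y} {x} p = proj₂ <-resp-≈ (+-identityˡ x)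
    (proj₁ <-resp-≈ (solve 2 (λ x y → (y :- x) :+ x := y) ≈-refl x y) (+-monoˡ-< x p))

  nn-diff : x ≤ y → 0# ≤ y - x
  nn-diff (inj₁ p) = inj₁ (pos-diff p)
  nn-diff {x} {y} (inj₂ e) = inj₂ (≈-trans (≈-sym (-‿inverseʳ x)) (+-congʳ e))

  diff-nn : 0# ≤ y - x → x ≤ y
  diff-nn (inj₁ p) = inj₁ (diff-pos p)
  diff-nn {y} {x} (inj₂ e) = inj₂ (≈-trans (≈-sym (+-identityˡ x))
    (≈-trans (+-congʳ e) (solve 2 (λ x y → (y :- x) :+ x := y) ≈-refl x y)))

  pos+pos : 0# < x → 0# < y → 0# < x + y
  pos+pos {x} {y} p q = <-trans q (proj₂ <-resp-≈ (+-identityˡ y) (+-monoˡ-< y p))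

  pos+nn : 0# < x → 0# ≤ y → 0# < x + y
  pos+nn p (inj₁ q) = pos+pos p q
  pos+nn {x} p (inj₂ q) = pos-resp (≈-trans (≈-sym (+-identityʳ x)) (+-congˡ q)) p

  nn+pos : 0# ≤ x → 0# < y → 0# < x + y
  nn+pos {x} {y} p q = pos-resp (+-comm y x) (pos+nn q p)

  nn+nn : 0# ≤ x → 0# ≤ y → 0# ≤ x + y
  nn+nn (inj₁ p) q = inj₁ (pos+nn p q)
  nn+nn {x} {y} (inj₂ p) q = nn-resp (≈-trans (≈-sym (+-identityˡ y)) (+-congʳ p)) q

  nn*nn : 0# ≤ x → 0# ≤ y → 0# ≤ x * y
  nn*nn (inj₁ p) (inj₁ q) = inj₁ (*-pos p q)
  nn*nn {x} p (inj₂ q) = inj₂ (≈-trans (≈-sym (zeroʳ x)) (*-congˡ q))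
  nn*nn {y = y} (inj₂ p) q = inj₂ (≈-trans (≈-sym (zeroˡ y)) (*-congʳ p))

  0≤0 : 0# ≤ 0#
  0≤0 = inj₂ ≈-refl

  pos≉0 : 0# < x → ¬ (x ≈ 0#)
  pos≉0 p e = <-irrefl (pos-resp e p)

  1≉0 : ¬ (1# ≈ 0#)
  1≉0 = pos≉0 0<1

  neg-pos : x < 0# → 0# < - x
  neg-pos {x} p = pos-resp (+-identityˡ (- x)) (pos-diff p)

  nn-neg : x ≤ 0# → 0# ≤ - x
  nn-neg {x} p = nn-resp (+-identityˡ (- x)) (nn-diff p)

  neg-nonpos : 0# ≤ - x → x ≤ 0#
  neg-nonpos {x} p = diff-nn (nn-resp (≈-sym (+-identityˡ (- x))) p)

  neg-neg : 0# < - x → x < 0#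
  neg-neg {x} p = diff-pos (pos-resp (≈-sym (+-identityˡ (- x))) p)

  -1≮ : ¬ (0# < - 1#)
  -1≮ p = <-irrefl (pos-resp (-‿inverseʳ 1#) (pos+pos 0<1 p))

  ⁻¹-pos : 0# < x → 0# < x ⁻¹
  ⁻¹-pos {x} p with compare 0# (x ⁻¹)
  ... | tri< q _ _ = q
  ... | tri≈ _ e _ = contradiction
    (≈-trans (≈-sym (⁻¹-inverseʳ (pos≉0 p))) (≈-trans (*-congˡ (≈-sym e)) (zeroʳ x))) 1≉0
  ... | tri> _ _ q = contradiction (pos-resp
    (≈-trans (solve 2 (λ a b → a :* (:- b) := :- (a :* b)) ≈-refl x (x ⁻¹))
      (-‿cong (⁻¹-inverseʳ (pos≉0 p)))) (*-pos p (neg-pos q))) -1≮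

  ≮⇒≥ : ¬ (x < y) → y ≤ x
  ≮⇒≥ {x} {y} ¬p with compare x y
  ... | tri< p _ _ = contradiction p ¬p
  ... | tri≈ _ e _ = inj₂ (≈-sym e)
  ... | tri> _ _ q = inj₁ q

  ≤⇒≯ : x ≤ y → ¬ (y < x)
  ≤⇒≯ (inj₁ p) q = <-asym p q
  ≤⇒≯ (inj₂ e) q = irrefl (≈-sym e) q

  ≤-trans : x ≤ y → y ≤ z → x ≤ z
  ≤-trans {x} {y} {z} p q =
    diff-nn (nn-resp (solve 3 (λ x y z → (y :- x) :+ (z :- y) := z :- x) ≈-refl x y z)
      (nn+nn (nn-diff p) (nn-diff q)))

  ≤-antisym : x ≤ y → y ≤ x → x ≈ y
  ≤-antisym (inj₂ e) _ = e
  ≤-antisym (inj₁ p) q = contradiction p (≤⇒≯ q)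

  ≤-<-trans : x ≤ y → y < z → x < z
  ≤-<-trans (inj₁ p) q = <-trans p q
  ≤-<-trans (inj₂ e) q = proj₂ <-resp-≈ (≈-sym e) q

  ≤-respˡ : x ≈ y → x ≤ z → y ≤ z
  ≤-respˡ e (inj₁ p) = inj₁ (proj₂ <-resp-≈ e p)
  ≤-respˡ e (inj₂ p) = inj₂ (≈-trans (≈-sym e) p)

  ≈0? : ∀ x → (x ≈ 0#) ⊎ ¬ (x ≈ 0#)
  ≈0? x with compare x 0#
  ... | tri< _ ¬e _ = inj₂ ¬e
  ... | tri≈ _ e _ = inj₁ e
  ... | tri> _ ¬e _ = inj₂ ¬e

  square-pos : ¬ (x ≈ 0#) → 0# < x * x
  square-pos {x} ¬e with compare x 0#
  ... | tri< p _ _ = pos-resp (solve 1 (λ x → (:- x) :* (:- x) := x :* x) ≈-refl x)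
                       (*-pos (neg-pos p) (neg-pos p))
  ... | tri≈ _ e _ = contradiction e ¬e
  ... | tri> _ _ p = *-pos p p

  diff≈0 : x - y ≈ 0# → x ≈ y
  diff≈0 {x} {y} e = ≈-trans (solve 2 (λ x y → x := (x :- y) :+ y) ≈-refl x y)
    (≈-trans (+-congʳ e) (+-identityˡ y))

  *-zero-cancel : ¬ (x ≈ 0#) → x * y ≈ 0# → y ≈ 0#
  *-zero-cancel {x} {y} ¬e e = begin
    y                    ≈⟨ *-identityˡ y ⟨
    1# * y               ≈⟨ *-congʳ (⁻¹-inverseʳ ¬e) ⟨
    x * x ⁻¹ * y         ≈⟨ solve 3 (λ a b c → a :* b :* c := b :* (a :* c)) ≈-refl x (x ⁻¹) y ⟩
    x ⁻¹ * (x * y)       ≈⟨ *-congˡ e ⟩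
    x ⁻¹ * 0#            ≈⟨ zeroʳ _ ⟩
    0#                   ∎
    where open ≈R

  -- The axioms do not say that `_⁻¹` respects `_≈_`; on nonzero elements this follows because
  -- inverses are unique.
  ⁻¹-cong : ¬ (x ≈ 0#) → x ≈ y → x ⁻¹ ≈ y ⁻¹
  ⁻¹-cong {x} {y} x≉0 x≈y = ≈-sym (diff≈0 (*-zero-cancel x≉0 (begin
    x * (y ⁻¹ - x ⁻¹)          ≈⟨ solve 3 (λ x p q → x :* (p :- q) := x :* p :- x :* q) ≈-refl x (y ⁻¹) (x ⁻¹) ⟩
    x * y ⁻¹ - x * x ⁻¹        ≈⟨ +-cong (*-congʳ x≈y) (-‿cong (⁻¹-inverseʳ x≉0)) ⟩
    y * y ⁻¹ - 1#              ≈⟨ +-congʳ (⁻¹-inverseʳ (λ y≈0 → x≉0 (≈-trans x≈y y≈0))) ⟩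
    1# - 1#                    ≈⟨ -‿inverseʳ 1# ⟩
    0#                         ∎)))
    where open ≈R

  sum-nn : {f : Vector Carrier n} → (∀ i → 0# ≤ f i) → 0# ≤ sum f
  sum-nn {zero} p = 0≤0
  sum-nn {suc n} p = nn+nn (p zero) (sum-nn (p ∘ suc))

  sum-pos : {f : Vector Carrier n} → (∀ i → 0# ≤ f i) → ∀ i → 0# < f i → 0# < sum f
  sum-pos p zero q = pos+nn q (sum-nn (p ∘ suc))
  sum-pos p (suc i) q = nn+pos (p zero) (sum-pos (p ∘ suc) i q)

  nn-sum≈0 : {f : Vector Carrier n} → (∀ i → 0# ≤ f i) → sum f ≈ 0# → ∀ i → f i ≈ 0#
  nn-sum≈0 p e i with p i
  ... | inj₁ q = contradiction e (pos≉0 (sum-pos p i q))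
  ... | inj₂ q = ≈-sym q

  sum-linear : (f g : Vector Carrier n) (t : Carrier) → sum (λ i → f i + t * g i) ≈ sum f + t * sum g
  sum-linear f g t = ≈-trans (∑-distrib-+ f (λ i → t * g i)) (+-congˡ (≈-sym (*-distribˡ-sum t g)))

  sum-minus : (f g : Vector Carrier n) → sum (λ i → f i - g i) ≈ sum f - sum g
  sum-minus {zero} f g = ≈-sym (-‿inverseʳ 0#)
  sum-minus {suc n} f g = ≈-trans (+-congˡ (sum-minus (f ∘ suc) (g ∘ suc)))
    (solve 4 (λ a b c d → (a :- b) :+ (c :- d) := (a :+ c) :- (b :+ d)) ≈-refl _ _ _ _)

  sum-neg : (f : Vector Carrier n) → sum (λ i → - f i) ≈ - sum f
  sum-neg {zero} f = ≈-sym -0#≈0#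
  sum-neg {suc n} f = ≈-trans (+-congˡ (sum-neg (f ∘ suc)))
    (solve 2 (λ a b → :- a :+ :- b := :- (a :+ b)) ≈-refl _ _)

  argmax : (B : Fin n → Bool) (f : Vector Carrier n) → (∃[ i ] T (B i)) →
           ∃[ i ] (T (B i) × (∀ j → T (B j) → f j ≤ f i))
  argmax {suc n} B f (i , b) with Fin.any? (λ j → Bool.T? (B (suc j)))
  ... | no none = zero , first i b ,
        λ { zero _ → inj₂ ≈-refl ; (suc j) t → contradiction (j , t) none }
    where
    first : ∀ i → T (B i) → T (B zero)
    first zero t = t
    first (suc i) t = contradiction (i , t) none
  ... | yes some with argmax (B ∘ suc) (f ∘ suc) some | Bool.T? (B zero)
  ...   | k , q , m | no ¬b = suc k , q , λ { zero b → contradiction b ¬b ; (suc j) → m j }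
  ...   | k , q , m | yes b with compare (f zero) (f (suc k))
  ...     | tri< p _ _ = suc k , q , λ { zero _ → inj₁ p ; (suc j) → m j }
  ...     | tri≈ _ p _ = suc k , q , λ { zero _ → inj₂ p ; (suc j) → m j }
  ...     | tri> _ _ p = zero , b , λ { zero _ → inj₂ ≈-refl ; (suc j) t → ≤-trans (m j t) (inj₁ p) }

-- Linear dependence, separation and Farkas' lemma.

module LinearAlgebra (ℝ : RealField) where
  open FieldOrder ℝ public
  open Polytopes ℝ public renaming (_·_ to infix 9 _·_; _⊖_ to infixl 10 _⊖_)

  private
    variable
      d k l n : ℕ

  infixr 5 _▹_
  _▹_ : {A : Set} → A → Vector A k → Vector A (suc k)
  (x ▹ u) zero = x
  (x ▹ u) (suc i) = u i

  0ᵖ : Point d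
  0ᵖ _ = 0#

  -ᵖ_ : Point d → Point d
  (-ᵖ x) j = - x j

  shear : Carrier → Point d → Point d → Point d
  shear t y x j = x j - t * y j

  ·-cong : {x x′ y y′ : Point d} → x ≋ x′ → y ≋ y′ → x · y ≈ x′ · y′
  ·-cong p q = sum-cong-≋ (λ j → *-cong (p j) (q j))

  ·-congˡ : (f : Point d) {y y′ : Point d} → y ≋ y′ → f · y ≈ f · y′
  ·-congˡ f = ·-cong {x = f} (λ _ → ≈-refl)

  ·-comm : (x y : Point d) → x · y ≈ y · x
  ·-comm x y = sum-cong-≋ (λ j → *-comm (x j) (y j))

  ·-shear : (f : Point d) (t : Carrier) (y x : Point d) → f · shear t y x ≈ f · x - t * (f · y)
  ·-shear f t y x = begin
    sum (λ j → f j * (x j - t * y j))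
      ≈⟨ sum-cong-≋ (λ j → solve 4 (λ f x t y → f :* (x :- t :* y) := f :* x :+ (:- t) :* (f :* y)) ≈-refl (f j) (x j) t (y j)) ⟩
    sum (λ j → f j * x j + (- t) * (f j * y j))
      ≈⟨ sum-linear (λ j → f j * x j) (λ j → f j * y j) (- t) ⟩
    f · x + (- t) * (f · y)
      ≈⟨ solve 3 (λ a t b → a :+ (:- t) :* b := a :- t :* b) ≈-refl _ _ _ ⟩
    f · x - t * (f · y) ∎
    where open ≈R

  shear-· : (t : Carrier) (g f x : Point d) → shear t g f · x ≈ f · x - t * (g · x)
  shear-· t g f x = ≈-trans (·-comm (shear t g f) x) (≈-trans (·-shear x t g f)
    (+-cong (·-comm x f) (-‿cong (*-congˡ (·-comm x g)))))

  ·-⊖ : (f x y : Point d) → f · (x ⊖ y) ≈ f · x - f · y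
  ·-⊖ f x y = ≈-trans
    (sum-cong-≋ (λ j → solve 3 (λ f x y → f :* (x :- y) := f :* x :- f :* y) ≈-refl (f j) (x j) (y j)))
    (sum-minus (λ j → f j * x j) (λ j → f j * y j))

  ·-0ᵖ : (f : Point d) → f · 0ᵖ ≈ 0#
  ·-0ᵖ f = sum-zero (λ j → zeroʳ (f j))

  ·-neg : (f x : Point d) → f · (-ᵖ x) ≈ - (f · x)
  ·-neg f x = begin
    f · (-ᵖ x)         ≈⟨ ·-congˡ f (λ j → +-identityˡ (- x j)) ⟨
    f · (0ᵖ ⊖ x)       ≈⟨ ·-⊖ f 0ᵖ x ⟩
    f · 0ᵖ - f · x     ≈⟨ +-congʳ (·-0ᵖ f) ⟩
    0# - f · x         ≈⟨ +-identityˡ _ ⟩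
    - (f · x)          ∎
    where open ≈R

  neg-· : (f x : Point d) → (-ᵖ f) · x ≈ - (f · x)
  neg-· f x = ≈-trans (·-comm (-ᵖ f) x) (≈-trans (·-neg x f) (-‿cong (·-comm x f)))

  ·-combination : (f : Point d) (μ : Vector Carrier k) (a : Vector (Point d) k) →
                  f · combination μ a ≈ sum (λ i → μ i * (f · a i))
  ·-combination {d} {k} f μ a = begin
    sum (λ j → f j * sum (λ i → μ i * a i j))     ≈⟨ sum-cong-≋ (λ j → *-distribˡ-sum (f j) (λ i → μ i * a i j)) ⟩
    sum (λ j → sum (λ i → f j * (μ i * a i j)))   ≈⟨ ∑-comm (λ j i → f j * (μ i * a i j)) ⟩
    sum (λ i → sum (λ j → f j * (μ i * a i j)))
      ≈⟨ sum-cong-≋ (λ i → sum-cong-≋ (λ j → solve 3 (λ f m a → f :* (m :* a) := m :* (f :* a)) ≈-refl (f j) (μ i) (a i j))) ⟩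
    sum (λ i → sum (λ j → μ i * (f j * a i j)))   ≈⟨ sum-cong-≋ (λ i → *-distribˡ-sum (μ i) (λ j → f j * a i j)) ⟨
    sum (λ i → μ i * (f · a i))                   ∎
    where open ≈R

  combination-combination : (μ : Vector Carrier k) (M : Fin k → Vector Carrier l) (a : Vector (Point d) l) →
    combination μ (λ i → combination (M i) a) ≋ combination (λ m → sum (λ i → μ i * M i m)) a
  combination-combination μ M a j = begin
    sum (λ i → μ i * sum (λ m → M i m * a m j))     ≈⟨ sum-cong-≋ (λ i → *-distribˡ-sum (μ i) (λ m → M i m * a m j)) ⟩
    sum (λ i → sum (λ m → μ i * (M i m * a m j)))   ≈⟨ ∑-comm (λ i m → μ i * (M i m * a m j)) ⟩
    sum (λ m → sum (λ i → μ i * (M i m * a m j)))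
      ≈⟨ sum-cong-≋ (λ m → sum-cong-≋ (λ i → solve 3 (λ u v w → u :* (v :* w) := u :* v :* w) ≈-refl (μ i) (M i m) (a m j))) ⟩
    sum (λ m → sum (λ i → μ i * M i m * a m j))     ≈⟨ sum-cong-≋ (λ m → *-distribʳ-sum (a m j) (λ i → μ i * M i m)) ⟨
    sum (λ m → sum (λ i → μ i * M i m) * a m j)     ∎
    where open ≈R

  ⊖≋0 : {x y : Point d} → x ⊖ y ≋ 0ᵖ → x ≋ y
  ⊖≋0 e j = diff≈0 (e j)

  ≋0? : (b : Point d) → (b ≋ 0ᵖ) ⊎ ∃[ j ] ¬ (b j ≈ 0#)
  ≋0? {zero} b = inj₁ λ ()
  ≋0? {suc d} b with ≈0? (b zero) | ≋0? (b ∘ suc)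
  ... | inj₂ ¬e | _ = inj₂ (zero , ¬e)
  ... | inj₁ e | inj₁ es = inj₁ λ { zero → e ; (suc j) → es j }
  ... | inj₁ e | inj₂ (j , ¬e) = inj₂ (suc j , ¬e)

  indicator : Fin k → Vector Carrier k
  indicator i j with i Fin.≟ j
  ... | yes _ = 1#
  ... | no _ = 0#

  indicator-≡ : (i : Fin k) → indicator i i ≈ 1#
  indicator-≡ i with i Fin.≟ i
  ... | yes _ = ≈-refl
  ... | no i≢i = contradiction ≡.refl i≢i

  indicator-≢ : (i j : Fin k) → j ≢ i → indicator i j ≈ 0#
  indicator-≢ i j j≢i with i Fin.≟ j
  ... | yes i≡j = contradiction (≡.sym i≡j) j≢i
  ... | no _ = ≈-refl

  indicator-nn : (i j : Fin k) → 0# ≤ indicator i j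
  indicator-nn i j with i Fin.≟ j
  ... | yes _ = inj₁ 0<1
  ... | no _ = 0≤0

  sum-indicator : (i : Fin k) (f : Vector Carrier k) → sum (λ j → indicator i j * f j) ≈ f i
  sum-indicator i f = ≈-trans
    (sum-single (λ j → indicator i j * f j) i (λ j j≢i → ≈-trans (*-congʳ (indicator-≢ i j j≢i)) (zeroˡ (f j))))
    (≈-trans (*-congʳ (indicator-≡ i)) (*-identityˡ (f i)))

  combination-indicator : (i : Fin k) (a : Vector (Point d) k) → combination (indicator i) a ≋ a i
  combination-indicator i a j = sum-indicator i (λ m → a m j)

  Dependent : Vector (Point d) k → Set
  Dependent {k = k} a =
    Σ[ α ∈ Vector Carrier k ] ((∃[ i ] ¬ (α i ≈ 0#)) × combination α a ≋ 0ᵖ)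

  -- Gaussian elimination on the first coordinate.
  dependent : (a : Vector (Point d) k) → d ℕ.< k → Dependent a
  dependent {zero} {suc k} a _ = (λ _ → 1#) , (zero , 1≉0) , λ ()
  dependent {suc d} {suc k} a (s≤s d<k) with ≋0? (λ i → a i zero)
  ... | inj₁ e =
    let α , nz , eq = dependent (λ i j → a i (suc j)) (ℕ.m≤n⇒m≤1+n d<k)
    in α , nz , λ { zero → sum-zero (λ i → ≈-trans (*-congˡ (e i)) (zeroʳ (α i))) ; (suc j) → eq j }
  ... | inj₂ (p , a≉0) =
    let α , (i , nz) , eq = dependent (λ i j → reduced i (suc j)) d<k
        eq′ : combination α reduced ≋ 0ᵖ
        eq′ = λ { zero → sum-zero (λ i → ≈-trans (*-congˡ (reduced-zero i)) (zeroʳ (α i))) ; (suc j) → eq j }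
    in insertAt α p (α₀ α)
     , (punchIn p i , λ z → nz (≈-trans (≈-reflexive (≡.sym (VecF.insertAt-punchIn α p (α₀ α) i))) z))
     , λ j → ≈-trans (expand α j) (eq′ j)
    where
    open ≈R
    c : Fin k → Carrier
    c i = a (punchIn p i) zero * a p zero ⁻¹
    reduced : Vector (Point (suc d)) k
    reduced i = shear (c i) (a p) (a (punchIn p i))
    reduced-zero : ∀ i → reduced i zero ≈ 0#
    reduced-zero i = begin
      x - x * u ⁻¹ * u     ≈⟨ solve 3 (λ x u v → x :- x :* v :* u := x :- x :* (u :* v)) ≈-refl x u (u ⁻¹) ⟩
      x - x * (u * u ⁻¹)   ≈⟨ +-congˡ (-‿cong (≈-trans (*-congˡ (⁻¹-inverseʳ a≉0)) (≈-trans (*-comm x 1#) (*-identityˡ x)))) ⟩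
      x - x                ≈⟨ -‿inverseʳ x ⟩
      0#                   ∎
      where
      x = a (punchIn p i) zero
      u = a p zero
    -- The reduction subtracts `c i` times the pivot from each remaining vector, so the coefficient
    -- of the pivot has to collect these multiples.
    α₀ : Vector Carrier k → Carrier
    α₀ α = sum (λ i → α i * (- c i))
    expand : (α : Vector Carrier k) → combination (insertAt α p (α₀ α)) a ≋ combination α reduced
    expand α j = begin
      sum t                                                ≈⟨ sum-remove {i = p} t ⟩
      t p + sum (t ∘ punchIn p)
        ≈⟨ +-cong (*-congʳ (≈-reflexive (VecF.insertAt-lookup α p (α₀ α))))
             (sum-cong-≋ (λ i → *-congʳ (≈-reflexive (VecF.insertAt-punchIn α p (α₀ α) i)))) ⟩
      α₀ α * a p j + sum (λ i → α i * a (punchIn p i) j)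
        ≈⟨ ≈-trans (+-comm _ _) (+-congˡ (*-comm _ _)) ⟩
      sum (λ i → α i * a (punchIn p i) j) + a p j * α₀ α
        ≈⟨ sum-linear (λ i → α i * a (punchIn p i) j) (λ i → α i * (- c i)) (a p j) ⟨
      sum (λ i → α i * a (punchIn p i) j + a p j * (α i * (- c i)))
        ≈⟨ sum-cong-≋ (λ i → solve 4 (λ α x y c → α :* x :+ y :* (α :* (:- c)) := α :* (x :- c :* y)) ≈-refl
             (α i) (a (punchIn p i) j) (a p j) (c i)) ⟩
      sum (λ i → α i * (a (punchIn p i) j - c i * a p j)) ∎
      where
      t : Vector Carrier (suc k)
      t i = insertAt α p (α₀ α) i * a i j

  Spanned : Vector (Point d) k → Point d → Set
  Spanned {k = k} a b = Σ[ μ ∈ Vector Carrier k ] (b ≋ combination μ a)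

  Cone : Vector (Point d) k → Point d → Set
  Cone {k = k} a b = Σ[ μ ∈ Vector Carrier k ] ((∀ i → 0# ≤ μ i) × b ≋ combination μ a)

  cone-generator : (a : Vector (Point d) k) (i : Fin k) → Cone a (a i)
  cone-generator a i = indicator i , indicator-nn i , λ j → ≈-sym (combination-indicator i a j)

  cone-trans : {a : Vector (Point d) k} {c : Vector (Point d) l} {b : Point d} →
               (∀ i → Cone a (c i)) → Cone c b → Cone a b
  cone-trans {k = k} {a = a} {c} cones (μ , μ≥0 , e) =
    (λ m → sum (λ i → μ i * M i m)) ,
    (λ m → sum-nn (λ i → nn*nn (μ≥0 i) (proj₁ (proj₂ (cones i)) m))) ,
    λ j → ≈-trans (e j) (≈-trans (sum-cong-≋ (λ i → *-congˡ (proj₂ (proj₂ (cones i)) j)))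
      (combination-combination μ M a j))
    where
    M : ∀ i → Vector Carrier k
    M i = proj₁ (cones i)

  private
    self-pos : (b : Point d) → ∃[ j ] ¬ (b j ≈ 0#) → 0# < b · b
    self-pos b (j , b≉0) = sum-pos nn j (square-pos b≉0)
      where
      nn : ∀ i → 0# ≤ b i * b i
      nn i with ≈0? (b i)
      ... | inj₁ e = inj₂ (≈-sym (≈-trans (*-congʳ e) (zeroˡ (b i))))
      ... | inj₂ ¬e = inj₁ (square-pos ¬e)

    0*-drop : ∀ x {y z : Carrier} → z ≈ y → z ≈ 0# * x + y
    0*-drop x e = ≈-sym (≈-trans (+-congʳ (zeroˡ x)) (≈-trans (+-identityˡ _) (≈-sym e)))

    unshear : ∀ {x t y z : Carrier} → x - t * y ≈ z → x ≈ t * y + z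
    unshear {x} {t} {y} e =
      ≈-trans (solve 3 (λ x t y → x := t :* y :+ (x :- t :* y)) ≈-refl x t y) (+-congˡ e)

    cancel⁻¹ : ∀ {s} u → ¬ (s ≈ 0#) → u - u * s ⁻¹ * s ≈ 0#
    cancel⁻¹ {s} u s≉0 = begin
      u - u * s ⁻¹ * s     ≈⟨ solve 3 (λ u s q → u :- u :* q :* s := u :- (s :* q) :* u) ≈-refl u s (s ⁻¹) ⟩
      u - s * s ⁻¹ * u     ≈⟨ +-congˡ (-‿cong (≈-trans (*-congʳ (⁻¹-inverseʳ s≉0)) (*-identityˡ u))) ⟩
      u - u                ≈⟨ -‿inverseʳ u ⟩
      0#                   ∎
      where open ≈R

  -- Linear counterpart of `farkas`. If `f` separates `b` from the tail but does not kill the head,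
  -- `b` is projected along the head onto the kernel of `f`. Either this projection is in the span
  -- of the tail, or the functional `g` separating it is corrected by a multiple of `f` so as to
  -- vanish on the head; its value at `b` is then that of `g` at the projection.
  span-or-separate : (a : Vector (Point d) k) (b : Point d) →
                     Spanned a b ⊎ ∃[ f ] ((∀ i → f · a i ≈ 0#) × 0# < f · b)
  span-or-separate {k = zero} a b with ≋0? b
  ... | inj₁ e = inj₁ ((λ ()) , e)
  ... | inj₂ nz = inj₂ (b , (λ ()) , self-pos b nz)
  span-or-separate {k = suc k} a b with span-or-separate (a ∘ suc) b
  ... | inj₁ (μ , e) = inj₁ ((0# ▹ μ) , λ j → 0*-drop (a zero j) (e j))
  ... | inj₂ (f , f0 , fb) with ≈0? (f · a zero)
  ...   | inj₁ e = inj₂ (f , (λ { zero → e ; (suc i) → f0 i }) , fb)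
  ...   | inj₂ s≉0 with span-or-separate (a ∘ suc) (shear (f · b * (f · a zero) ⁻¹) (a zero) b)
  ...     | inj₁ (μ , e) = inj₁ (((f · b * (f · a zero) ⁻¹) ▹ μ) , λ j → unshear (e j))
  ...     | inj₂ (g , g0 , gb) = inj₂ (h , h0 , pos-resp (≈-sym hb) gb)
    where
    open ≈R
    q = (f · a zero) ⁻¹
    h = shear (g · a zero * q) f g
    h0 : ∀ i → h · a i ≈ 0#
    h0 zero = ≈-trans (shear-· _ f g (a zero)) (cancel⁻¹ (g · a zero) s≉0)
    h0 (suc i) = ≈-trans (shear-· _ f g (a (suc i))) (≈-trans (+-cong (g0 i) (-‿cong (≈-trans (*-congˡ (f0 i)) (zeroʳ _)))) (-‿inverseʳ 0#))
    hb : h · b ≈ g · shear (f · b * q) (a zero) b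
    hb = ≈-trans (shear-· _ f g b) (≈-trans
      (solve 4 (λ x y q z → x :- y :* q :* z := x :- z :* q :* y) ≈-refl (g · b) (g · a zero) q (f · b))
      (≈-sym (·-shear g (f · b * q) (a zero) b)))

  -- Bartl's induction on the number of generators.
  farkas : (a : Vector (Point d) k) (b : Point d) →
           Cone a b ⊎ ∃[ f ] ((∀ i → f · a i ≤ 0#) × 0# < f · b)
  farkas {k = zero} a b with ≋0? b
  ... | inj₁ e = inj₁ ((λ ()) , (λ ()) , e)
  ... | inj₂ nz = inj₂ (b , (λ ()) , self-pos b nz)
  farkas {k = suc k} a b with farkas (a ∘ suc) b
  ... | inj₁ (μ , μ≥0 , e) = inj₁ ((0# ▹ μ) , (λ { zero → 0≤0 ; (suc i) → μ≥0 i }) , λ j → 0*-drop (a zero j) (e j))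
  ... | inj₂ (f , f≤0 , fb) with compare 0# (f · a zero)
  ...   | tri≈ _ e _ = inj₂ (f , (λ { zero → inj₂ (≈-sym e) ; (suc i) → f≤0 i }) , fb)
  ...   | tri> _ _ p = inj₂ (f , (λ { zero → inj₁ p ; (suc i) → f≤0 i }) , fb)
  ...   | tri< s>0 _ _ = finish (farkas a′ b′)
    where
    open ≈R
    q = (f · a zero) ⁻¹
    c : Fin k → Carrier
    c i = f · a (suc i) * q
    a′ : Vector (Point _) k
    a′ i = shear (c i) (a zero) (a (suc i))
    b′ = shear (f · b * q) (a zero) b
    -- `f` is nonpositive on the tail and positive on the head, so the projection onto the kernel of
    -- `f` adds nonnegative multiples of the head to the tail. This is why a cone representation of
    -- the projected `b` lifts back.
    -c≥0 : ∀ i → 0# ≤ - c i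
    -c≥0 i = nn-resp (solve 2 (λ x q → (:- x) :* q := :- (x :* q)) ≈-refl (f · a (suc i)) q)
      (nn*nn (nn-neg (f≤0 i)) (inj₁ (⁻¹-pos s>0)))
    finish : Cone a′ b′ ⊎ ∃[ g ] ((∀ i → g · a′ i ≤ 0#) × 0# < g · b′) →
             Cone a b ⊎ ∃[ f ] ((∀ i → f · a i ≤ 0#) × 0# < f · b)
    finish (inj₁ (μ , μ≥0 , e)) = inj₁ (((f · b * q + sum (λ i → μ i * (- c i))) ▹ μ)
      , (λ { zero → nn+nn (nn*nn (inj₁ fb) (inj₁ (⁻¹-pos s>0))) (sum-nn (λ i → nn*nn (μ≥0 i) (-c≥0 i)))
           ; (suc i) → μ≥0 i })
      , λ j → begin
          b j
            ≈⟨ unshear (e j) ⟩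
          f · b * q * a zero j + sum (λ i → μ i * (a (suc i) j - c i * a zero j))
            ≈⟨ +-congˡ (sum-cong-≋ (λ i → solve 4 (λ m x c y → m :* (x :- c :* y) := m :* x :+ y :* (m :* (:- c))) ≈-refl
                 (μ i) (a (suc i) j) (c i) (a zero j))) ⟩
          f · b * q * a zero j + sum (λ i → μ i * a (suc i) j + a zero j * (μ i * (- c i)))
            ≈⟨ +-congˡ (sum-linear (λ i → μ i * a (suc i) j) (λ i → μ i * (- c i)) (a zero j)) ⟩
          f · b * q * a zero j + (sum (λ i → μ i * a (suc i) j) + a zero j * sum (λ i → μ i * (- c i)))
            ≈⟨ solve 4 (λ u y s t → u :* y :+ (s :+ y :* t) := (u :+ t) :* y :+ s) ≈-refl (f · b * q) (a zero j) _ _ ⟩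
          (f · b * q + sum (λ i → μ i * (- c i))) * a zero j + sum (λ i → μ i * a (suc i) j) ∎)
    finish (inj₂ (g , g≤0 , gb)) = inj₂ (h , h≤0 , pos-resp (swap b) gb)
      where
      h = shear (g · a zero * q) f g
      swap : ∀ x → g · shear (f · x * q) (a zero) x ≈ h · x
      swap x = ≈-trans (·-shear g (f · x * q) (a zero) x) (≈-trans
        (solve 4 (λ x y q z → x :- z :* q :* y := x :- y :* q :* z) ≈-refl (g · x) (g · a zero) q (f · x))
        (≈-sym (shear-· _ f g x)))
      h≤0 : ∀ i → h · a i ≤ 0#
      h≤0 zero = inj₂ (≈-trans (shear-· _ f g (a zero)) (cancel⁻¹ (g · a zero) (pos≉0 s>0)))
      h≤0 (suc i) = ≤-respˡ (swap (a (suc i))) (g≤0 i)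

-- Irredundant generators, exposed rays and dual bases.

module ConvexCones (em : ExcludedMiddle 0ℓ) (ℝ : RealField) where
  open LinearAlgebra ℝ public

  private
    variable
      d k l n : ℕ

  -- Weights on all generators with the one at `j` equal to zero stand for the cone of the others,
  -- which avoids reindexing.
  Irredundant : Vector (Point d) k → Set
  Irredundant {k = k} a = (j : Fin k) (μ : Vector Carrier k) →
    (∀ i → 0# ≤ μ i) → μ j ≈ 0# → ¬ (a j ≋ combination μ a)

  -- Excluded middle decides whether some generator is redundant; removing it keeps the cone and
  -- lowers the number of generators.
  irredundant-generators : (a : Vector (Point d) k) →
    ∃[ r ] Σ[ σ ∈ (Fin r → Fin k) ] ((∀ i → Cone (a ∘ σ) (a i)) × Irredundant (a ∘ σ))
  irredundant-generators {k = zero} a = 0 , (λ ()) , (λ ()) , λ ()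
  irredundant-generators {d} {suc k} a
    with em {P = ∃[ j ] Σ[ μ ∈ Vector Carrier (suc k) ] ((∀ i → 0# ≤ μ i) × μ j ≈ 0# × a j ≋ combination μ a)}
  ... | no irr = suc k , id , cone-generator a , λ j μ μ≥0 μj e → irr (j , μ , μ≥0 , μj , e)
  ... | yes (j , μ , μ≥0 , μj , e) =
    let r , σ , cones , irr = irredundant-generators (a ∘ punchIn j)
        cone-j : Cone (a ∘ punchIn j) (a j)
        cone-j = μ ∘ punchIn j , μ≥0 ∘ punchIn j , λ m → ≈-trans (e m)
          (≈-trans (sum-remove {i = j} (λ i → μ i * a i m))
            (≈-trans (+-congʳ (≈-trans (*-congʳ μj) (zeroˡ (a j m)))) (+-identityˡ _)))
        cone : ∀ i → Dec (j ≡ i) → Cone (a ∘ punchIn j ∘ σ) (a i)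
        cone i = λ
          { (yes ≡.refl) → cone-trans cones cone-j
          ; (no j≢i) → ≡.subst (λ m → Cone (a ∘ punchIn j ∘ σ) (a m)) (Fin.punchIn-punchOut j≢i) (cones (punchOut j≢i)) }
    in r , punchIn j ∘ σ , (λ i → cone i (j Fin.≟ i)) , irr

  module _ {d k} (a : Vector (Point d) k) (irr : Irredundant a)
           (p : Point d) (p<0 : ∀ i → p · a i < 0#) where

    private
      module _ (j i : Fin k) (i≢j : i ≢ j) where

        -- A relation aᵢ + Σ μₗ aₗ = ν aⱼ with μ, ν ≥ 0, evaluated at p, shows that ν exceeds μⱼ;
        -- so aⱼ would be in the cone of the others.
        no-relation : ¬ Cone ((-ᵖ a j) ▹ a) (-ᵖ a i)
        no-relation (ν , ν≥0 , e) = irr j ρ ρ≥0 (≈-trans (*-congˡ κj) (zeroʳ _)) λ m → begin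
          a j m                                    ≈⟨ *-identityˡ _ ⟨
          1# * a j m                               ≈⟨ *-congʳ (⁻¹-inverseʳ (pos≉0 τ>0)) ⟨
          τ * τ ⁻¹ * a j m                         ≈⟨ solve 3 (λ t q x → t :* q :* x := q :* (t :* x)) ≈-refl τ (τ ⁻¹) (a j m) ⟩
          τ ⁻¹ * (τ * a j m)                       ≈⟨ *-congˡ (relation m) ⟨
          τ ⁻¹ * sum (λ l → κ l * a l m)           ≈⟨ *-distribˡ-sum (τ ⁻¹) (λ l → κ l * a l m) ⟩
          sum (λ l → τ ⁻¹ * (κ l * a l m))         ≈⟨ sum-cong-≋ (λ l → solve 3 (λ u v w → u :* (v :* w) := u :* v :* w) ≈-refl (τ ⁻¹) (κ l) (a l m)) ⟩
          sum (λ l → τ ⁻¹ * κ l * a l m)           ∎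
          where
          open ≈R
          μ : Vector Carrier k
          μ = ν ∘ suc
          τ = ν zero - μ j
          κ : Vector Carrier k
          κ l with l Fin.≟ j
          ... | yes _ = 0#
          ... | no _ = μ l + indicator i l
          κ≥0 : ∀ l → 0# ≤ κ l
          κ≥0 l with l Fin.≟ j
          ... | yes _ = 0≤0
          ... | no _ = nn+nn (ν≥0 (suc l)) (indicator-nn i l)
          κj : κ j ≈ 0#
          κj with j Fin.≟ j
          ... | yes _ = ≈-refl
          ... | no j≢j = contradiction ≡.refl j≢j
          κi>0 : 0# < κ i
          κi>0 with i Fin.≟ j
          ... | yes i≡j = contradiction i≡j i≢j
          ... | no _ = nn+pos (ν≥0 (suc i)) (pos-resp (≈-sym (indicator-≡ i)) 0<1)
          split : ∀ l → κ l ≈ (μ l + indicator i l) - μ j * indicator j l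
          split l with l Fin.≟ j
          ... | yes ≡.refl = ≈-sym (≈-trans (+-cong (≈-trans (+-congˡ (indicator-≢ i l (i≢j ∘ ≡.sym))) (+-identityʳ _))
                 (-‿cong (≈-trans (*-congˡ (indicator-≡ l)) (≈-trans (*-comm _ _) (*-identityˡ _))))) (-‿inverseʳ _))
          ... | no l≢j = ≈-sym (≈-trans (+-congˡ (≈-trans (-‿cong (≈-trans (*-congˡ (indicator-≢ j l l≢j)) (zeroʳ _))) -0#≈0#)) (+-identityʳ _))
          relation : ∀ m → sum (λ l → κ l * a l m) ≈ τ * a j m
          relation m = begin
            sum (λ l → κ l * a l m)
              ≈⟨ sum-cong-≋ (λ l → ≈-trans (*-congʳ (split l))
                   (solve 5 (λ u v w x y → (u :+ v :- w :* x) :* y := (u :* y :+ v :* y) :+ (:- w) :* (x :* y)) ≈-refl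
                     (μ l) (indicator i l) (μ j) (indicator j l) (a l m))) ⟩
            sum (λ l → (μ l * a l m + indicator i l * a l m) + (- μ j) * (indicator j l * a l m))
              ≈⟨ sum-linear (λ l → μ l * a l m + indicator i l * a l m) (λ l → indicator j l * a l m) (- μ j) ⟩
            sum (λ l → μ l * a l m + indicator i l * a l m) + (- μ j) * sum (λ l → indicator j l * a l m)
              ≈⟨ +-cong (∑-distrib-+ (λ l → μ l * a l m) (λ l → indicator i l * a l m)) (*-congˡ (combination-indicator j a m)) ⟩
            (sum (λ l → μ l * a l m) + combination (indicator i) a m) + (- μ j) * a j m
              ≈⟨ +-congʳ (+-congˡ (≈-trans (combination-indicator i a m)
                   (≈-trans (solve 1 (λ x → x := :- (:- x)) ≈-refl (a i m)) (-‿cong (e m))))) ⟩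
            (sum (λ l → μ l * a l m) + - (ν zero * - a j m + sum (λ l → μ l * a l m))) + (- μ j) * a j m
              ≈⟨ solve 4 (λ s n x w → (s :+ :- (n :* (:- x) :+ s)) :+ (:- w) :* x := (n :- w) :* x) ≈-refl _ (ν zero) (a j m) (μ j) ⟩
            τ * a j m ∎
          pτ : τ * (- p · a j) ≈ sum (λ l → κ l * (- p · a l))
          pτ = begin
            τ * (- p · a j)                         ≈⟨ solve 2 (λ t x → t :* (:- x) := :- (t :* x)) ≈-refl τ (p · a j) ⟩
            - (τ * p · a j)                         ≈⟨ -‿cong (≈-trans (*-distribˡ-sum τ (λ m → p m * a j m))
                   (sum-cong-≋ (λ m → solve 3 (λ t u v → t :* (u :* v) := u :* (t :* v)) ≈-refl τ (p m) (a j m)))) ⟩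
            - (p · (λ m → τ * a j m))               ≈⟨ -‿cong (·-congˡ p relation) ⟨
            - (p · combination κ a)                 ≈⟨ neg-· p (combination κ a) ⟨
            (-ᵖ p) · combination κ a                ≈⟨ ·-combination (-ᵖ p) κ a ⟩
            sum (λ l → κ l * (-ᵖ p) · a l)          ≈⟨ sum-cong-≋ (λ l → *-congˡ (neg-· p (a l))) ⟩
            sum (λ l → κ l * (- p · a l))           ∎
          τ>0 : 0# < τ
          τ>0 with compare 0# τ
          ... | tri< τ>0 _ _ = τ>0
          ... | tri≈ _ τ≈0 _ = contradiction (≈-trans (≈-sym pτ) (≈-trans (*-congʳ (≈-sym τ≈0)) (zeroˡ _)))
                 (pos≉0 (sum-pos (λ l → nn*nn (κ≥0 l) (inj₁ (neg-pos (p<0 l)))) i (*-pos κi>0 (neg-pos (p<0 i)))))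
          ... | tri> _ _ τ<0 = contradiction
                 (sum-pos (λ l → nn*nn (κ≥0 l) (inj₁ (neg-pos (p<0 l)))) i (*-pos κi>0 (neg-pos (p<0 i))))
                 (λ pos → <-asym (pos-resp (≈-sym pτ) pos)
                   (neg-neg (pos-resp (solve 2 (λ t x → (:- t) :* x := :- (t :* x)) ≈-refl τ _)
                     (*-pos (neg-pos τ<0) (neg-pos (p<0 j))))))
          ρ : Vector Carrier k
          ρ l = τ ⁻¹ * κ l
          ρ≥0 : ∀ l → 0# ≤ ρ l
          ρ≥0 l = nn*nn (inj₁ (⁻¹-pos τ>0)) (κ≥0 l)

        -- Adding `-ᵖ a j` to the generators forces the functional from Farkas' lemma to vanish on
        -- `a j`; the target `-ᵖ a i` makes it negative on `a i`.
        separate : ∃[ f ] (f · a j ≈ 0# × f · a i < 0# × (∀ l → f · a l ≤ 0#))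
        separate with farkas ((-ᵖ a j) ▹ a) (-ᵖ a i)
        ... | inj₁ cone = contradiction cone no-relation
        ... | inj₂ (f , f≤0 , fi) =
          f , ≤-antisym (f≤0 (suc j)) (≤-trans (nn-neg (f≤0 zero)) (inj₂ (≈-trans (-‿cong (·-neg f (a j)))
                (solve 1 (λ x → :- (:- x) := x) ≈-refl _))))
            , neg-neg (pos-resp (·-neg f (a i)) fi) , f≤0 ∘ suc

    -- The functionals separating `a j` from each single `a i` are summed: none is positive on a
    -- generator, all vanish on `a j`, and the summand for `i` is strict at `a i`.
    exposed : ∀ j → ∃[ f ] (f · a j ≈ 0# × (∀ i → i ≢ j → f · a i < 0#))
    exposed j = f , ≈-trans (eval j) (sum-zero λ i → proj₁ (proj₂ (part i (i Fin.≟ j)))) ,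
      λ i i≢j → neg-neg (pos-resp (≈-sym (neg-eval i))
        (sum-pos (λ m → nn-neg (proj₂ (proj₂ (proj₂ (part m (m Fin.≟ j)))) i)) i
          (neg-pos (proj₁ (proj₂ (proj₂ (part i (i Fin.≟ j)))) i≢j))))
      where
      part : ∀ i → Dec (i ≡ j) → ∃[ f ] (f · a j ≈ 0# × (i ≢ j → f · a i < 0#) × (∀ l → f · a l ≤ 0#))
      part i (no i≢j) = let f , fj , fi , f≤0 = separate j i i≢j in f , fj , (λ _ → fi) , f≤0
      part i (yes i≡j) = 0ᵖ , zero-at j , contradiction i≡j , inj₂ ∘ zero-at
        where
        zero-at : ∀ l → 0ᵖ · a l ≈ 0#
        zero-at l = ≈-trans (·-comm 0ᵖ (a l)) (·-0ᵖ (a l))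
      F : Vector (Point d) k
      F i = proj₁ (part i (i Fin.≟ j))
      f = combination (λ _ → 1#) F
      eval : ∀ l → f · a l ≈ sum (λ i → F i · a l)
      eval l = ≈-trans (·-comm f (a l)) (≈-trans (·-combination (a l) (λ _ → 1#) F)
        (sum-cong-≋ (λ i → ≈-trans (*-identityˡ _) (·-comm (a l) (F i)))))
      neg-eval : ∀ l → - (f · a l) ≈ sum (λ i → - (F i · a l))
      neg-eval l = ≈-trans (-‿cong (eval l)) (≈-sym (sum-neg (λ i → F i · a l)))

  Independent : Vector (Point d) k → Set
  Independent {k = k} r = (α : Vector Carrier k) → combination α r ≋ 0ᵖ → ∀ i → α i ≈ 0#

  private
    others : Fin k → Vector (Point d) k → Vector (Point d) k
    others j r i with i Fin.≟ j
    ... | yes _ = 0ᵖ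
    ... | no _ = r i

  -- `others` puts zero in place of `r j`. If this family spanned `r j`, there would be a relation
  -- with coefficient one at `j`. So some functional kills the rest and is positive on `r j`, and it
  -- is rescaled to the value one.
  dual-functional : (r : Vector (Point d) k) → Independent r → ∀ j →
                    ∃[ φ ] (φ · r j ≈ 1# × (∀ i → i ≢ j → φ · r i ≈ 0#))
  dual-functional {d} {k} r ind j with span-or-separate (others j r) (r j)
  ... | inj₂ (f , f0 , fj) = φ , φj , λ i i≢j → ≈-trans (scaled (r i)) (≈-trans (*-congˡ (others0 i i≢j)) (zeroʳ _))
    where
    φ : Point d
    φ m = (f · r j) ⁻¹ * f m
    scaled : ∀ x → φ · x ≈ (f · r j) ⁻¹ * f · x
    scaled x = ≈-trans (sum-cong-≋ (λ m → solve 3 (λ u v w → u :* v :* w := u :* (v :* w)) ≈-refl _ (f m) (x m)))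
      (≈-sym (*-distribˡ-sum _ (λ m → f m * x m)))
    φj : φ · r j ≈ 1#
    φj = ≈-trans (scaled (r j)) (≈-trans (*-comm _ _) (⁻¹-inverseʳ (pos≉0 fj)))
    others0 : ∀ i → i ≢ j → f · r i ≈ 0#
    others0 i i≢j with i Fin.≟ j | f0 i
    ... | yes i≡j | _ = contradiction i≡j i≢j
    ... | no _ | e = e
  ... | inj₁ (μ , e) = contradiction (≈-trans (≈-sym αj) (ind α dep j)) 1≉0
    where
    open ≈R
    ν : Vector Carrier k
    ν i with i Fin.≟ j
    ... | yes _ = 0#
    ... | no _ = μ i
    α : Vector Carrier k
    α i = indicator j i - ν i
    νj : ν j ≈ 0#
    νj with j Fin.≟ j
    ... | yes _ = ≈-refl
    ... | no j≢j = contradiction ≡.refl j≢j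
    αj : α j ≈ 1#
    αj = ≈-trans (+-cong (indicator-≡ j) (≈-trans (-‿cong νj) -0#≈0#)) (+-identityʳ 1#)
    dep : combination α r ≋ 0ᵖ
    dep m = begin
      sum (λ i → (indicator j i - ν i) * r i m)
        ≈⟨ sum-cong-≋ (λ i → solve 3 (λ u v w → (u :- v) :* w := u :* w :- v :* w) ≈-refl (indicator j i) (ν i) (r i m)) ⟩
      sum (λ i → indicator j i * r i m - ν i * r i m)
        ≈⟨ sum-minus (λ i → indicator j i * r i m) (λ i → ν i * r i m) ⟩
      combination (indicator j) r m - sum (λ i → ν i * r i m)
        ≈⟨ +-cong (combination-indicator j r m) (-‿cong (≈-trans (sum-cong-≋ νμ) (≈-sym (e m)))) ⟩
      r j m - r j m
        ≈⟨ -‿inverseʳ _ ⟩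
      0# ∎
      where
      νμ : ∀ i → ν i * r i m ≈ μ i * others j r i m
      νμ i with i Fin.≟ j
      ... | yes _ = ≈-trans (zeroˡ _) (≈-sym (zeroʳ (μ i)))
      ... | no _ = ≈-refl

  -- The d + 1 vectors `y` and `r` are dependent, and independence of `r` makes the coefficient of
  -- `y` nonzero, so the relation can be solved for `y`.
  independent-spans : (r : Vector (Point d) d) → Independent r → ∀ y → Spanned r y
  independent-spans {d} r ind y with dependent (y ▹ r) ℕ.≤-refl
  ... | α , (i , αi) , e with ≈0? (α zero)
  ...   | inj₂ α₀ = (λ i → (- (α zero ⁻¹)) * α (suc i)) , λ m → begin
    y m                                                        ≈⟨ *-identityˡ _ ⟨
    1# * y m                                                   ≈⟨ *-congʳ (⁻¹-inverseʳ α₀) ⟨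
    α zero * α zero ⁻¹ * y m
      ≈⟨ solve 4 (λ a q y s → a :* q :* y := q :* (a :* y :+ s) :+ (:- q) :* s) ≈-refl (α zero) (α zero ⁻¹) (y m) _ ⟩
    α zero ⁻¹ * (α zero * y m + rest m) + (- (α zero ⁻¹)) * rest m
      ≈⟨ ≈-trans (+-congʳ (≈-trans (*-congˡ (e m)) (zeroʳ _))) (+-identityˡ _) ⟩
    (- (α zero ⁻¹)) * rest m                                     ≈⟨ *-distribˡ-sum _ (λ i → α (suc i) * r i m) ⟩
    sum (λ i → (- (α zero ⁻¹)) * (α (suc i) * r i m))
      ≈⟨ sum-cong-≋ (λ i → solve 3 (λ u v w → u :* (v :* w) := u :* v :* w) ≈-refl _ (α (suc i)) (r i m)) ⟩
    sum (λ i → (- (α zero ⁻¹)) * α (suc i) * r i m)              ∎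
    where
    open ≈R
    rest : Point d
    rest = combination (α ∘ suc) r
  ...   | inj₁ α₀ = contradiction (all i) αi
    where
    all : ∀ i → α i ≈ 0#
    all zero = α₀
    all (suc i) = ind (α ∘ suc) (λ m → ≈-trans (≈-sym (≈-trans (+-congʳ (≈-trans (*-congʳ α₀) (zeroˡ (y m)))) (+-identityˡ _))) (e m)) i

  -- The source of all upper bounds on dimension. An entry one is prefixed to the coefficient
  -- vectors of the `p i ⊖ v`, so the coefficients of a linear relation among them sum to zero and
  -- give an affine relation.
  flat-dependent : (v : Point d) (r : Vector (Point d) k) (p : Vector (Point d) n) →
    (∀ i → Spanned r (p i ⊖ v)) → suc k ℕ.< n → ¬ AffinelyIndependent p
  flat-dependent {d} {k} {n} v r p sp k<n ind =
    let α , (i , αi) , e = dependent (λ i → (1# ▹ (C i))) k<n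
    in αi (ind α (Σα α e) (λ m → total α e m) i)
    where
    open ≈R
    C : Fin n → Vector Carrier k
    C i = proj₁ (sp i)
    Σα : ∀ α → combination α (λ i → (1# ▹ (C i))) ≋ 0ᵖ → sum α ≈ 0#
    Σα α e = ≈-trans (sum-cong-≋ {_} {α} {λ i → α i * 1#}
      (λ i → ≈-trans (≈-sym (*-identityˡ (α i))) (*-comm 1# (α i)))) (e zero)
    total : ∀ α → combination α (λ i → (1# ▹ (C i))) ≋ 0ᵖ → combination α p ≋ 0ᵖ
    total α e m = begin
      sum (λ i → α i * p i m)
        ≈⟨ sum-cong-≋ (λ i → solve 3 (λ a p v → a :* p := a :* (p :- v) :+ v :* a) ≈-refl (α i) (p i m) (v m)) ⟩
      sum (λ i → α i * (p i m - v m) + v m * α i)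
        ≈⟨ sum-linear (λ i → α i * (p i m - v m)) α (v m) ⟩
      sum (λ i → α i * (p i m - v m)) + v m * sum α
        ≈⟨ +-cong (≈-trans (sum-cong-≋ (λ i → *-congˡ (proj₂ (sp i) m))) (combination-combination α C r m))
             (≈-trans (*-congˡ (Σα α e)) (zeroʳ _)) ⟩
      sum (λ l → sum (λ i → α i * C i l) * r l m) + 0#
        ≈⟨ +-identityʳ _ ⟩
      sum (λ l → sum (λ i → α i * C i l) * r l m)
        ≈⟨ sum-zero (λ l → ≈-trans (*-congʳ (e (suc l))) (zeroˡ _)) ⟩
      0# ∎

-- A polytope is generated by its vertices.

module Vertices (em : ExcludedMiddle 0ℓ) (ℝ : RealField) where
  open ConvexCones em ℝ public

  private
    variable
      d k n : ℕ

  private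
    swap-sums : {λ₀ s x y : Carrier} → λ₀ + s ≈ 0# → λ₀ * y + x ≈ 0# → x - y * s ≈ 0#
    swap-sums {λ₀} {s} {x} {y} p q = begin
      x - y * s                           ≈⟨ solve 4 (λ l s x y → x :- y :* s := (l :* y :+ x) :- y :* (l :+ s)) ≈-refl λ₀ s x y ⟩
      (λ₀ * y + x) - y * (λ₀ + s)         ≈⟨ +-cong q (-‿cong (≈-trans (*-congˡ p) (zeroʳ y))) ⟩
      0# - 0#                             ≈⟨ -‿inverseʳ 0# ⟩
      0#                                  ∎
      where open ≈R

  affinely-independent : (v : Point d) (u : Vector (Point d) k) →
    Independent (λ i → u i ⊖ v) → AffinelyIndependent (v ▹ u)
  affinely-independent v u ind λs Σλ e = λ { zero → λ₀ ; (suc i) → tail i }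
    where
    open ≈R
    tail : ∀ i → λs (suc i) ≈ 0#
    tail = ind (λs ∘ suc) (λ m → begin
      sum (λ i → λs (suc i) * (u i m - v m))
        ≈⟨ sum-cong-≋ (λ i → solve 3 (λ l u v → l :* (u :- v) := l :* u :+ (:- v) :* l) ≈-refl (λs (suc i)) (u i m) (v m)) ⟩
      sum (λ i → λs (suc i) * u i m + (- v m) * λs (suc i))
        ≈⟨ sum-linear (λ i → λs (suc i) * u i m) (λs ∘ suc) (- v m) ⟩
      sum (λ i → λs (suc i) * u i m) + (- v m) * sum (λs ∘ suc)
        ≈⟨ solve 3 (λ x y s → x :+ (:- y) :* s := x :- y :* s) ≈-refl _ (v m) _ ⟩
      sum (λ i → λs (suc i) * u i m) - v m * sum (λs ∘ suc)
        ≈⟨ swap-sums Σλ (e m) ⟩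
      0# ∎)
    λ₀ : λs zero ≈ 0#
    λ₀ = ≈-trans (≈-sym (≈-trans (+-congˡ (sum-zero tail)) (+-identityʳ _))) Σλ

  nonzero-independent : (x : Vector (Point d) 1) → ∃[ m ] ¬ (x zero m ≈ 0#) → Independent x
  nonzero-independent x (m , x≉0) α e zero =
    *-zero-cancel x≉0 (≈-trans (*-comm _ _) (≈-trans (≈-sym (+-identityʳ _)) (e m)))

  singleton-dim : {S : Point d → Set} {v : Point d} → S v → (∀ x → S x → x ≋ v) → HasDim S 0
  singleton-dim {v = v} v∈S only =
    (v ▹ (λ ()) , (λ { zero → v∈S }) , affinely-independent v (λ ()) λ _ _ ()) ,
    λ (p , p∈S , ind) → flat-dependent v (λ ()) p
      (λ i → (λ ()) , λ m → ≈-trans (+-congʳ (only (p i) (p∈S i) m)) (-‿inverseʳ _)) (s≤s (s≤s z≤n)) ind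

  dim-0 : {S : Point d → Set} {v x : Point d} → HasDim S 0 → S v → S x → x ≋ v
  dim-0 {v = v} {x} (_ , small) v∈S x∈S with ≋0? (x ⊖ v)
  ... | inj₁ e = ⊖≋0 e
  ... | inj₂ nz = contradiction
    (v ▹ x ▹ (λ ()) , (λ { zero → v∈S ; (suc zero) → x∈S }) ,
      affinely-independent v (x ▹ (λ ())) (nonzero-independent (λ i → (x ▹ (λ ())) i ⊖ v) nz)) small

  -- Lifted to first coordinate one, convex combinations become conic ones, that coordinate
  -- recording the total weight. `height` is negative on all lifted points, which is the pointedness
  -- that `exposed` asks for.
  homogenize : Point d → Point (suc d)
  homogenize x = 1# ▹ x

  homogenize-cong : {x y : Point d} → x ≋ y → homogenize x ≋ homogenize y
  homogenize-cong e zero = ≈-refl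
  homogenize-cong e (suc j) = e j

  height : Point (suc d)
  height = - 1# ▹ 0ᵖ

  height<0 : (x : Point d) → height · homogenize x < 0#
  height<0 x = neg-neg (pos-resp (≈-sym (≈-trans (-‿cong (≈-trans (+-cong
      (≈-trans (*-comm _ _) (*-identityˡ _)) (≈-trans (·-comm 0ᵖ x) (·-0ᵖ x))) (+-identityʳ _)))
      (solve 1 (λ x → :- (:- x) := x) ≈-refl 1#))) 0<1)

  private
    sum-*1 : (μ : Vector Carrier k) → sum μ ≈ sum (λ i → μ i * 1#)
    sum-*1 μ = sum-cong-≋ (λ i → ≈-trans (≈-sym (*-identityˡ (μ i))) (*-comm 1# (μ i)))

  cone-weights : (a : Vector (Point d) k) (x : Point d) (c : Cone (homogenize ∘ a) (homogenize x)) →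
                 sum (proj₁ c) ≈ 1# × x ≋ combination (proj₁ c) a
  cone-weights a x (μ , _ , e) =
    ≈-trans (sum-*1 μ)
      (≈-sym (e zero)) , e ∘ suc

  hull-cone : (P : Polytope d) {x : Point d} → points P x → Cone (homogenize ∘ Polytope.generator P) (homogenize x)
  hull-cone P (μ , μ≥0 , Σμ , e) = μ , μ≥0 , λ
    { zero → ≈-trans (≈-sym Σμ) (sum-*1 μ)
    ; (suc j) → e j }

  cone-hull : (P : Polytope d) {x : Point d} → Cone (homogenize ∘ Polytope.generator P) (homogenize x) → points P x
  cone-hull P {x} c@(μ , μ≥0 , _) = let Σμ , e′ = cone-weights (Polytope.generator P) x c in μ , μ≥0 , Σμ , e′

  points-resp : (P : Polytope d) {x y : Point d} → x ≋ y → points P x → points P y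
  points-resp P e (μ , μ≥0 , Σμ , e′) = μ , μ≥0 , Σμ , λ j → ≈-trans (≈-sym (e j)) (e′ j)

  facePoints-resp : {P : Polytope d} (F : Face P) {x y : Point d} → x ≋ y → facePoints F x → facePoints F y
  facePoints-resp F e (x∈P , Fx) =
    points-resp _ e x∈P , ≈-trans (·-congˡ (Face.normal F) (λ j → ≈-sym (e j))) Fx

  module _ (P : Polytope d) where
    open Polytope P

    -- The functional exposing a lifted irredundant generator reads as an inequality with normal
    -- `f ∘ suc` and offset `- f zero`. Where equality holds, all weights except that of the
    -- generator vanish, so the face is a single point.
    generated-by-vertices :
      ∃[ r ] Σ[ g ∈ (Fin r → Vertex P) ] (∀ {x} → points P x → Cone (homogenize ∘ proj₁ ∘ g) (homogenize x))
    generated-by-vertices with irredundant-generators (homogenize ∘ generator)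
    ... | r , σ , cones , irr = r , (λ j → g j , face j , dim j , g∈face j) , hull
      where
      g : Vector (Point d) r
      g = generator ∘ σ
      hull : ∀ {x} → points P x → Cone (homogenize ∘ g) (homogenize x)
      hull x∈P = cone-trans cones (hull-cone P x∈P)
      g∈P : ∀ j → points P (g j)
      g∈P j = cone-hull P (cone-generator (homogenize ∘ generator) (σ j))
      module _ (j : Fin r) where
        ex = exposed (homogenize ∘ g) irr height (height<0 ∘ g) j
        f = proj₁ ex
        value : ∀ x → f · homogenize x ≈ (f ∘ suc) · x - (- f zero)
        value x = ≈-trans (+-congʳ (≈-trans (*-comm _ _) (*-identityˡ _)))
          (solve 2 (λ a b → a :+ b := b :- (:- a)) ≈-refl (f zero) _)
        f≤0 : ∀ i → f · homogenize (g i) ≤ 0#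
        f≤0 i with i Fin.≟ j
        ... | yes ≡.refl = inj₂ (proj₁ (proj₂ ex))
        ... | no i≢j = inj₁ (proj₂ (proj₂ ex) i i≢j)
        terms : ∀ {x} (c : Cone (homogenize ∘ g) (homogenize x)) →
                - (f · homogenize x) ≈ sum (λ i → proj₁ c i * - (f · homogenize (g i)))
        terms (μ , μ≥0 , e) = ≈-trans (-‿cong (≈-trans (·-congˡ f e) (·-combination f μ (homogenize ∘ g))))
          (≈-trans (≈-sym (sum-neg (λ i → μ i * f · homogenize (g i))))
          (sum-cong-≋ (λ i → solve 2 (λ a b → :- (a :* b) := a :* (:- b)) ≈-refl (μ i) _)))
        face : Face P
        face = record
          { normal = f ∘ suc
          ; offset = - f zero
          ; valid = λ x x∈P → let c = hull x∈P in diff-nn (nn-resp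
              (≈-trans (≈-sym (terms c)) (≈-trans (-‿cong (value x)) (solve 2 (λ a b → :- (a :- b) := b :- a) ≈-refl _ _)))
              (sum-nn (λ i → nn*nn (proj₁ (proj₂ c) i) (nn-neg (f≤0 i)))))
          }
        g∈face : facePoints face (g j)
        g∈face = g∈P j , diff≈0 (≈-trans (≈-sym (value (g j))) (proj₁ (proj₂ ex)))
        only : ∀ x → facePoints face x → x ≋ g j
        only x (x∈P , Fx) m = begin
          x m                          ≈⟨ proj₂ weights m ⟩
          sum (λ i → μ i * g i m)      ≈⟨ sum-single (λ i → μ i * g i m) j (λ i i≢j → ≈-trans (*-congʳ (μ0 i i≢j)) (zeroˡ _)) ⟩
          μ j * g j m                  ≈⟨ *-congʳ (≈-trans (≈-sym (sum-single μ j μ0)) (proj₁ weights)) ⟩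
          1# * g j m                   ≈⟨ *-identityˡ _ ⟩
          g j m                        ∎
          where
          open ≈R
          c = hull x∈P
          μ = proj₁ c
          weights = cone-weights g x c
          Σ≈0 : sum (λ i → μ i * - (f · homogenize (g i))) ≈ 0#
          Σ≈0 = ≈-trans (≈-sym (terms c)) (≈-trans (-‿cong (≈-trans (value x)
            (≈-trans (+-congʳ Fx) (-‿inverseʳ _)))) -0#≈0#)
          μ0 : ∀ i → i ≢ j → μ i ≈ 0#
          μ0 i i≢j = *-zero-cancel (pos≉0 (neg-pos (proj₂ (proj₂ ex) i i≢j)))
            (≈-trans (*-comm _ _) (nn-sum≈0 (λ i → nn*nn (proj₁ (proj₂ c) i) (nn-neg (f≤0 i))) Σ≈0 i))
        dim : HasDim (facePoints face) 0
        dim = singleton-dim g∈face only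

-- The basis of edge directions at a simple vertex.

module Corners (em : ExcludedMiddle 0ℓ) (ℝ : RealField) where
  open Vertices em ℝ public

  cone-resp : ∀ {d k} {a : Vector (Point d) k} {b b′ : Point d} → b ≋ b′ → Cone a b → Cone a b′
  cone-resp e (μ , μ≥0 , eq) = μ , μ≥0 , λ j → ≈-trans (≈-sym (e j)) (eq j)

  -- Coordinates at a vertex: `φ` is the basis dual to the rays towards the neighbours. In these
  -- coordinates the translate of P lies in the nonnegative orthant and the rays are the unit
  -- vectors, which turns questions on edges and faces through `v` into sign arguments.
  record Corner {d n} (P : Polytope d) (V : Fin n → Vertex P) (i₀ : Fin n) : Set where
    v : Point d
    v = proj₁ (V i₀)
    field
      nb : Fin d → Fin n
    ray : Vector (Point d) d
    ray j = proj₁ (V (nb j)) ⊖ v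
    field
      φ      : Vector (Point d) d
      φ-nb   : ∀ j → φ j · ray j ≈ 1#
      φ-nb≢  : ∀ j i → i ≢ j → φ j · ray i ≈ 0#
      coords : ∀ y → y ≋ combination (λ j → φ j · y) ray
      φ-nn   : ∀ {x} → points P x → ∀ j → 0# ≤ φ j · (x ⊖ v)
      edge   : Fin d → Face P
      isEdge : ∀ j → IsEdge P (edge j)
      v∈edge : ∀ j → facePoints (edge j) v
      nb∈edge : ∀ j → facePoints (edge j) (proj₁ (V (nb j)))

  vertex∈P : ∀ {d} {P : Polytope d} (v : Vertex P) → points P (proj₁ v)
  vertex∈P (_ , F , _ , x∈P , _) = x∈P

  private
    module AtVertex {d n} (P : Polytope d) (V : Fin (suc n) → Vertex P)
                    (V-injective : ∀ {i j} → proj₁ (V i) ≋ proj₁ (V j) → i ≡ j)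
                    (V-surjective : ∀ (v : Vertex P) → ∃[ i ] proj₁ (V i) ≋ proj₁ v) (i₀ : Fin (suc n)) where
      vtx : Fin (suc n) → Point d
      vtx i = proj₁ (V i)

      v = vtx i₀

      ray : Vector (Point d) n
      ray k = vtx (punchIn i₀ k) ⊖ v

      hull : ∀ {x} → points P x → Cone (homogenize ∘ vtx) (homogenize x)
      hull x∈P = let r , g , gen = generated-by-vertices P in
        cone-trans {a = homogenize ∘ vtx} {c = homogenize ∘ proj₁ ∘ g} (λ j → let i , e = V-surjective (g j) in
          cone-resp {a = homogenize ∘ vtx} (homogenize-cong e) (cone-generator (homogenize ∘ vtx) i)) (gen x∈P)

      F₀ = proj₁ (proj₂ (V i₀))
      a = Face.normal F₀

      -- Makes the cone at `v` pointed. `a` is the normal of the face witnessing that `v` is a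
      -- vertex; another vertex with the same value would lie in that face, which has dimension
      -- zero.
      a<0 : ∀ k → a · ray k < 0#
      a<0 k with Face.valid F₀ (vtx (punchIn i₀ k)) (vertex∈P (V (punchIn i₀ k)))
      ... | inj₁ p = neg-neg (pos-resp
              (≈-trans (+-congʳ (≈-sym (proj₂ (proj₂ (proj₂ (proj₂ (V i₀)))))))
              (≈-trans (solve 2 (λ x y → y :- x := :- (x :- y)) ≈-refl _ _) (-‿cong (≈-sym (·-⊖ a _ v)))))
              (pos-diff p))
      ... | inj₂ e = contradiction (≡.sym (V-injective (dim-0 {S = facePoints F₀} (proj₁ (proj₂ (proj₂ (V i₀))))
              (proj₂ (proj₂ (proj₂ (V i₀)))) (vertex∈P (V (punchIn i₀ k)) , e)))) (Fin.punchInᵢ≢i i₀ k ∘ ≡.sym)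

      ray-cone : ∀ {x} → points P x → Cone ray (x ⊖ v)
      ray-cone {x} x∈P = μ ∘ punchIn i₀ , proj₁ (proj₂ c) ∘ punchIn i₀ , λ m → begin
        x m - v m
          ≈⟨ +-cong (proj₂ w m) (-‿cong (≈-trans (≈-sym (*-identityˡ (v m))) (≈-trans (*-congʳ (≈-sym (proj₁ w))) (*-comm _ _)))) ⟩
        sum (λ i → μ i * vtx i m) - v m * sum μ
          ≈⟨ solve 3 (λ x y s → x :- y :* s := x :+ (:- y) :* s) ≈-refl _ (v m) (sum μ) ⟩
        sum (λ i → μ i * vtx i m) + (- v m) * sum μ
          ≈⟨ sum-linear (λ i → μ i * vtx i m) μ (- v m) ⟨
        sum (λ i → μ i * vtx i m + (- v m) * μ i)
          ≈⟨ sum-cong-≋ (λ i → solve 3 (λ l u v → l :* u :+ (:- v) :* l := l :* (u :- v)) ≈-refl (μ i) (vtx i m) (v m)) ⟩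
        sum (t m)
          ≈⟨ sum-remove {i = i₀} (t m) ⟩
        μ i₀ * (v m - v m) + sum (t m ∘ punchIn i₀)
          ≈⟨ ≈-trans (+-congʳ (≈-trans (*-congˡ (-‿inverseʳ (v m))) (zeroʳ _))) (+-identityˡ _) ⟩
        sum (t m ∘ punchIn i₀) ∎
        where
        open ≈R
        c = hull x∈P
        μ = proj₁ c
        w = cone-weights vtx x c
        t : Fin d → Vector Carrier (suc n)
        t m i = μ i * (vtx i m - v m)

      module Extreme {r} (σ : Fin r → Fin n) (cones : ∀ i → Cone (ray ∘ σ) (ray i)) (irr : Irredundant (ray ∘ σ)) where
        R : Vector (Point d) r
        R = ray ∘ σ

        R-cone : ∀ {x} → points P x → Cone R (x ⊖ v)
        R-cone x∈P = cone-trans {a = R} {c = ray} cones (ray-cone x∈P)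

        module _ (j : Fin r) where
          private
            ex = exposed R irr a (a<0 ∘ σ) j
          f = proj₁ ex

          f≤0 : ∀ i → f · R i ≤ 0#
          f≤0 i with i Fin.≟ j
          ... | yes ≡.refl = inj₂ (proj₁ (proj₂ ex))
          ... | no i≢j = inj₁ (proj₂ (proj₂ ex) i i≢j)

          terms : ∀ {x} (c : Cone R (x ⊖ v)) →
                  f · v - f · x ≈ sum (λ i → proj₁ c i * - (f · R i))
          terms {x} (μ , _ , e) = ≈-trans
            (≈-trans (solve 2 (λ x y → y :- x := :- (x :- y)) ≈-refl (f · x) (f · v)) (-‿cong (≈-sym (·-⊖ f x v))))
            (≈-trans (-‿cong (≈-trans (·-congˡ f e) (·-combination f μ R)))
            (≈-trans (≈-sym (sum-neg (λ i → μ i * f · R i)))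
            (sum-cong-≋ (λ i → solve 2 (λ a b → :- (a :* b) := a :* (:- b)) ≈-refl (μ i) _))))

          -- `f` vanishes on `R j` and is negative on the other extreme rays, so a point where `f`
          -- takes its value at `v` has all its weight on `R j`.
          edge : Face P
          edge = record
            { normal = f
            ; offset = f · v
            ; valid = λ x x∈P → let c = R-cone x∈P in diff-nn (nn-resp (≈-sym (terms {x} c))
                (sum-nn (λ i → nn*nn (proj₁ (proj₂ c) i) (nn-neg (f≤0 i)))))
            }

          v∈edge : facePoints edge v
          v∈edge = vertex∈P (V i₀) , ≈-refl

          far∈edge : facePoints edge (vtx (punchIn i₀ (σ j)))
          far∈edge = vertex∈P (V _) , diff≈0 (≈-trans (≈-sym (·-⊖ f _ v)) (proj₁ (proj₂ ex)))

          edge-span : ∀ {x} → facePoints edge x → Spanned {k = 1} (λ _ → R j) (x ⊖ v)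
          edge-span {x} (x∈P , Fx) = (λ _ → μ j) , λ m → ≈-trans (proj₂ (proj₂ c) m) (≈-trans
              (sum-single (λ i → μ i * R i m) j (λ i i≢j → ≈-trans (*-congʳ (μ0 i i≢j)) (zeroˡ _)))
              (≈-sym (+-identityʳ _)))
            where
            c = R-cone x∈P
            μ = proj₁ c
            Σ≈0 : sum (λ i → μ i * - (f · R i)) ≈ 0#
            Σ≈0 = ≈-trans (≈-sym (terms {x} c)) (≈-trans (+-congˡ (-‿cong Fx)) (-‿inverseʳ _))
            μ0 : ∀ i → i ≢ j → μ i ≈ 0#
            μ0 i i≢j = *-zero-cancel (pos≉0 (neg-pos (proj₂ (proj₂ ex) i i≢j)))
              (≈-trans (*-comm _ _) (nn-sum≈0 (λ i → nn*nn (proj₁ (proj₂ c) i) (nn-neg (f≤0 i))) Σ≈0 i))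

          R≉0 : ∃[ m ] ¬ (R j m ≈ 0#)
          R≉0 with ≋0? (R j)
          ... | inj₂ nz = nz
          ... | inj₁ z = contradiction (a<0 (σ j)) (irrefl (≈-trans (·-congˡ a z) (·-0ᵖ a)))

          isEdge : IsEdge P edge
          isEdge = (v ▹ vtx (punchIn i₀ (σ j)) ▹ (λ ()) , (λ { zero → v∈edge ; (suc zero) → far∈edge }) ,
              affinely-independent v (vtx (punchIn i₀ (σ j)) ▹ (λ ()))
                (nonzero-independent (λ i → (vtx (punchIn i₀ (σ j)) ▹ (λ ())) i ⊖ v) R≉0)) ,
            λ (p , p∈ , ind) → flat-dependent v (λ _ → R j) p (λ i → edge-span (p∈ i)) ℕ.≤-refl ind

        edge-injective : ∀ {i j} → (∀ x → facePoints (edge i) x ⇔ facePoints (edge j) x) → i ≡ j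
        edge-injective {i} {j} same with i Fin.≟ j
        ... | yes i≡j = i≡j
        ... | no i≢j = contradiction (proj₂ (proj₂ (exposed R irr a (a<0 ∘ σ) j)) i i≢j)
          (irrefl (≈-trans (·-⊖ (f j) _ v) (≈-trans (+-congʳ (proj₂ (Equivalence.to (same _) (far∈edge i)))) (-‿inverseʳ _))))

        -- Distinct extreme rays expose distinct edges through the vertex, and simplicity allows
        -- only d of them. In the other direction, fewer than d rays cannot carry d + 1 affinely
        -- independent points; this is `many`.
        few : Simple P → r ℕ.≤ d
        few simple = Fin.injective⇒≤ {f = index} λ {i} {j} e → edge-injective λ x → mk⇔
            (λ x∈i → Equivalence.to (found j x) (≡.subst (λ k → facePoints (proj₁ (B k)) x) e (Equivalence.from (found i x) x∈i)))
            (λ x∈j → Equivalence.to (found i x) (≡.subst (λ k → facePoints (proj₁ (B k)) x) (≡.sym e) (Equivalence.from (found j x) x∈j)))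
          where
          bij = simple (V i₀)
          B = Bijection.to bij
          point : (j : Fin r) → Σ (Face P) (λ F → IsEdge P F × facePoints F v)
          point j = edge j , isEdge j , v∈edge j
          index : Fin r → Fin d
          index j = proj₁ (Bijection.surjective bij (point j))
          found : ∀ j x → facePoints (proj₁ (B (index j))) x ⇔ facePoints (edge j) x
          found j = proj₂ (Bijection.surjective bij (point j)) ≡.refl

        many : FullDimensional P → d ℕ.≤ r
        many ((p , p∈P , ind) , _) = ℕ.≮⇒≥ λ r<d →
          flat-dependent v R p (λ i → let μ , _ , e = R-cone (p∈P i) in μ , e) (s≤s r<d) ind

        respan : (α : Vector Carrier r) → combination α R ≋ 0ᵖ → ∀ j → ¬ (α j ≈ 0#) →
                 ∀ {y} → Spanned R y → Σ[ ν ∈ Vector Carrier r ] (ν j ≈ 0# × y ≋ combination ν R)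
        respan α e j αj {y} (μ , eq) =
          (λ i → μ i - t * α i) ,
          ≈-trans (solve 4 (λ m q a x → m :- m :* q :* a := m :- (a :* q) :* m) ≈-refl (μ j) (α j ⁻¹) (α j) (α j))
            (≈-trans (+-congˡ (-‿cong (≈-trans (*-congʳ (⁻¹-inverseʳ αj)) (*-identityˡ _)))) (-‿inverseʳ _)) ,
          λ m → ≈-sym (≈-trans
            (sum-cong-≋ (λ i → solve 4 (λ u t a x → (u :- t :* a) :* x := u :* x :+ (:- t) :* (a :* x)) ≈-refl (μ i) t (α i) (R i m)))
            (≈-trans (sum-linear (λ i → μ i * R i m) (λ i → α i * R i m) (- t))
            (≈-trans (+-cong (≈-sym (eq m)) (≈-trans (*-congˡ (e m)) (zeroʳ _))) (+-identityʳ _))))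
          where
          t = μ j * α j ⁻¹

      drop-zero : ∀ {r} (R : Vector (Point d) (suc r)) (j : Fin (suc r)) {y : Point d} →
        Σ[ ν ∈ Vector Carrier (suc r) ] (ν j ≈ 0# × y ≋ combination ν R) → Spanned (R ∘ punchIn j) y
      drop-zero R j (ν , νj , e) = ν ∘ punchIn j , λ m → ≈-trans (e m) (≈-trans (sum-remove {i = j} (λ i → ν i * R i m))
        (≈-trans (+-congʳ (≈-trans (*-congʳ νj) (zeroˡ _))) (+-identityˡ _)))

      module Basis (full : FullDimensional P) (σ : Fin d → Fin n) (cones : ∀ i → Cone (ray ∘ σ) (ray i)) (irr : Irredundant (ray ∘ σ)) where
        open Extreme σ cones irr

        -- Removing a ray needs the number of rays to be a successor, so `d` is generalised to an
        -- `r` equal to it.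
        too-flat : ∀ {r} → r ≡ d → (R′ : Vector (Point d) r) (j : Fin r) →
          (∀ {x} → points P x → Σ[ ν ∈ Vector Carrier r ] (ν j ≈ 0# × x ⊖ v ≋ combination ν R′)) → ⊥
        too-flat {suc r} eq R′ j span = let (p , p∈P , ind) , _ = full in
          flat-dependent v (R′ ∘ punchIn j) p (λ i → drop-zero R′ j (span (p∈P i))) (s≤s (ℕ.≤-reflexive eq)) ind

        -- By `R-cone` the d rays span every difference from `v`. A nontrivial relation would
        -- eliminate one ray and leave P in an affine space of dimension below d.
        R-independent : Independent R
        R-independent α e j with ≈0? (α j)
        ... | inj₁ z = z
        ... | inj₂ αj = contradiction (λ {x} x∈P → respan α e j αj (let μ , _ , eq = R-cone {x} x∈P in μ , eq)) (too-flat ≡.refl R j)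

        φ : Vector (Point d) d
        φ j = proj₁ (dual-functional R R-independent j)

        φ-R : ∀ j → φ j · R j ≈ 1#
        φ-R j = proj₁ (proj₂ (dual-functional R R-independent j))

        φ-R≢ : ∀ j i → i ≢ j → φ j · R i ≈ 0#
        φ-R≢ j = proj₂ (proj₂ (dual-functional R R-independent j))

        φ-combination : ∀ μ {y} → y ≋ combination μ R → ∀ j → φ j · y ≈ μ j
        φ-combination μ {y} e j = begin
          φ j · y                             ≈⟨ ·-congˡ (φ j) e ⟩
          φ j · combination μ R               ≈⟨ ·-combination (φ j) μ R ⟩
          sum (λ i → μ i * φ j · R i)         ≈⟨ sum-single (λ i → μ i * φ j · R i) j (λ i i≢j → ≈-trans (*-congˡ (φ-R≢ j i i≢j)) (zeroʳ _)) ⟩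
          μ j * φ j · R j                     ≈⟨ ≈-trans (*-congˡ (φ-R j)) (≈-trans (*-comm _ _) (*-identityˡ _)) ⟩
          μ j                                 ∎
          where open ≈R

        result : Corner P V i₀
        result = record
          { nb = λ j → punchIn i₀ (σ j)
          ; φ = φ
          ; φ-nb = φ-R
          ; φ-nb≢ = φ-R≢
          ; coords = λ y → let μ , e = independent-spans R R-independent y in
              λ m → ≈-trans (e m) (sum-cong-≋ (λ j → *-congʳ (≈-sym (φ-combination μ e j))))
          ; φ-nn = λ {x} x∈P j → let μ , μ≥0 , e = R-cone {x} x∈P in nn-resp (≈-sym (φ-combination μ e j)) (μ≥0 j)
          ; edge = edge
          ; isEdge = isEdge
          ; v∈edge = v∈edge
          ; nb∈edge = far∈edge
          }

      build : FullDimensional P → Simple P →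
        (Σ[ r ∈ ℕ ] Σ[ σ ∈ (Fin r → Fin n) ] ((∀ i → Cone (ray ∘ σ) (ray i)) × Irredundant (ray ∘ σ))) → Corner P V i₀
      build full simple (r , σ , cones , irr) =
        with-size (ℕ.≤-antisym (Extreme.few σ cones irr simple) (Extreme.many σ cones irr full)) σ cones irr
        where
        with-size : ∀ {r} → r ≡ d → (σ : Fin r → Fin n) → (∀ i → Cone (ray ∘ σ) (ray i)) → Irredundant (ray ∘ σ) → Corner P V i₀
        with-size ≡.refl σ cones irr = Basis.result full σ cones irr

  corner : ∀ {d n} (P : Polytope d) → FullDimensional P → Simple P → (V : Fin n → Vertex P) →
    (∀ {i j} → proj₁ (V i) ≋ proj₁ (V j) → i ≡ j) → (∀ (v : Vertex P) → ∃[ i ] proj₁ (V i) ≋ proj₁ v) →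
    ∀ i₀ → Corner P V i₀
  corner {n = suc n} P full simple V inj surj i₀ =
    build full simple (irredundant-generators ray)
    where open AtVertex P V inj surj i₀

-- Counting choices, subsets and multiplicities.

module Counting where
  module ℕΣ where
    open MonoidSum ℕ.+-0-commutativeMonoid public
    open SumSingle ℕ.+-0-commutativeMonoid public
    open SemiringSum ℕ.+-*-semiring public using (*-distribˡ-sum; *-distribʳ-sum)

  module ℕΠ where
    open MonoidSum ℕ.*-1-commutativeMonoid public
    open SumSingle ℕ.*-1-commutativeMonoid public

  private
    variable
      a b d n k : ℕ
      A B : Set

  T-irrelevant : ∀ {x} (p q : T x) → p ≡ q
  T-irrelevant {true} _ _ = ≡.refl

  T-≡ : ∀ {x y} → (T x → T y) → (T y → T x) → x ≡ y
  T-≡ {false} {false} _ _ = ≡.refl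
  T-≡ {false} {true} _ g = ⊥-elim (g tt)
  T-≡ {true} {false} f _ = ⊥-elim (f tt)
  T-≡ {true} {true} _ _ = ≡.refl

  T-not : ∀ {x} → T (not x) → ¬ T x
  T-not {false} _ ()

  not-T : ∀ {x} → ¬ T x → T (not x)
  not-T {false} _ = tt
  not-T {true} ¬t = ¬t tt

  bit : Bool → ℕ
  bit b = if b then 1 else 0

  bit-true : ∀ {b} → T b → bit b ≡ 1
  bit-true {true} _ = ≡.refl

  bit-false : ∀ {b} → ¬ T b → bit b ≡ 0
  bit-false {false} _ = ≡.refl
  bit-false {true} ¬t = ⊥-elim (¬t tt)

  count : (Fin n → Bool) → ℕ
  count B = ℕΣ.sum (bit ∘ B)

  count-cong : {B C : Fin n → Bool} → (∀ i → B i ≡ C i) → count B ≡ count C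
  count-cong {n} e = ℕΣ.sum-cong-≗ {n} (≡.cong bit ∘ e)

  count-complement : (B : Fin n → Bool) → count B ℕ.+ count (not ∘ B) ≡ n
  count-complement {zero} B = ≡.refl
  count-complement {suc n} B with B zero
  ... | true = ≡.cong suc (count-complement (B ∘ suc))
  ... | false = ≡.trans (ℕ.+-suc _ _) (≡.cong suc (count-complement (B ∘ suc)))

  injection⇒≤ : A ↔ Fin a → B ↔ Fin b → (f : A → B) → (∀ {x y} → f x ≡ f y → x ≡ y) → a ℕ.≤ b
  injection⇒≤ α β f inj = Fin.injective⇒≤ {f = Inverse.to β ∘ f ∘ Inverse.from α} λ {i} {j} e →
    ≡.trans (≡.sym (Inverse.strictlyInverseˡ α i)) (≡.trans
      (≡.cong (Inverse.to α) (inj (≡.trans (≡.sym (Inverse.strictlyInverseʳ β _))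
        (≡.trans (≡.cong (Inverse.from β) e) (Inverse.strictlyInverseʳ β _)))))
      (Inverse.strictlyInverseˡ α j))

  Σ-fin : {f : Fin n → ℕ} {F : Fin n → Set} → (∀ i → F i ↔ Fin (f i)) → Σ (Fin n) F ↔ Fin (ℕΣ.sum f)
  Σ-fin {zero} e = mk↔ₛ′ (λ ()) (λ ()) (λ ()) (λ ())
  Σ-fin {suc n} e = ↔-trans
    (mk↔ₛ′ (λ { (zero , x) → inj₁ x ; (suc i , x) → inj₂ (i , x) })
           (λ { (inj₁ x) → zero , x ; (inj₂ (i , x)) → suc i , x })
           (λ { (inj₁ x) → ≡.refl ; (inj₂ (i , x)) → ≡.refl })
           (λ { (zero , x) → ≡.refl ; (suc i , x) → ≡.refl }))
    (↔-trans (e zero ⊎F.⊎-↔ Σ-fin (e ∘ suc)) (↔-sym Fin.+↔⊎))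

  T-fin : ∀ x → T x ↔ Fin (bit x)
  T-fin true = ↔-sym Fin.1↔⊤
  T-fin false = ↔-sym Fin.0↔⊥

  Sub : (Fin n → Bool) → Set
  Sub B = Σ (Fin _) (T ∘ B)

  Sub-fin : (B : Fin n → Bool) → Sub B ↔ Fin (count B)
  Sub-fin B = Σ-fin (T-fin ∘ B)

  Sub-≡ : {B : Fin n → Bool} {x y : Sub B} → proj₁ x ≡ proj₁ y → x ≡ y
  Sub-≡ {x = i , s} {.i , t} ≡.refl = ≡.cong (i ,_) (T-irrelevant s t)

  Subtype-fin : (e : A ↔ Fin a) (B : A → Bool) → Σ A (T ∘ B) ↔ Fin (count (B ∘ Inverse.from e))
  Subtype-fin e B = ↔-trans
    (mk↔ₛ′ (λ (x , t) → Inverse.to e x , ≡.subst (T ∘ B) (≡.sym (Inverse.strictlyInverseʳ e x)) t)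
           (λ (i , t) → Inverse.from e i , t)
           (λ (i , t) → Sub-≡ (Inverse.strictlyInverseˡ e i))
           (λ (x , t) → subtype-≡ (Inverse.strictlyInverseʳ e x)))
    (Sub-fin (B ∘ Inverse.from e))
    where
    subtype-≡ : ∀ {x y} {s : T (B x)} {t : T (B y)} → x ≡ y → (x , s) ≡ (y , t)
    subtype-≡ {s = s} {t} ≡.refl = ≡.cong (_ ,_) (T-irrelevant s t)

  -- Dependent functions stored as iterated pairs, so that equality of all entries gives equality.
  Π : (Fin n → Set) → Set
  Π {zero} F = ⊤
  Π {suc n} F = F zero × Π (F ∘ suc)

  look : {F : Fin n → Set} → Π F → ∀ i → F i
  look (x , _) zero = x
  look (_ , xs) (suc i) = look xs i

  tab : {F : Fin n → Set} → (∀ i → F i) → Π F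
  tab {zero} f = tt
  tab {suc n} f = f zero , tab (f ∘ suc)

  look-tab : {F : Fin n → Set} (f : ∀ i → F i) (i : Fin n) → look {F = F} (tab f) i ≡ f i
  look-tab f zero = ≡.refl
  look-tab {F = F} f (suc i) = look-tab {F = F ∘ suc} (f ∘ suc) i

  look-ext : {F : Fin n → Set} {x y : Π F} → (∀ i → look {F = F} x i ≡ look y i) → x ≡ y
  look-ext {zero} _ = ≡.refl
  look-ext {suc n} {F} e = ≡.cong₂ _,_ (e zero) (look-ext {F = F ∘ suc} (e ∘ suc))

  Π-fin : {f : Fin n → ℕ} {F : Fin n → Set} → (∀ i → F i ↔ Fin (f i)) → Π F ↔ Fin (ℕΠ.sum f)
  Π-fin {zero} e = ↔-sym Fin.1↔⊤
  Π-fin {suc n} e = ↔-trans (e zero ×F.×-↔ Π-fin (e ∘ suc)) (↔-sym Fin.*↔×)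

  -- Subsets of size `k` of the true positions of `B`, built along Pascal's recursion: the binomial
  -- coefficient comes out of `KSubset-fin` directly, and membership determines the element.
  KSubset : ℕ → (Fin d → Bool) → Set
  KSubset {zero} zero B = ⊤
  KSubset {zero} (suc k) B = ⊥
  KSubset {suc d} zero B = KSubset zero (B ∘ suc)
  KSubset {suc d} (suc k) B = KSubset (suc k) (B ∘ suc) ⊎ (T (B zero) × KSubset k (B ∘ suc))

  mem : (B : Fin d → Bool) → KSubset k B → Fin d → Bool
  mem {suc d} {zero} B s zero = false
  mem {suc d} {zero} B s (suc j) = mem (B ∘ suc) s j
  mem {suc d} {suc k} B (inj₁ s) zero = false
  mem {suc d} {suc k} B (inj₁ s) (suc j) = mem (B ∘ suc) s j
  mem {suc d} {suc k} B (inj₂ (_ , s)) zero = true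
  mem {suc d} {suc k} B (inj₂ (_ , s)) (suc j) = mem (B ∘ suc) s j

  mem⊆ : (B : Fin d → Bool) (s : KSubset k B) → ∀ j → T (mem B s j) → T (B j)
  mem⊆ {suc d} {zero} B s (suc j) = mem⊆ (B ∘ suc) s j
  mem⊆ {suc d} {suc k} B (inj₁ s) (suc j) = mem⊆ (B ∘ suc) s j
  mem⊆ {suc d} {suc k} B (inj₂ (t , s)) zero _ = t
  mem⊆ {suc d} {suc k} B (inj₂ (_ , s)) (suc j) = mem⊆ (B ∘ suc) s j

  count-mem : (B : Fin d → Bool) (s : KSubset k B) → count (mem B s) ≡ k
  count-mem {zero} {zero} B s = ≡.refl
  count-mem {suc d} {zero} B s = count-mem (B ∘ suc) s
  count-mem {suc d} {suc k} B (inj₁ s) = count-mem (B ∘ suc) s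
  count-mem {suc d} {suc k} B (inj₂ (_ , s)) = ≡.cong suc (count-mem (B ∘ suc) s)

  mem-injective : (B : Fin d → Bool) {s t : KSubset k B} → (∀ j → mem B s j ≡ mem B t j) → s ≡ t
  mem-injective {zero} {zero} B e = ≡.refl
  mem-injective {suc d} {zero} B e = mem-injective (B ∘ suc) (e ∘ suc)
  mem-injective {suc d} {suc k} B {inj₁ s} {inj₁ t} e = ≡.cong inj₁ (mem-injective (B ∘ suc) (e ∘ suc))
  mem-injective {suc d} {suc k} B {inj₁ s} {inj₂ t} e = case e zero of λ ()
  mem-injective {suc d} {suc k} B {inj₂ s} {inj₁ t} e = case e zero of λ ()
  mem-injective {suc d} {suc k} B {inj₂ (p , s)} {inj₂ (q , t)} e =
    ≡.cong inj₂ (≡.cong₂ _,_ (T-irrelevant p q) (mem-injective (B ∘ suc) (e ∘ suc)))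

  subset : (M : Fin d → Bool) (B : Fin d → Bool) → (∀ j → T (M j) → T (B j)) → count M ≡ k →
           Σ[ s ∈ KSubset k B ] (∀ j → mem B s j ≡ M j)
  subset {zero} {zero} M B M⊆B e = tt , λ ()
  subset {suc d} M B M⊆B e with M zero in eq
  subset {suc d} {zero} M B M⊆B e | false = let s , p = subset (M ∘ suc) (B ∘ suc) (M⊆B ∘ suc) e in
    s , λ { zero → ≡.sym eq ; (suc j) → p j }
  subset {suc d} {suc k} M B M⊆B e | false = let s , p = subset (M ∘ suc) (B ∘ suc) (M⊆B ∘ suc) e in
    inj₁ s , λ { zero → ≡.sym eq ; (suc j) → p j }
  subset {suc d} {suc k} M B M⊆B e | true =
    let s , p = subset (M ∘ suc) (B ∘ suc) (M⊆B ∘ suc) (ℕ.suc-injective e)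
    in inj₂ (M⊆B zero (≡.subst T (≡.sym eq) tt) , s) , λ { zero → ≡.sym eq ; (suc j) → p j }

  private
    resize : a ≡ b → A ↔ Fin a → A ↔ Fin b
    resize ≡.refl e = e

  KSubset-fin : ∀ k (B : Fin d → Bool) → KSubset k B ↔ Fin (count B Binomial.C k)
  KSubset-fin {zero} zero B = ↔-sym Fin.1↔⊤
  KSubset-fin {zero} (suc k) B = ↔-sym Fin.0↔⊥
  KSubset-fin {suc d} zero B = resize {b = count B Binomial.C 0}
    (≡.trans (nC0≡1 (count (B ∘ suc))) (≡.sym (nC0≡1 (count B)))) (KSubset-fin zero (B ∘ suc))
    where
    nC0≡1 : ∀ n → n Binomial.C 0 ≡ 1
    nC0≡1 n = ≡.trans (Binomial.nCk≡nC[n∸k] {n = n} z≤n) (Binomial.nCn≡1 n)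
  KSubset-fin {suc d} (suc k) B with B zero
  ... | true = resize {b = suc (count (B ∘ suc)) Binomial.C suc k}
        (≡.trans (ℕ.+-comm _ (count (B ∘ suc) Binomial.C k)) (Binomial.nCk+nC[k+1]≡[n+1]C[k+1] (count (B ∘ suc)) k))
        (↔-trans (KSubset-fin (suc k) (B ∘ suc) ⊎F.⊎-↔
            ↔-trans (mk↔ₛ′ (λ (_ , s) → s) (λ s → tt , s) (λ _ → ≡.refl) (λ _ → ≡.refl)) (KSubset-fin k (B ∘ suc)))
          (↔-sym Fin.+↔⊎))
  ... | false = ↔-trans (mk↔ₛ′ [ id , (λ ()) ]′ inj₁ (λ _ → ≡.refl) (λ { (inj₁ _) → ≡.refl ; (inj₂ (() , _)) })) (KSubset-fin (suc k) (B ∘ suc))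

  multiplicity : (Fin n → ℕ) → ℕ → ℕ
  multiplicity x i = count (λ v → x v ℕ.≡ᵇ i)

  sum-by-value : (x : Fin n → ℕ) → (∀ v → x v ℕ.≤ d) → (f : ℕ → ℕ) →
    ℕΣ.sum (f ∘ x) ≡ ℕΣ.sum {suc d} (λ i → multiplicity x (toℕ i) ℕ.* f (toℕ i))
  sum-by-value {n} {d} x x≤d f = ≡.sym (begin
    ℕΣ.sum {suc d} (λ i → multiplicity x (toℕ i) ℕ.* f (toℕ i))
      ≡⟨ ℕΣ.sum-cong-≗ {suc d} (λ i → ℕΣ.*-distribʳ-sum {n} (f (toℕ i)) (λ v → bit (x v ℕ.≡ᵇ toℕ i))) ⟩
    ℕΣ.sum {suc d} (λ i → ℕΣ.sum {n} (λ v → term v i))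
      ≡⟨ ℕΣ.∑-comm (λ i v → term v i) ⟩
    ℕΣ.sum (λ v → ℕΣ.sum (term v))
      ≡⟨ ℕΣ.sum-cong-≗ {n} value ⟩
    ℕΣ.sum (f ∘ x) ∎)
    where
    open ≡.≡-Reasoning
    term : Fin n → Fin (suc d) → ℕ
    term v i = bit (x v ℕ.≡ᵇ toℕ i) ℕ.* f (toℕ i)
    value : ∀ v → ℕΣ.sum (term v) ≡ f (x v)
    value v = ≡.trans
      (ℕΣ.sum-single (term v) i (λ j j≢i → ≡.cong (ℕ._* f (toℕ j))
        (bit-false (λ t → j≢i (Fin.toℕ-injective (≡.trans (≡.sym (ℕ.≡ᵇ⇒≡ (x v) (toℕ j) t)) (≡.sym toℕ-i)))))))
      (≡.trans (≡.cong (ℕ._* f (toℕ i)) (bit-true (ℕ.≡⇒≡ᵇ (x v) (toℕ i) (≡.sym toℕ-i))))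
        (≡.trans (ℕ.*-identityˡ _) (≡.cong f toℕ-i)))
      where
      i = Fin.fromℕ< (s≤s (x≤d v))
      toℕ-i = Fin.toℕ-fromℕ< (s≤s (x≤d v))

  -- The matrix of binomial coefficients is triangular, so the multiplicities are found from the top down.
  binomial-moments : (x y : Fin n → ℕ) → (∀ v → x v ℕ.≤ d) → (∀ v → y v ℕ.≤ d) →
    (∀ k → ℕΣ.sum (λ v → x v Binomial.C k) ≡ ℕΣ.sum (λ v → y v Binomial.C k)) →
    ∀ i → multiplicity x i ≡ multiplicity y i
  binomial-moments {n} {d} x y x≤d y≤d moments i = from-top (suc d) i (ℕ.m≤n+m (suc d) i)
    where
    absent : (x : Fin n → ℕ) → (∀ v → x v ℕ.≤ d) → ∀ i → d ℕ.< i → multiplicity x i ≡ 0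
    absent x x≤d i d<i = ℕΣ.sum-zero {f = λ v → bit (x v ℕ.≡ᵇ i)}
      (λ v → bit-false (λ t → ℕ.<⇒≱ d<i (≡.subst (ℕ._≤ d) (ℕ.≡ᵇ⇒≡ (x v) i t) (x≤d v))))
    term : (Fin n → ℕ) → ℕ → Fin (suc d) → ℕ
    term x k j = multiplicity x (toℕ j) ℕ.* (toℕ j Binomial.C k)
    -- `g` bounds the distance to the top: at zero, `i` exceeds `d` and both multiplicities vanish.
    -- In the moment of order `i`, smaller values have binomial coefficient zero, larger ones agree
    -- by recursion, and the value `i` itself has coefficient one.
    from-top : ∀ g i → d ℕ.< i ℕ.+ g → multiplicity x i ≡ multiplicity y i
    from-top zero i d<i = ≡.trans (absent x x≤d i d<i′) (≡.sym (absent y y≤d i d<i′))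
      where
      d<i′ : d ℕ.< i
      d<i′ = ≡.subst (d ℕ.<_) (ℕ.+-identityʳ i) d<i
    from-top (suc g) i d<i+g with suc d ℕ.≤? i
    ... | yes d<i = ≡.trans (absent x x≤d i d<i) (≡.sym (absent y y≤d i d<i))
    ... | no d≮i = ≡.trans (≡.sym (diagonal x)) (≡.trans
          (ℕ.+-cancelʳ-≡ _ _ _ (≡.trans (≡.sym (expand x x≤d)) (≡.trans (moments i)
            (≡.trans (expand y y≤d) (≡.cong (term y i p ℕ.+_) (≡.sym rest))))))
          (diagonal y))
      where
      p : Fin (suc d)
      p = Fin.fromℕ< (ℕ.≰⇒> d≮i)
      toℕ-p : toℕ p ≡ i
      toℕ-p = Fin.toℕ-fromℕ< (ℕ.≰⇒> d≮i)
      diagonal : ∀ x → term x i p ≡ multiplicity x i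
      diagonal x rewrite toℕ-p | Binomial.nCn≡1 i = ℕ.*-identityʳ _
      expand : ∀ x → (∀ v → x v ℕ.≤ d) →
        ℕΣ.sum (λ v → x v Binomial.C i) ≡ term x i p ℕ.+ ℕΣ.sum (term x i ∘ punchIn p)
      expand x x≤d = ≡.trans (sum-by-value x x≤d (Binomial._C i)) (ℕΣ.sum-remove {i = p} (term x i))
      others : ∀ j → j ≢ p → term x i j ≡ term y i j
      others j j≢p with ℕ.<-cmp (toℕ j) i
      ... | tri< j<i _ _ rewrite Binomial.k>n⇒nCk≡0 j<i =
            ≡.trans (ℕ.*-zeroʳ (multiplicity x (toℕ j))) (≡.sym (ℕ.*-zeroʳ (multiplicity y (toℕ j))))
      ... | tri≈ _ j≡i _ = contradiction (Fin.toℕ-injective (≡.trans j≡i (≡.sym toℕ-p))) j≢p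
      ... | tri> _ _ i<j = ≡.cong (ℕ._* (toℕ j Binomial.C i)) (from-top g (toℕ j)
            (ℕ.≤-trans (≡.subst (d ℕ.<_) (ℕ.+-suc i g) d<i+g) (ℕ.+-monoˡ-≤ g i<j)))
      rest : ℕΣ.sum (term x i ∘ punchIn p) ≡ ℕΣ.sum (term y i ∘ punchIn p)
      rest = ℕΣ.sum-cong-≗ {d} (λ j → others (punchIn p j) (Fin.punchInᵢ≢i p j))

  ^-sum : ∀ m (f : Fin n → ℕ) → m ℕ.^ ℕΣ.sum f ≡ ℕΠ.sum (λ v → m ℕ.^ f v)
  ^-sum {zero} m f = ≡.refl
  ^-sum {suc n} m f = ≡.trans (ℕ.^-distribˡ-+-* m (f zero) _) (≡.cong (m ℕ.^ f zero ℕ.*_) (^-sum m (f ∘ suc)))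

  -- Exchanging two products groups the factors by vertex. The product in `hProduct` starts at
  -- exponent `h` of one, so a vertex of value zero contributes a factor one; hence `1 ⊔ x v`.
  hProduct-multiplicity : (x : Fin n → ℕ) → (∀ v → x v ℕ.≤ d) → (h : Vector ℕ (suc d)) →
    (∀ i → h i ≡ multiplicity x (toℕ i)) → hProduct h ≡ ℕΠ.sum (λ v → 1 ℕ.⊔ x v)
  hProduct-multiplicity {n} {d} x x≤d h h≡ = begin
    ℕΠ.sum (λ i → suc (toℕ i) ℕ.^ h (suc i))
      ≡⟨ ℕΠ.sum-cong-≗ {d} (λ i → ≡.trans (≡.cong (suc (toℕ i) ℕ.^_) (h≡ (suc i)))
           (^-sum (suc (toℕ i)) (λ v → bit (x v ℕ.≡ᵇ suc (toℕ i))))) ⟩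
    ℕΠ.sum (λ i → ℕΠ.sum (λ v → factor v i))     ≡⟨ ℕΠ.∑-comm (λ i v → factor v i) ⟩
    ℕΠ.sum (λ v → ℕΠ.sum (factor v))             ≡⟨ ℕΠ.sum-cong-≗ {n} value ⟩
    ℕΠ.sum (λ v → 1 ℕ.⊔ x v)                     ∎
    where
    open ≡.≡-Reasoning
    factor : Fin n → Fin d → ℕ
    factor v i = suc (toℕ i) ℕ.^ bit (x v ℕ.≡ᵇ suc (toℕ i))
    value : ∀ v → ℕΠ.sum (factor v) ≡ 1 ℕ.⊔ x v
    value v with x v | x≤d v
    ... | zero | _ = ℕΠ.sum-zero {d} {λ i → suc (toℕ i) ℕ.^ 0} (λ _ → ≡.refl)
    ... | suc y | y<d = ≡.trans
      (ℕΠ.sum-single (λ i → suc (toℕ i) ℕ.^ bit (y ℕ.≡ᵇ toℕ i)) i (λ j j≢i → ≡.cong (suc (toℕ j) ℕ.^_)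
        (bit-false (λ t → j≢i (Fin.toℕ-injective (≡.trans (≡.sym (ℕ.≡ᵇ⇒≡ y (toℕ j) t)) (≡.sym toℕ-i)))))))
      (≡.trans (≡.cong (suc (toℕ i) ℕ.^_) (bit-true (ℕ.≡⇒≡ᵇ y (toℕ i) (≡.sym toℕ-i))))
        (≡.trans (ℕ.*-identityʳ _) (≡.cong suc toℕ-i)))
      where
      i = Fin.fromℕ< y<d
      toℕ-i = Fin.toℕ-fromℕ< y<d

-- Comparing sizes of setoids.

module Sizes where
  open Counting

  private
    variable
      k l n : ℕ

  -- `f` is applied to enumerated representatives only, so any function reflecting the equalities
  -- will do.
  size-≤ : {S S′ : Setoid 0ℓ 0ℓ} → HasSize S k → HasSize S′ l →
    (f : Setoid.Carrier S → Setoid.Carrier S′) → (∀ {x y} → Setoid._≈_ S′ (f x) (f y) → Setoid._≈_ S x y) → k ℕ.≤ l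
  size-≤ {S′ = S′} α β f inj = Fin.injective⇒≤ {f = λ i → index (f (A.to i))} λ {i} {j} e →
    A.injective (inj (S.trans (S.sym (found (f (A.to i)))) (S.trans (S.reflexive (≡.cong B.to e)) (found (f (A.to j))))))
    where
    module S = Setoid S′
    module A = Bijection α
    module B = Bijection β
    index : S.Carrier → Fin _
    index x = proj₁ (B.surjective x)
    found : ∀ x → B.to (index x) S.≈ x
    found x = proj₂ (B.surjective x) ≡.refl

  size-via : {A : Set} (e : A ↔ Fin k) (S : Setoid 0ℓ 0ℓ) (f : A → Setoid.Carrier S) →
    (∀ {x y} → Setoid._≈_ S (f x) (f y) → x ≡ y) →
    (∀ s → ∃[ x ] Setoid._≈_ S (f x) s) → HasSize S k
  size-via e S f inj surj = record
    { to = f ∘ from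
    ; cong = λ i≡ → S.reflexive (≡.cong (f ∘ from) i≡)
    ; bijective =
        (λ {i} {j} i≈j → ≡.trans (≡.sym (Inverse.strictlyInverseˡ e i))
          (≡.trans (≡.cong (Inverse.to e) (inj i≈j)) (Inverse.strictlyInverseˡ e j)))
      , λ s → let x , fx≈s = surj s in Inverse.to e x ,
          λ i≡ → S.trans (S.reflexive (≡.cong f (≡.trans (≡.cong from i≡) (Inverse.strictlyInverseʳ e x)))) fx≈s
    }
    where
    module S = Setoid S
    from = Inverse.from e

  size-subset : (S : Setoid 0ℓ 0ℓ) (B : Fin n → Bool) (f : Sub B → Setoid.Carrier S) →
    (∀ {x y} → Setoid._≈_ S (f x) (f y) → proj₁ x ≡ proj₁ y) →
    (∀ s → ∃[ x ] Setoid._≈_ S (f x) s) → HasSize S (count B)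
  size-subset S B f inj surj = size-via (Sub-fin B) S f (λ e → Sub-≡ {B = B} (inj e)) surj

-- Neighbours, edges and faces in local coordinates.

module SimplePolytope
  (em : ExcludedMiddle 0ℓ) (ℝ : RealField)
  {d : ℕ} (P : Polytopes.Polytope ℝ d)
  (full : Polytopes.FullDimensional ℝ P) (simple : Polytopes.Simple ℝ P)
  {n : ℕ} (V : Fin n → Polytopes.Vertex ℝ P)
  (V-injective : ∀ {i j} → Polytopes._≋_ ℝ (proj₁ (V i)) (proj₁ (V j)) → i ≡ j)
  (V-surjective : ∀ (v : Polytopes.Vertex ℝ P) → ∃[ i ] Polytopes._≋_ ℝ (proj₁ (V i)) (proj₁ v)) where

  open Corners em ℝ
  open Counting
  open Sizes

  infix 4 _<?_
  _<?_ : Carrier → Carrier → Bool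
  x <? y with compare x y
  ... | tri< _ _ _ = true
  ... | tri≈ _ _ _ = false
  ... | tri> _ _ _ = false

  <?-sound : ∀ {x y} → T (x <? y) → x < y
  <?-sound {x} {y} t with compare x y
  ... | tri< p _ _ = p

  <?-complete : ∀ {x y} → x < y → T (x <? y)
  <?-complete {x} {y} p with compare x y
  ... | tri< _ _ _ = tt
  ... | tri≈ ¬p _ _ = ¬p p
  ... | tri> ¬p _ _ = ¬p p

  zero? : Carrier → Bool
  zero? x = [ (λ _ → true) , (λ _ → false) ]′ (≈0? x)

  zero?-sound : ∀ {x} → T (zero? x) → x ≈ 0#
  zero?-sound {x} t with ≈0? x
  ... | inj₁ e = e

  zero?-complete : ∀ {x} → x ≈ 0# → T (zero? x)
  zero?-complete {x} e with ≈0? x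
  ... | inj₁ _ = tt
  ... | inj₂ ¬e = ¬e e

  nonpos-sum≈0 : ∀ {k} {f : Vector Carrier k} → (∀ i → f i ≤ 0#) → sum f ≈ 0# → ∀ i → f i ≈ 0#
  nonpos-sum≈0 {f = f} f≤0 e i = ≈-trans (solve 1 (λ x → x := :- (:- x)) ≈-refl (f i))
    (≈-trans (-‿cong (nn-sum≈0 (nn-neg ∘ f≤0) (≈-trans (sum-neg f) (≈-trans (-‿cong e) -0#≈0#)) i)) -0#≈0#)

  sum-nonpos : ∀ {k} {f : Vector Carrier k} → (∀ i → f i ≤ 0#) → sum f ≤ 0#
  sum-nonpos {f = f} f≤0 = neg-nonpos (nn-resp (sum-neg f) (sum-nn (nn-neg ∘ f≤0)))

  nn*nonpos : ∀ {x y} → 0# ≤ x → y ≤ 0# → x * y ≤ 0#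
  nn*nonpos {x} {y} p q = neg-nonpos (nn-resp (solve 2 (λ x y → x :* (:- y) := :- (x :* y)) ≈-refl x y) (nn*nn p (nn-neg q)))

  private
    module At (v : Fin n) = Corner (corner P full simple V V-injective V-surjective v)
  open At public hiding (v)

  vtx : Fin n → Point d
  vtx v = proj₁ (V v)

  vtx∈P : ∀ v → points P (vtx v)
  vtx∈P v = vertex∈P (V v)

  ⊖-self : ∀ (f x : Point d) → f · (x ⊖ x) ≈ 0#
  ⊖-self f x = ≈-trans (·-⊖ f x x) (-‿inverseʳ _)

  nb≢ : ∀ v j → nb v j ≢ v
  nb≢ v j e = 1≉0 (≈-trans (≈-sym (φ-nb v j)) (≡.subst (λ u → φ v j · (vtx u ⊖ vtx v) ≈ 0#) (≡.sym e) (⊖-self _ _)))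

  nb-injective : ∀ v {i j} → nb v i ≡ nb v j → i ≡ j
  nb-injective v {i} {j} e with i Fin.≟ j
  ... | yes i≡j = i≡j
  ... | no i≢j = contradiction (≈-trans (≈-sym (φ-nb v j))
    (≡.subst (λ u → φ v j · (vtx u ⊖ vtx v) ≈ 0#) e (φ-nb≢ v j i i≢j))) 1≉0

  expand : ∀ v (f y : Point d) → f · y ≈ sum (λ j → φ v j · y * f · ray v j)
  expand v f y = ≈-trans (·-congˡ f (coords v y)) (·-combination f (λ j → φ v j · y) (ray v))

  coords-zero : ∀ v (y : Point d) → (∀ j → φ v j · y ≈ 0#) → y ≋ 0ᵖ
  coords-zero v y e m = ≈-trans (coords v y m) (sum-zero (λ j → ≈-trans (*-congʳ (e j)) (zeroˡ _)))

  vtx-≡ : ∀ v u → (∀ j → φ v j · (vtx u ⊖ vtx v) ≈ 0#) → u ≡ v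
  vtx-≡ v u e = V-injective (⊖≋0 (coords-zero v _ e))

  -- Every `φ w j` is nonnegative at both points, which lie on opposite sides of `w` along `r`; so
  -- it vanishes on `r`.
  not-between : ∀ w {x y : Point d} (s t : Carrier) (r : Point d) → points P x → points P y →
    0# < s → 0# < t → (∀ m → x m - vtx w m ≈ s * r m) → (∀ m → y m - vtx w m ≈ - t * r m) → r ≋ 0ᵖ
  not-between w {x} {y} s t r x∈P y∈P s>0 t>0 ex ey = coords-zero w r λ j → ≤-antisym
    (≮⇒≥ λ pos → ≤⇒≯ (nn-resp (scale (- t) ey j) (φ-nn w y∈P j))
      (neg-neg (pos-resp (solve 2 (λ t x → t :* x := :- (:- t :* x)) ≈-refl t (φ w j · r)) (*-pos t>0 pos))))
    (≮⇒≥ λ neg → ≤⇒≯ (nn-resp (scale s ex j) (φ-nn w x∈P j))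
      (neg-neg (pos-resp (solve 2 (λ t x → t :* :- x := :- (t :* x)) ≈-refl s (φ w j · r)) (*-pos s>0 (neg-pos neg)))))
    where
    scale : ∀ {x} s → (∀ m → x m - vtx w m ≈ s * r m) → ∀ j → φ w j · (x ⊖ vtx w) ≈ s * φ w j · r
    scale s e j = ≈-trans (·-congˡ (φ w j) e)
      (≈-trans (sum-cong-≋ (λ m → solve 3 (λ u v w → u :* (v :* w) := v :* (u :* w)) ≈-refl (φ w j m) s (r m)))
        (≈-sym (*-distribˡ-sum s (λ m → φ w j m * r m))))

  on-ray : ∀ v j {x} → (∀ i → i ≢ j → φ v i · (x ⊖ vtx v) ≈ 0#) →
           ∀ m → x m - vtx v m ≈ φ v j · (x ⊖ vtx v) * ray v j m
  on-ray v j {x} e m = ≈-trans (coords v (x ⊖ vtx v) m)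
    (sum-single (λ i → φ v i · (x ⊖ vtx v) * ray v i m) j (λ i i≢j → ≈-trans (*-congʳ (e i i≢j)) (zeroˡ _)))

  ray≉0 : ∀ v j → ¬ (ray v j ≋ 0ᵖ)
  ray≉0 v j e = 1≉0 (≈-trans (≈-sym (φ-nb v j)) (≈-trans (·-congˡ (φ v j) e) (·-0ᵖ (φ v j))))

  -- Such a `u` is reached from `v` by a multiple `t > 0` of the ray. If `t < 1` then `u`, and if
  -- `t > 1` then the neighbour, would lie strictly inside a segment of P, against `not-between`.
  nb-unique : ∀ v j u → u ≢ v → (∀ i → i ≢ j → φ v i · (vtx u ⊖ vtx v) ≈ 0#) → u ≡ nb v j
  nb-unique v j u u≢v e = V-injective λ m → diff≈0 (begin
      vtx u m - vtx w m                       ≈⟨ solve 3 (λ u w v → u :- w := (u :- v) :- (w :- v)) ≈-refl (vtx u m) (vtx w m) (vtx v m) ⟩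
      (vtx u m - vtx v m) - ray v j m         ≈⟨ +-congʳ (on-ray v j {vtx u} e m) ⟩
      t * ray v j m - ray v j m               ≈⟨ +-congʳ (≈-trans (*-congʳ t≈1) (*-identityˡ _)) ⟩
      ray v j m - ray v j m                   ≈⟨ -‿inverseʳ _ ⟩
      0#                                      ∎)
    where
    open ≈R
    w = nb v j
    t = φ v j · (vtx u ⊖ vtx v)
    t>0 : 0# < t
    t>0 with φ-nn v (vtx∈P u) j
    ... | inj₁ p = p
    ... | inj₂ z = contradiction (vtx-≡ v u λ i → all i (i Fin.≟ j)) u≢v
      where
      all : ∀ i → Dec (i ≡ j) → φ v i · (vtx u ⊖ vtx v) ≈ 0#
      all i (yes ≡.refl) = ≈-sym z
      all i (no i≢j) = e i i≢j
    u-v : ∀ m → vtx u m - vtx v m ≈ t * ray v j m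
    u-v = on-ray v j {vtx u} e
    t≈1 : t ≈ 1#
    t≈1 with compare t 1#
    ... | tri≈ _ t≈1 _ = t≈1
    ... | tri< t<1 _ _ = contradiction (not-between u (1# - t) t (ray v j) (vtx∈P w) (vtx∈P v) (pos-diff t<1) t>0
        (λ m → begin
          vtx w m - vtx u m                   ≈⟨ solve 3 (λ u w v → w :- u := (w :- v) :- (u :- v)) ≈-refl (vtx u m) (vtx w m) (vtx v m) ⟩
          ray v j m - (vtx u m - vtx v m)     ≈⟨ +-cong (≈-sym (*-identityˡ _)) (-‿cong (u-v m)) ⟩
          1# * ray v j m - t * ray v j m      ≈⟨ solve 3 (λ o t r → o :* r :- t :* r := (o :- t) :* r) ≈-refl 1# t (ray v j m) ⟩
          (1# - t) * ray v j m                ∎)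
        (λ m → begin
          vtx v m - vtx u m                   ≈⟨ solve 2 (λ u v → v :- u := :- (u :- v)) ≈-refl (vtx u m) (vtx v m) ⟩
          - (vtx u m - vtx v m)               ≈⟨ -‿cong (u-v m) ⟩
          - (t * ray v j m)                   ≈⟨ solve 2 (λ t r → :- (t :* r) := (:- t) :* r) ≈-refl t (ray v j m) ⟩
          - t * ray v j m                     ∎)) (ray≉0 v j)
    ... | tri> _ _ 1<t = contradiction (not-between w (t - 1#) 1# (ray v j) (vtx∈P u) (vtx∈P v) (pos-diff 1<t) 0<1
        (λ m → begin
          vtx u m - vtx w m                   ≈⟨ solve 3 (λ u w v → u :- w := (u :- v) :- (w :- v)) ≈-refl (vtx u m) (vtx w m) (vtx v m) ⟩
          (vtx u m - vtx v m) - ray v j m     ≈⟨ +-cong (u-v m) (-‿cong (≈-sym (*-identityˡ _))) ⟩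
          t * ray v j m - 1# * ray v j m      ≈⟨ solve 3 (λ o t r → t :* r :- o :* r := (t :- o) :* r) ≈-refl 1# t (ray v j m) ⟩
          (t - 1#) * ray v j m                ∎)
        (λ m → begin
          vtx v m - vtx w m                   ≈⟨ solve 2 (λ w v → v :- w := :- (w :- v)) ≈-refl (vtx w m) (vtx v m) ⟩
          - ray v j m                         ≈⟨ -‿cong (*-identityˡ _) ⟨
          - (1# * ray v j m)                  ≈⟨ solve 2 (λ t r → :- (t :* r) := (:- t) :* r) ≈-refl 1# (ray v j m) ⟩
          - 1# * ray v j m                    ∎)) (ray≉0 v j)

  module _ (F : Face P) where
    open Face F

    nb∈face : ∀ v j → facePoints F (vtx v) → normal · ray v j ≈ 0# → facePoints F (vtx (nb v j))
    nb∈face v j (_ , Fv) e = vtx∈P _ , ≈-trans (diff≈0 (≈-trans (≈-sym (·-⊖ normal _ _)) e)) Fv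

    face-nb : ∀ v j → facePoints F (vtx v) → facePoints F (vtx (nb v j)) → normal · ray v j ≈ 0#
    face-nb v j (_ , Fv) (_ , Fw) = ≈-trans (·-⊖ normal _ _) (≈-trans (+-cong Fw (-‿cong Fv)) (-‿inverseʳ _))

    -- The values of the normal on the rays at `v` are nonpositive and the coordinates of `x`
    -- nonnegative. Their products sum to zero, so each vanishes, and a nonzero coordinate puts its
    -- ray into the face.
    face-support : ∀ v → facePoints F (vtx v) → ∀ {x} → facePoints F x → ∀ j →
      ¬ (φ v j · (x ⊖ vtx v) ≈ 0#) → facePoints F (vtx (nb v j))
    face-support v v∈F@(_ , Fv) {x} (x∈P , Fx) j nz = nb∈face v j v∈F (*-zero-cancel nz
        (nonpos-sum≈0 {f = λ i → φ v i · (x ⊖ vtx v) * normal · ray v i}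
          (λ i → nn*nonpos (φ-nn v x∈P i) (down i)) (≈-trans (≈-sym (expand v normal _))
            (≈-trans (·-⊖ normal _ _) (≈-trans (+-cong Fx (-‿cong Fv)) (-‿inverseʳ _)))) j))
      where
      down : ∀ i → normal · ray v i ≤ 0#
      down i = ≤-respˡ (≈-sym (·-⊖ normal _ _)) (≤-respˡ (+-congˡ (-‿cong (≈-sym Fv)))
        (neg-nonpos (nn-resp (solve 2 (λ x y → y :- x := :- (x :- y)) ≈-refl _ offset) (nn-diff (valid _ (vtx∈P (nb v i)))))))

  module _ {F : Face P} (F-edge : IsEdge P F) (v : Fin n) (v∈F : facePoints F (vtx v)) where

    edge-unique : ∀ {i j} → facePoints F (vtx (nb v i)) → facePoints F (vtx (nb v j)) → i ≡ j
    edge-unique {i} {j} i∈F j∈F with i Fin.≟ j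
    ... | yes i≡j = i≡j
    ... | no i≢j = contradiction
      (vtx v ▹ two , (λ { zero → v∈F ; (suc zero) → i∈F ; (suc (suc zero)) → j∈F }) ,
        affinely-independent (vtx v) two ind) (proj₂ F-edge)
      where
      two : Vector (Point d) 2
      two = vtx (nb v i) ▹ vtx (nb v j) ▹ (λ ())
      apply : ∀ f α → combination α (λ i → two i ⊖ vtx v) ≋ 0ᵖ →
              α zero * f · ray v i + (α (suc zero) * f · ray v j + 0#) ≈ 0#
      apply f α e = ≈-trans (≈-sym (·-combination f α (λ i → two i ⊖ vtx v))) (≈-trans (·-congˡ f e) (·-0ᵖ f))
      ind : Independent (λ i → two i ⊖ vtx v)
      ind α e zero = ≈-trans (≈-sym (≈-trans
        (+-cong (≈-trans (*-congˡ (φ-nb v i)) (≈-trans (*-comm _ _) (*-identityˡ _)))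
          (≈-trans (+-congʳ (≈-trans (*-congˡ (φ-nb≢ v i j (i≢j ∘ ≡.sym))) (zeroʳ _))) (+-identityʳ _))) (+-identityʳ _)))
        (apply (φ v i) α e)
      ind α e (suc zero) = ≈-trans (≈-sym (≈-trans
        (+-cong (≈-trans (*-congˡ (φ-nb≢ v j i i≢j)) (zeroʳ _))
          (≈-trans (+-identityʳ _) (≈-trans (*-congˡ (φ-nb v j)) (≈-trans (*-comm _ _) (*-identityˡ _))))) (+-identityˡ _)))
        (apply (φ v j) α e)

    -- An edge has two affinely independent points, so one of them differs from `v` and has a
    -- nonzero coordinate there.
    edge-direction : ∃[ j ] facePoints F (vtx (nb v j))
    edge-direction with proj₁ F-edge
    ... | p , p∈F , ind with ≋0? (λ j → φ v j · (p zero ⊖ vtx v)) | ≋0? (λ j → φ v j · (p (suc zero) ⊖ vtx v))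
    ...   | inj₂ (j , nz) | _ = j , face-support F v v∈F (p∈F zero) j nz
    ...   | inj₁ _ | inj₂ (j , nz) = j , face-support F v v∈F (p∈F (suc zero)) j nz
    ...   | inj₁ z₀ | inj₁ z₁ = contradiction ind (flat-dependent (vtx v) (λ ()) p
        (λ { zero → (λ ()) , coords-zero v _ z₀ ; (suc zero) → (λ ()) , coords-zero v _ z₁ }) (s≤s (s≤s z≤n)))

    edge-flat : ∀ j → facePoints F (vtx (nb v j)) → ∀ {x} → facePoints F x → ∀ i → i ≢ j → φ v i · (x ⊖ vtx v) ≈ 0#
    edge-flat j j∈F {x} x∈F i i≢j with ≈0? (φ v i · (x ⊖ vtx v))
    ... | inj₁ z = z
    ... | inj₂ nz = contradiction (edge-unique (face-support F v v∈F x∈F i nz) j∈F) i≢j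

    edge-ends : ∀ j → facePoints F (vtx (nb v j)) → ∀ u → facePoints F (vtx u) → u ≢ v → u ≡ nb v j
    edge-ends j j∈F u u∈F u≢v = nb-unique v j u u≢v (edge-flat j j∈F u∈F)

  edge-⊆ : ∀ {F G} → IsEdge P F → ∀ v → facePoints F (vtx v) → facePoints G (vtx v) →
    ∀ j → facePoints F (vtx (nb v j)) → facePoints G (vtx (nb v j)) → ∀ x → facePoints F x → facePoints G x
  edge-⊆ {F} {G} F-edge v v∈F v∈G j j∈F j∈G x x∈F = proj₁ x∈F ,
    ≈-trans (diff≈0 (≈-trans (≈-sym (·-⊖ (Face.normal G) x (vtx v))) (≈-trans
      (expand v (Face.normal G) (x ⊖ vtx v))
      (≈-trans (sum-single (λ i → φ v i · (x ⊖ vtx v) * Face.normal G · ray v i) j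
        (λ i i≢j → ≈-trans (*-congʳ (edge-flat {F} F-edge v v∈F j j∈F x∈F i i≢j)) (zeroˡ _)))
        (≈-trans (*-congˡ (face-nb G v j v∈G j∈G)) (zeroʳ _)))))) (proj₂ v∈G)

  nb-adjacent : ∀ v j → Adjacent P (V (nb v j)) (V v)
  nb-adjacent v j = (nb≢ v j ∘ V-injective) , edge v j , isEdge v j , nb∈edge v j , v∈edge v j

  adjacent-nb : ∀ u v → Adjacent P (V u) (V v) → ∃[ j ] u ≡ nb v j
  adjacent-nb u v (u≉v , F , F-edge , u∈F , v∈F) =
    let j , j∈F = edge-direction {F} F-edge v v∈F
    in j , edge-ends {F} F-edge v v∈F j j∈F u u∈F (λ { ≡.refl → u≉v (λ _ → ≈-refl) })

-- In-degrees, faces and invariance of the in-degree distribution.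

module Orientations
  (em : ExcludedMiddle 0ℓ) (ℝ : RealField)
  {d : ℕ} (P : Polytopes.Polytope ℝ d)
  (full : Polytopes.FullDimensional ℝ P) (simple : Polytopes.Simple ℝ P)
  {n : ℕ} (V : Fin n → Polytopes.Vertex ℝ P)
  (V-injective : ∀ {i j} → Polytopes._≋_ ℝ (proj₁ (V i)) (proj₁ (V j)) → i ≡ j)
  (V-surjective : ∀ (v : Polytopes.Vertex ℝ P) → ∃[ i ] Polytopes._≋_ ℝ (proj₁ (V i)) (proj₁ v)) where

  open Corners em ℝ
  open Counting
  open Sizes
  open SimplePolytope em ℝ P full simple V V-injective V-surjective public

  index : Vertex P → Fin n
  index u = proj₁ (V-surjective u)

  vtx-index : ∀ u → vtx (index u) ≋ proj₁ u
  vtx-index u = proj₂ (V-surjective u)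

  inB outB : Point d → Fin n → Fin d → Bool
  inB c v j = c · vtx (nb v j) <? c · vtx v
  outB c v j = c · vtx v <? c · vtx (nb v j)

  indeg outdeg : Point d → Fin n → ℕ
  indeg c v = count (inB c v)
  outdeg c v = count (outB c v)

  private
    EdgeIn : Point d → Vertex P → Face P → Set
    EdgeIn c v F = IsEdge P F × facePoints F (proj₁ v) ×
      Σ[ u ∈ Vertex P ] (facePoints F (proj₁ u) × c · proj₁ u < c · proj₁ v)

    resp-< : ∀ c {x x′ y y′ : Point d} → x ≋ x′ → y ≋ y′ → c · x < c · y → c · x′ < c · y′
    resp-< c ex ey p = proj₁ <-resp-≈ (·-congˡ c ey) (proj₂ <-resp-≈ (·-congˡ c ex) p)

  in-edges : ∀ c v → HasInDegree P c (indeg c v) (V v)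
  in-edges c v = size-subset (Subsetoid (FaceSetoid P) (EdgeIn c (V v))) (inB c v)
    (λ (j , t) → edge v j , isEdge v j , v∈edge v j , V (nb v j) , nb∈edge v j , <?-sound t)
    (λ {(i , _)} {(j , _)} same → edge-unique {edge v j} (isEdge v j) v (v∈edge v j)
      (Equivalence.to (same _) (nb∈edge v i)) (nb∈edge v j))
    (λ (F , F-edge , v∈F , u , u∈F , cu<cv) →
      let j , j∈F = edge-direction {F} F-edge v v∈F
          e = edge-ends {F} F-edge v v∈F j j∈F (index u) (facePoints-resp F (λ m → ≈-sym (vtx-index u m)) u∈F)
                (λ i≡v → <-irrefl (resp-< c {y = vtx v} (λ m → ≈-trans (≈-sym (vtx-index u m)) (≈-reflexive (≡.cong (λ i → vtx i m) i≡v))) (λ _ → ≈-refl) cu<cv))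
      in (j , <?-complete (resp-< c {y = vtx v} (λ m → ≈-trans (≈-sym (vtx-index u m)) (≈-reflexive (≡.cong (λ i → vtx i m) e))) (λ _ → ≈-refl) cu<cv))
       , λ x → mk⇔ (edge-⊆ {edge v j} {F} (isEdge v j) v (v∈edge v j) v∈F j (nb∈edge v j) j∈F x)
                   (edge-⊆ {F} {edge v j} F-edge v v∈F (v∈edge v j) j j∈F (nb∈edge v j) x))

  in-degree-unique : ∀ c {k} u → HasInDegree P c k u → k ≡ indeg c (index u)
  in-degree-unique c {k} u size = ℕ.≤-antisym
      (size-≤ {S = Subsetoid (FaceSetoid P) (EdgeIn c u)} {S′ = Subsetoid (FaceSetoid P) (EdgeIn c (V (index u)))}
        size (in-edges c (index u)) (move u (V (index u)) (λ m → ≈-sym (vtx-index u m))) id)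
      (size-≤ {S = Subsetoid (FaceSetoid P) (EdgeIn c (V (index u)))} {S′ = Subsetoid (FaceSetoid P) (EdgeIn c u)}
        (in-edges c (index u)) size (move (V (index u)) u (vtx-index u)) id)
    where
    move : ∀ (u v : Vertex P) → proj₁ u ≋ proj₁ v → Σ (Face P) (EdgeIn c u) → Σ (Face P) (EdgeIn c v)
    move u v e (F , F-edge , u∈F , w , w∈F , p) =
      F , F-edge , facePoints-resp F e u∈F , w , w∈F , resp-< c {x = proj₁ w} (λ _ → ≈-refl) e p

  h-multiplicity : ∀ c (i : ℕ) {k} → HasSize (Subsetoid (Vertices P) (HasInDegree P c i)) k →
                   k ≡ multiplicity (indeg c) i
  h-multiplicity c i size = ℕ.≤-antisym
    (size-≤ {S = S} {S′ = S} size canonical id id) (size-≤ {S = S} {S′ = S} canonical size id id)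
    where
    S = Subsetoid (Vertices P) (HasInDegree P c i)
    canonical : HasSize S (multiplicity (indeg c) i)
    canonical = size-subset S (λ v → indeg c v ℕ.≡ᵇ i)
      (λ (v , t) → V v , ≡.subst (λ k → HasInDegree P c k (V v)) (ℕ.≡ᵇ⇒≡ _ i t) (in-edges c v))
      V-injective
      (λ (u , size) → (index u , ℕ.≡⇒≡ᵇ _ i (≡.sym (in-degree-unique c u size))) , vtx-index u)

  generic-nb : ∀ {c} → Generic P c → ∀ v j → ¬ (c · vtx (nb v j) ≈ c · vtx v)
  generic-nb gen v j = gen (V (nb v j)) (V v) (nb-adjacent v j)

  out-complement : ∀ {c} → Generic P c → ∀ v j → outB c v j ≡ not (inB c v j)
  out-complement {c} gen v j = T-≡
    (λ t → not-T (λ s → <-asym (<?-sound t) (<?-sound s)))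
    (λ t → <?-complete (case ≮⇒≥ (T-not t ∘ <?-complete) of λ
      { (inj₁ p) → p ; (inj₂ e) → contradiction (≈-sym e) (generic-nb gen v j) }))

  generic-neg : ∀ {c} → Generic P c → Generic P (-ᵖ c)
  generic-neg {c} gen u v adj e = gen u v adj (≈-trans (solve 1 (λ x → x := :- (:- x)) ≈-refl _)
    (≈-trans (-‿cong (≈-trans (≈-sym (neg-· c (proj₁ u))) (≈-trans e (neg-· c (proj₁ v)))))
      (solve 1 (λ x → :- (:- x) := x) ≈-refl _)))

  indeg-neg : ∀ c v → indeg (-ᵖ c) v ≡ outdeg c v
  indeg-neg c v = count-cong λ j → T-≡
    (λ t → <?-complete (diff-pos (pos-resp (trade j) (pos-diff (<?-sound t)))))
    (λ t → <?-complete (diff-pos (pos-resp (≈-sym (trade j)) (pos-diff (<?-sound t)))))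
    where
    trade : ∀ j → (-ᵖ c) · vtx v - (-ᵖ c) · vtx (nb v j) ≈ c · vtx (nb v j) - c · vtx v
    trade j = ≈-trans (+-cong (neg-· c _) (-‿cong (neg-· c _))) (solve 2 (λ x y → :- x :- :- y := y :- x) ≈-refl _ _)

  -- The face spanned by the edges S at v is the zero set of Σ_{j ∉ S} φ v j, which is nonnegative on P − v.
  module _ (v : Fin n) (S : Fin d → Bool) where
    private
      ω : Vector Carrier d
      ω j = if S j then 0# else 1#

      ω≥0 : ∀ j → 0# ≤ ω j
      ω≥0 j with S j
      ... | true = 0≤0
      ... | false = inj₁ 0<1

    coface : Point d
    coface = combination ω (φ v)

    coface-· : ∀ y → coface · y ≈ sum (λ j → ω j * φ v j · y)
    coface-· y = ≈-trans (·-comm coface y) (≈-trans (·-combination y ω (φ v)) (sum-cong-≋ (λ j → *-congˡ (·-comm y (φ v j)))))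

    coface-nn : ∀ {x} → points P x → 0# ≤ coface · (x ⊖ vtx v)
    coface-nn x∈P = nn-resp (≈-sym (coface-· _)) (sum-nn (λ j → nn*nn (ω≥0 j) (φ-nn v x∈P j)))

    -- A face is recorded by its set of vertices, so that descriptions from different corners can be
    -- compared.
    inF : Fin n → Bool
    inF u = zero? (coface · (vtx u ⊖ vtx v))

    inF-sound : ∀ u → T (inF u) → ∀ j → ¬ T (S j) → φ v j · (vtx u ⊖ vtx v) ≈ 0#
    inF-sound u t j j∉S with S j | nn-sum≈0 (λ j → nn*nn (ω≥0 j) (φ-nn v (vtx∈P u) j))
                                  (≈-trans (≈-sym (coface-· _)) (zero?-sound t)) j
    ... | true | _ = contradiction tt j∉S
    ... | false | e = ≈-trans (≈-sym (*-identityˡ _)) e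

    inF-complete : ∀ u → (∀ j → ¬ T (S j) → φ v j · (vtx u ⊖ vtx v) ≈ 0#) → T (inF u)
    inF-complete u e = zero?-complete (≈-trans (coface-· _) (sum-zero term))
      where
      term : ∀ j → ω j * φ v j · (vtx u ⊖ vtx v) ≈ 0#
      term j with S j | e j
      ... | true | _ = zeroˡ _
      ... | false | e = ≈-trans (*-congˡ (e (λ ()))) (zeroʳ _)

    self∈F : T (inF v)
    self∈F = inF-complete v (λ j _ → ⊖-self (φ v j) (vtx v))

    inF-nb : ∀ j → inF (nb v j) ≡ S j
    inF-nb j = T-≡
      (λ t → case Bool.T? (S j) of λ { (yes s) → s ; (no ¬s) → contradiction (≈-trans (≈-sym (φ-nb v j)) (inF-sound (nb v j) t j ¬s)) 1≉0 })
      (λ s → inF-complete (nb v j) (λ i i∉S → φ-nb≢ v i j (λ { ≡.refl → i∉S s })))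

  module _ (v : Fin n) (S : Fin d → Bool) {w : Fin n} (w∈F : T (inF v S w)) where
    private
      g = coface v S

    trace : Fin d → Bool
    trace i = inF v S (nb w i)

    private
      shift : ∀ u → g · (vtx u ⊖ vtx v) ≈ g · (vtx u ⊖ vtx w)
      shift u = ≈-trans (·-⊖ g _ _) (≈-trans
        (solve 3 (λ u v w → u :- v := (u :- w) :+ (w :- v)) ≈-refl (g · vtx u) (g · vtx v) (g · vtx w))
        (≈-trans (+-cong (≈-sym (·-⊖ g _ _)) (≈-trans (≈-sym (·-⊖ g _ _)) (zero?-sound w∈F))) (+-identityʳ _)))

      term : ∀ u → Vector Carrier d
      term u i = φ w i · (vtx u ⊖ vtx w) * g · ray w i

      total : ∀ u → g · (vtx u ⊖ vtx v) ≈ sum (term u)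
      total u = ≈-trans (shift u) (expand w g _)

      term-nn : ∀ u i → 0# ≤ term u i
      term-nn u i = nn*nn (φ-nn w (vtx∈P u) i) (nn-resp (shift (nb w i)) (coface-nn v S (vtx∈P (nb w i))))

    -- As `coface v S` vanishes on `vtx w ⊖ vtx v`, it may be measured from `w` instead of `v`. Its
    -- values on the rays at `w` are nonnegative, so it is zero at `u` exactly when the coordinates
    -- of `u` off the traced rays are zero.
    rebase : ∀ u → inF v S u ≡ inF w trace u
    rebase u = T-≡
      (λ t → inF-complete w trace u λ i i∉S′ → *-zero-cancel
        (λ z → i∉S′ (zero?-complete (≈-trans (shift (nb w i)) z)))
        (≈-trans (*-comm _ _) (nn-sum≈0 (term-nn u) (≈-trans (≈-sym (total u)) (zero?-sound t)) i)))
      (λ t → zero?-complete (≈-trans (total u) (sum-zero λ i → case Bool.T? (trace i) of λ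
        { (yes s) → ≈-trans (*-congˡ (≈-trans (≈-sym (shift (nb w i))) (zero?-sound s))) (zeroʳ _)
        ; (no ¬s) → ≈-trans (*-congʳ (inF-sound w trace u t i ¬s)) (zeroˡ _) })))

    -- The |S| independent directions of the face at v lie in the span of the |trace| directions at w.
    dimension-≤ : count S ℕ.≤ count trace
    dimension-≤ = ℕ.≮⇒≥ λ lt →
      let α , (a , αa) , e = dependent coordinates lt
      in αa (zero-at α (λ i → Y≈0 α e i (Bool.T? (trace i))) a)
      where
      at : Fin (count S) → Fin d
      at a = proj₁ (Inverse.from (Sub-fin S) a)
      at′ : Fin (count trace) → Fin d
      at′ b = proj₁ (Inverse.from (Sub-fin trace) b)
      coordinates : Vector (Point (count trace)) (count S)
      coordinates a b = φ w (at′ b) · ray v (at a)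
      Y : Vector Carrier (count S) → Point d
      Y α = combination α (ray v ∘ at)
      outside : ∀ i → ¬ T (trace i) → ∀ a → φ w i · ray v (at a) ≈ 0#
      outside i i∉ a = begin
        φ w i · (vtx u ⊖ vtx v)                              ≈⟨ ·-⊖ (φ w i) _ _ ⟩
        φ w i · vtx u - φ w i · vtx v
          ≈⟨ solve 3 (λ u v w → u :- v := (u :- w) :- (v :- w)) ≈-refl (φ w i · vtx u) (φ w i · vtx v) (φ w i · vtx w) ⟩
        (φ w i · vtx u - φ w i · vtx w) - (φ w i · vtx v - φ w i · vtx w)
          ≈⟨ +-cong (≈-trans (≈-sym (·-⊖ (φ w i) _ _)) (inF-sound w trace u u∈ i i∉))
               (-‿cong (≈-trans (≈-sym (·-⊖ (φ w i) _ _)) (inF-sound w trace v v∈ i i∉))) ⟩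
        0# - 0#                                              ≈⟨ -‿inverseʳ 0# ⟩
        0#                                                   ∎
        where
        open ≈R
        u = nb v (at a)
        u∈ : T (inF w trace u)
        u∈ = ≡.subst T (≡.trans (≡.sym (inF-nb v S (at a))) (rebase u)) (proj₂ (Inverse.from (Sub-fin S) a))
        v∈ : T (inF w trace v)
        v∈ = ≡.subst T (rebase v) (self∈F v S)
      Y≈0 : ∀ α → combination α coordinates ≋ 0ᵖ → ∀ i → Dec (T (trace i)) → φ w i · Y α ≈ 0#
      Y≈0 α e i (no i∉) = ≈-trans (·-combination (φ w i) α (ray v ∘ at)) (sum-zero λ a → ≈-trans (*-congˡ (outside i i∉ a)) (zeroʳ (α a)))
      Y≈0 α e i (yes i∈) = ≡.subst (λ i → φ w i · Y α ≈ 0#) (≡.cong proj₁ (Inverse.strictlyInverseʳ (Sub-fin trace) (i , i∈)))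
        (≈-trans (·-combination (φ w (at′ b)) α (ray v ∘ at)) (e b))
        where b = Inverse.to (Sub-fin trace) (i , i∈)
      at-injective : ∀ {a b} → at a ≡ at b → a ≡ b
      at-injective {a} {b} e = ≡.trans (≡.sym (Inverse.strictlyInverseˡ (Sub-fin S) a))
        (≡.trans (≡.cong (Inverse.to (Sub-fin S)) (Sub-≡ {B = S} e)) (Inverse.strictlyInverseˡ (Sub-fin S) b))
      zero-at : ∀ α → (∀ i → φ w i · Y α ≈ 0#) → ∀ a → α a ≈ 0#
      zero-at α z a = begin
        α a                                        ≈⟨ ≈-trans (≈-sym (*-identityˡ (α a))) (*-comm 1# (α a)) ⟩
        α a * 1#                                   ≈⟨ *-congˡ (φ-nb v (at a)) ⟨
        α a * φ v (at a) · ray v (at a)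
          ≈⟨ sum-single (λ b → α b * φ v (at a) · ray v (at b)) a
               (λ b b≢a → ≈-trans (*-congˡ (φ-nb≢ v (at a) (at b) (b≢a ∘ at-injective))) (zeroʳ (α b))) ⟨
        sum (λ b → α b * φ v (at a) · ray v (at b))    ≈⟨ ·-combination (φ v (at a)) α (ray v ∘ at) ⟨
        φ v (at a) · Y α                           ≈⟨ ≈-trans (·-congˡ (φ v (at a)) (coords-zero w (Y α) z)) (·-0ᵖ (φ v (at a))) ⟩
        0#                                         ∎
        where open ≈R

  -- `dimension-≤` is used twice: tracing at `v` the face described from `w` returns `S`.
  dimension : ∀ v S {w} (w∈F : T (inF v S w)) → count (trace v S w∈F) ≡ count S
  dimension v S {w} w∈F = ℕ.≤-antisym
    (ℕ.≤-trans (dimension-≤ w (trace v S w∈F) v∈) (ℕ.≤-reflexive (count-cong λ j →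
      ≡.trans (≡.sym (rebase v S w∈F (nb v j))) (inF-nb v S j))))
    (dimension-≤ v S w∈F)
    where
    v∈ : T (inF w (trace v S w∈F) v)
    v∈ = ≡.subst T (rebase v S w∈F v) (self∈F v S)

  module _ (c : Point d) (v : Fin n) (S : Fin d → Bool) (S⊆in : ∀ j → T (S j) → T (inB c v j)) where

    -- Seen from `v`, the face has nonnegative coordinates supported on `S`, and `c` decreases along
    -- these rays. It serves for the sink with all rays and for facets with all but one.
    top-of-face : ∀ u → T (inF v S u) → u ≢ v → c · vtx u < c · vtx v
    top-of-face u u∈F u≢v = drop (sum-nonpos term≤0)
      where
      term : Vector Carrier d
      term j = φ v j · (vtx u ⊖ vtx v) * c · ray v j
      ray<0 : ∀ j → T (S j) → c · ray v j < 0#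
      ray<0 j s = neg-neg (pos-resp (≈-trans (solve 2 (λ x y → y :- x := :- (x :- y)) ≈-refl _ _) (-‿cong (≈-sym (·-⊖ c _ _))))
        (pos-diff (<?-sound (S⊆in j s))))
      term≤0 : ∀ j → term j ≤ 0#
      term≤0 j with Bool.T? (S j)
      ... | yes s = nn*nonpos (φ-nn v (vtx∈P u) j) (inj₁ (ray<0 j s))
      ... | no ¬s = inj₂ (≈-trans (*-congʳ (inF-sound v S u u∈F j ¬s)) (zeroˡ _))
      all-zero : (∀ j → term j ≈ 0#) → ∀ j → φ v j · (vtx u ⊖ vtx v) ≈ 0#
      all-zero z j with Bool.T? (S j)
      ... | yes s = *-zero-cancel (λ e → irrefl e (ray<0 j s)) (≈-trans (*-comm _ _) (z j))
      ... | no ¬s = inF-sound v S u u∈F j ¬s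
      c-diff : c · vtx u - c · vtx v ≈ sum term
      c-diff = ≈-trans (≈-sym (·-⊖ c _ _)) (expand v c _)
      drop : sum term ≤ 0# → c · vtx u < c · vtx v
      drop (inj₁ p) = diff-pos (pos-resp (≈-trans (-‿cong (≈-sym c-diff)) (solve 2 (λ x y → :- (x :- y) := y :- x) ≈-refl _ _)) (neg-pos p))
      drop (inj₂ e) = contradiction (vtx-≡ v u (all-zero (nonpos-sum≈0 term≤0 e))) u≢v

    top-unique : ∀ w → T (inF v S w) → (∀ u → T (inF v S u) → c · vtx u ≤ c · vtx w) → w ≡ v
    top-unique w w∈F top with w Fin.≟ v
    ... | yes w≡v = w≡v
    ... | no w≢v = contradiction (top-of-face w w∈F w≢v) (≤⇒≯ (top v (self∈F v S)))

  -- A pair stands for the k-face spanned by the chosen in-edges, whose top vertex is the given one.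
  TopCorner : ℕ → Point d → Set
  TopCorner k c = Σ (Fin n) (λ v → KSubset k (inB c v))

  module _ {k : ℕ} {c c′ : Point d} (gen′ : Generic P c′) where
    private
      module _ (v : Fin n) (s : KSubset k (inB c v)) where
        S : Fin d → Bool
        S = mem (inB c v) s

        best = argmax (inF v S) (λ u → c′ · vtx u) (v , self∈F v S)
        w = proj₁ best
        w∈F = proj₁ (proj₂ best)

        S′ : Fin d → Bool
        S′ = trace v S w∈F

        S′⊆in : ∀ i → T (S′ i) → T (inB c′ w i)
        S′⊆in i t = <?-complete (case proj₂ (proj₂ best) (nb w i) t of λ
          { (inj₁ p) → p ; (inj₂ e) → contradiction e (generic-nb gen′ w i) })

        s′ = subset S′ (inB c′ w) S′⊆in (≡.trans (dimension v S w∈F) (count-mem (inB c v) s))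

        same-face : ∀ u → inF v S u ≡ inF w (mem (inB c′ w) (proj₁ s′)) u
        same-face u = ≡.trans (rebase v S w∈F u) (T-≡
          (λ t → inF-complete w _ u (λ j ¬m → inF-sound w S′ u t j (¬m ∘ ≡.subst T (≡.sym (proj₂ s′ j)))))
          (λ t → inF-complete w S′ u (λ j ¬m → inF-sound w _ u t j (¬m ∘ ≡.subst T (proj₂ s′ j)))))

      -- The same face described from its top vertex for `c′`. The vertex set of the face is
      -- preserved, and it determines the top vertex for `c` as well as the edges there that lie in
      -- the face; hence `convert-injective`.
      convert : TopCorner k c → TopCorner k c′
      convert (v , s) = w v s , proj₁ (s′ v s)

      same-face-≡ : ∀ {v s u t} → convert (v , s) ≡ convert (u , t) → ∀ x → inF v (S v s) x ≡ inF u (S u t) x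
      same-face-≡ {v} {s} {u} {t} e x = ≡.trans (same-face v s x)
        (≡.trans (≡.cong (λ (w , r) → inF w (mem (inB c′ w) r) x) e) (≡.sym (same-face u t x)))

      convert-injective : ∀ {x y} → convert x ≡ convert y → x ≡ y
      convert-injective {v , s} {u , t} e = same-vertex v≡u (same-face-≡ {v} {s} {u} {t} e)
        where
        v≡u : v ≡ u
        v≡u = top-unique c u (S u t) (mem⊆ (inB c u) t) v
          (≡.subst T (same-face-≡ {v} {s} {u} {t} e v) (self∈F v (S v s)))
          (λ x x∈ → case x Fin.≟ v of λ
            { (yes ≡.refl) → inj₂ ≈-refl
            ; (no x≢v) → inj₁ (top-of-face c v (S v s) (mem⊆ (inB c v) s) x
                (≡.subst T (≡.sym (same-face-≡ {v} {s} {u} {t} e x)) x∈) x≢v) })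
        same-vertex : ∀ {v s u t} → v ≡ u → (∀ x → inF v (S v s) x ≡ inF u (S u t) x) → (v , s) ≡ (u , t)
        same-vertex {v} {s} {.v} {t} ≡.refl e = ≡.cong (v ,_) (mem-injective (inB c v) λ j →
          ≡.trans (≡.sym (inF-nb v (S v s) j)) (≡.trans (e (nb v j)) (inF-nb v (S v t) j)))

    moment-≤ : ℕΣ.sum (λ v → indeg c v Binomial.C k) ℕ.≤ ℕΣ.sum (λ v → indeg c′ v Binomial.C k)
    moment-≤ = injection⇒≤ (Σ-fin (λ v → KSubset-fin k (inB c v))) (Σ-fin (λ v → KSubset-fin k (inB c′ v)))
      convert convert-injective

  indeg≤d : ∀ c v → indeg c v ℕ.≤ d
  indeg≤d c v = ℕ.≤-trans (ℕ.m≤m+n (indeg c v) _) (ℕ.≤-reflexive (count-complement (inB c v)))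

  multiplicity-invariant : ∀ {c c′} → Generic P c → Generic P c′ →
    ∀ i → multiplicity (indeg c) i ≡ multiplicity (indeg c′) i
  multiplicity-invariant {c} {c′} gen gen′ = binomial-moments (indeg c) (indeg c′) (indeg≤d c) (indeg≤d c′)
    (λ k → ℕ.≤-antisym (moment-≤ {k} {c} {c′} gen′) (moment-≤ {k} {c′} {c} gen))

  hProduct-outdeg : ∀ {c} → Generic P c → (h : Vector ℕ (suc d)) → IsHVector P h →
    hProduct h ≡ ℕΠ.sum (λ v → 1 ℕ.⊔ outdeg c v)
  hProduct-outdeg {c} gen h (c₀ , gen₀ , sizes) =
    hProduct-multiplicity (outdeg c) (λ v → ≡.subst (ℕ._≤ d) (indeg-neg c v) (indeg≤d (-ᵖ c) v)) h λ i →
      ≡.trans (h-multiplicity c₀ (toℕ i) (sizes i)) (≡.trans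
        (multiplicity-invariant gen₀ (generic-neg gen) (toℕ i))
        (count-cong (λ v → ≡.cong (ℕ._≡ᵇ toℕ i) (indeg-neg c v))))

-- Facets and the number of branching vertices.

module FacetCount
  (em : ExcludedMiddle 0ℓ) (ℝ : RealField)
  {d : ℕ} (P : Polytopes.Polytope ℝ d)
  (full : Polytopes.FullDimensional ℝ P) (simple : Polytopes.Simple ℝ P)
  {n : ℕ} (V : Fin n → Polytopes.Vertex ℝ P)
  (V-injective : ∀ {i j} → Polytopes._≋_ ℝ (proj₁ (V i)) (proj₁ (V j)) → i ≡ j)
  (V-surjective : ∀ (v : Polytopes.Vertex ℝ P) → ∃[ i ] Polytopes._≋_ ℝ (proj₁ (V i)) (proj₁ v)) where

  open Corners em ℝ
  open Counting
  open Sizes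
  open Orientations em ℝ P full simple V V-injective V-surjective public

  -- A `punchIn` on `pred d`, the dimension in `IsFacet`, for a `d` that is not visibly a successor.
  skip : ∀ {d} → Fin d → Fin (ℕ.pred d) → Fin d
  skip {suc d} j = punchIn j

  skip-≢ : ∀ {d} (j : Fin d) i → skip j i ≢ j
  skip-≢ {suc d} j = Fin.punchInᵢ≢i j

  skip-injective : ∀ {d} (j : Fin d) {i k} → skip j i ≡ skip j k → i ≡ k
  skip-injective {suc d} j = Fin.punchIn-injective j _ _

  sum-skip : ∀ {d} (f : Vector Carrier d) j → f j ≈ 0# → sum f ≈ sum (f ∘ skip j)
  sum-skip {suc d} f j z = ≈-trans (sum-remove {i = j} f) (≈-trans (+-congʳ z) (+-identityˡ _))

  module _ (v : Fin n) (j : Fin d) where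

    private
      flip : ∀ x → φ v j · (x ⊖ vtx v) ≈ (-ᵖ φ v j) · vtx v - (-ᵖ φ v j) · x
      flip x = begin
        φ v j · (x ⊖ vtx v)                        ≈⟨ ·-⊖ (φ v j) x (vtx v) ⟩
        φ v j · x - φ v j · vtx v
          ≈⟨ solve 2 (λ x y → x :- y := :- y :- :- x) ≈-refl (φ v j · x) (φ v j · vtx v) ⟩
        - φ v j · vtx v - - φ v j · x
          ≈⟨ +-cong (neg-· (φ v j) (vtx v)) (-‿cong (neg-· (φ v j) x)) ⟨
        (-ᵖ φ v j) · vtx v - (-ᵖ φ v j) · x        ∎
        where open ≈R

    -- Faces are presented by upper bounds, whence the sign: this is where the nonnegative
    -- coordinate `φ v j` attains zero.
    facet : Face P
    facet = record
      { normal = -ᵖ φ v j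
      ; offset = (-ᵖ φ v j) · vtx v
      ; valid = λ x x∈P → diff-nn (nn-resp (flip x) (φ-nn v x∈P j))
      }

    facet-φ : ∀ {x} → facePoints facet x → φ v j · (x ⊖ vtx v) ≈ 0#
    facet-φ {x} (_ , e) = ≈-trans (flip x) (≈-trans (+-congˡ (-‿cong e)) (-‿inverseʳ _))

    φ-facet : ∀ {x} → points P x → φ v j · (x ⊖ vtx v) ≈ 0# → facePoints facet x
    φ-facet {x} x∈P e = x∈P , ≈-sym (diff≈0 (≈-trans (≈-sym (flip x)) e))

    v∈facet : facePoints facet (vtx v)
    v∈facet = φ-facet (vtx∈P v) (⊖-self _ _)

    nb∈facet : ∀ i → i ≢ j → facePoints facet (vtx (nb v i))
    nb∈facet i i≢j = φ-facet (vtx∈P (nb v i)) (φ-nb≢ v j i i≢j)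

    isFacet : IsFacet P facet
    isFacet = (vtx v ▹ u , (λ { zero → v∈facet ; (suc i) → nb∈facet (skip j i) (skip-≢ j i) }) ,
        affinely-independent (vtx v) u ind) ,
      λ (p , p∈ , aff) → flat-dependent (vtx v) (ray v ∘ skip j) p (λ i → span (facet-φ (p∈ i))) ℕ.≤-refl aff
      where
      u : Vector (Point d) (ℕ.pred d)
      u i = vtx (nb v (skip j i))
      ind : Independent (λ i → u i ⊖ vtx v)
      ind α e i = begin
        α i                                   ≈⟨ ≈-trans (≈-sym (*-identityˡ (α i))) (*-comm 1# (α i)) ⟩
        α i * 1#                              ≈⟨ *-congˡ (φ-nb v (skip j i)) ⟨
        α i * f · ray v (skip j i)            ≈⟨ sum-single (λ k → α k * f · ray v (skip j k)) i
                                                   (λ k k≢i → ≈-trans (*-congˡ (φ-nb≢ v _ _ (k≢i ∘ skip-injective j))) (zeroʳ (α k))) ⟨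
        sum (λ k → α k * f · ray v (skip j k))    ≈⟨ ·-combination f α (ray v ∘ skip j) ⟨
        f · combination α (ray v ∘ skip j)    ≈⟨ ≈-trans (·-congˡ f e) (·-0ᵖ f) ⟩
        0#                                    ∎
        where
        open ≈R
        f = φ v (skip j i)
      span : ∀ {x} → φ v j · (x ⊖ vtx v) ≈ 0# → Spanned (ray v ∘ skip j) (x ⊖ vtx v)
      span {x} e = (λ i → φ v (skip j i) · (x ⊖ vtx v)) , λ m → ≈-trans (coords v (x ⊖ vtx v) m)
        (sum-skip (λ i → φ v i · (x ⊖ vtx v) * ray v i m) j (≈-trans (*-congʳ e) (zeroˡ _)))

  element : ∀ {N} (B : Fin N → Bool) → Fin (count B) → Sub B
  element B = Inverse.from (Sub-fin B)

  count≡0 : ∀ {N} (B : Fin N → Bool) → count B ≡ 0 → ∀ i → ¬ T (B i)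
  count≡0 B e i t = Fin.¬Fin0 (≡.subst Fin e (Inverse.to (Sub-fin B) (i , t)))

  count≡1 : ∀ {N} (B : Fin N → Bool) → count B ≡ 1 → ∃[ j ] (T (B j) × (∀ i → i ≢ j → ¬ T (B i)))
  count≡1 B e = proj₁ x , proj₂ x , λ i i≢j t → i≢j (≡.cong proj₁
      (≡.trans (≡.sym (Inverse.strictlyInverseʳ (Sub-fin B) (i , t))) (≡.cong (element B) (only e _ _))))
    where
    only : ∀ {k} → k ≡ 1 → (x y : Fin k) → x ≡ y
    only ≡.refl zero zero = ≡.refl
    x = element B (≡.subst Fin (≡.sym e) zero)

  count≥2 : ∀ {N} (B : Fin N → Bool) → 2 ℕ.≤ count B → Σ[ x ∈ Sub B ] Σ[ y ∈ Sub B ] proj₁ x ≢ proj₁ y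
  count≥2 B le = element B x , element B y , λ e → x≢y le (≡.trans (≡.sym (Inverse.strictlyInverseˡ (Sub-fin B) x))
      (≡.trans (≡.cong (Inverse.to (Sub-fin B)) (Sub-≡ {B = B} e)) (Inverse.strictlyInverseˡ (Sub-fin B) y)))
    where
    x = Fin.fromℕ< (ℕ.<-≤-trans (s≤s z≤n) le)
    y = Fin.fromℕ< le
    x≢y : ∀ {k} (le : 2 ℕ.≤ k) → Fin.fromℕ< (ℕ.<-≤-trans (s≤s z≤n) le) ≢ Fin.fromℕ< le
    x≢y (s≤s (s≤s _)) ()

  module WithObjective {c : Point d} (gen : Generic P c) where

    not-out : ∀ v j → ¬ T (outB c v j) → T (inB c v j)
    not-out v j ¬out with inB c v j | out-complement gen v j
    ... | true | _ = tt
    ... | false | e = contradiction (≡.subst T (≡.sym e) tt) ¬out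

    sink-top : ∀ v → outdeg c v ≡ 0 → ∀ u → u ≢ v → c · vtx u < c · vtx v
    sink-top v sink u = top-of-face c v (λ _ → true) (λ j _ → not-out v j (count≡0 (outB c v) sink j)) u
      (inF-complete v (λ _ → true) u (λ j ¬t → contradiction tt ¬t))

    sink-unique : ∀ v w → outdeg c v ≡ 0 → outdeg c w ≡ 0 → v ≡ w
    sink-unique v w sv sw with v Fin.≟ w
    ... | yes v≡w = v≡w
    ... | no v≢w = contradiction (sink-top v sv w (v≢w ∘ ≡.sym)) (<-asym (sink-top w sw v v≢w))

    sink-exists : Fin n → ∃[ v ] outdeg c v ≡ 0
    sink-exists i =
      let v , _ , top = argmax (λ _ → true) (λ u → c · vtx u) (i , tt)
      in v , ℕΣ.sum-zero {d} {bit ∘ outB c v} (λ j → bit-false (λ t → ≤⇒≯ (top (nb v j) tt) (<?-sound t)))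

    -- The facet at `v` missing ray `j` has `v` on top once no other edge at `v` ascends; edge `j`
    -- may go either way. So the sink allows d directions `j`, and a vertex of out-degree one only
    -- the direction of its out-edge.
    TopFacet : Set
    TopFacet = Σ[ v ∈ Fin n ] Σ[ j ∈ Fin d ] (∀ i → i ≢ j → ¬ T (outB c v i))

    facet-top : ((v , j , _) : TopFacet) → ∀ u → facePoints (facet v j) (vtx u) → u ≢ v → c · vtx u < c · vtx v
    facet-top (v , j , top) u u∈ = top-of-face c v S (λ i t → not-out v i (top i (S⇒≢ i t))) u
      (inF-complete v S u λ i ¬t → ≡.subst (λ i → φ v i · (vtx u ⊖ vtx v) ≈ 0#) (≡.sym (¬S⇒≡ i ¬t)) (facet-φ v j u∈))
      where
      S : Fin d → Bool
      S i = not ⌊ i Fin.≟ j ⌋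
      S⇒≢ : ∀ i → T (S i) → i ≢ j
      S⇒≢ i t i≡j = T-not t (fromWitness {a? = i Fin.≟ j} i≡j)
      ¬S⇒≡ : ∀ i → ¬ T (S i) → i ≡ j
      ¬S⇒≡ i ¬t with i Fin.≟ j
      ... | yes i≡j = i≡j
      ... | no _ = contradiction tt ¬t

    toFacet : TopFacet → Setoid.Carrier (Facets P)
    toFacet (v , j , _) = facet v j , isFacet v j

    -- Two vertices of one facet cannot each be strictly above the other. At a common vertex, the
    -- neighbour along `k` lies on the facet missing `j` unless `j` is `k`.
    facet-injective : (x y : TopFacet) → Setoid._≈_ (Facets P) (toFacet x) (toFacet y) →
                      proj₁ x ≡ proj₁ y × proj₁ (proj₂ x) ≡ proj₁ (proj₂ y)
    facet-injective x@(v , j , _) y@(w , k , _) same = v≡w , directions v≡w same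
      where
      v≡w : v ≡ w
      v≡w with v Fin.≟ w
      ... | yes v≡w = v≡w
      ... | no v≢w = contradiction
        (facet-top x w (Equivalence.from (same _) (v∈facet w k)) (v≢w ∘ ≡.sym))
        (<-asym (facet-top y v (Equivalence.to (same _) (v∈facet v j)) v≢w))
      directions : ∀ {v w j k} → v ≡ w → (∀ x → facePoints (facet v j) x ⇔ facePoints (facet w k) x) → j ≡ k
      directions {v} {j = j} {k} ≡.refl same with j Fin.≟ k
      ... | yes j≡k = j≡k
      ... | no j≢k = contradiction (≈-trans (≈-sym (φ-nb v k))
        (facet-φ v k (Equivalence.to (same _) (nb∈facet v j k (j≢k ∘ ≡.sym))))) 1≉0

    one two : Fin n → Bool
    one v = outdeg c v ℕ.≡ᵇ 1
    two v = 1 ℕ.<ᵇ outdeg c v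

    -- All d facets at the sink and one facet at each vertex of out-degree 1 have that vertex on top.
    facets-≥ : ∀ {m} → HasSize (Facets P) m → Fin n → d ℕ.+ count one ℕ.≤ m
    facets-≥ size i = size-≤ {S = ≡.setoid (Fin d ⊎ Sub one)} {S′ = Facets P}
      (↔⇒⤖ (↔-sym (↔-trans (↔-refl ⊎F.⊎-↔ Sub-fin one) (↔-sym Fin.+↔⊎)))) size (toFacet ∘ top)
      (λ {x} {y} same → separate x y (facet-injective (top x) (top y) same))
      where
      o = proj₁ (sink-exists i)
      o-sink = proj₂ (sink-exists i)
      deg1 : ((v , _) : Sub one) → outdeg c v ≡ 1
      deg1 (v , t) = ℕ.≡ᵇ⇒≡ _ 1 t
      top : Fin d ⊎ Sub one → TopFacet
      top (inj₁ j) = o , j , λ i _ → count≡0 (outB c o) o-sink i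
      top (inj₂ (v , t)) = let j , _ , others = count≡1 (outB c v) (deg1 (v , t)) in v , j , others
      o≢ : ((v , _) : Sub one) → o ≢ v
      o≢ x@(v , _) ≡.refl = case ≡.trans (≡.sym o-sink) (deg1 x) of λ ()
      separate : ∀ x y → proj₁ (top x) ≡ proj₁ (top y) × proj₁ (proj₂ (top x)) ≡ proj₁ (proj₂ (top y)) → x ≡ y
      separate (inj₁ j) (inj₁ k) (_ , e) = ≡.cong inj₁ e
      separate (inj₁ j) (inj₂ y) (e , _) = contradiction e (o≢ y)
      separate (inj₂ x) (inj₁ k) (e , _) = contradiction (≡.sym e) (o≢ x)
      separate (inj₂ x) (inj₂ y) (e , _) = ≡.cong inj₂ (Sub-≡ {B = one} e)

    vertices-≤ : n ℕ.≤ 1 ℕ.+ count one ℕ.+ count two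
    vertices-≤ = ℕ.≤-trans (ℕ.≤-reflexive (≡.sym (count-complement two)))
      (ℕ.≤-trans (ℕ.+-monoʳ-≤ (count two) few) (ℕ.≤-reflexive (ℕ.+-comm (count two) _)))
      where
      class : ∀ x → T (not (1 ℕ.<ᵇ x)) → x ≡ 0 ⊎ x ≡ 1
      class zero _ = inj₁ ≡.refl
      class (suc zero) _ = inj₂ ≡.refl
      code : ∀ v → outdeg c v ≡ 0 ⊎ outdeg c v ≡ 1 → Fin 1 ⊎ Sub one
      code v (inj₁ _) = inj₁ zero
      code v (inj₂ e) = inj₂ (v , ℕ.≡⇒≡ᵇ _ 1 e)
      code-injective : ∀ v w x y → code v x ≡ code w y → v ≡ w
      code-injective v w (inj₁ sv) (inj₁ sw) _ = sink-unique v w sv sw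
      code-injective v w (inj₂ _) (inj₂ _) e = ≡.cong proj₁ (Sum.inj₂-injective e)
      few : count (not ∘ two) ℕ.≤ 1 ℕ.+ count one
      few = injection⇒≤ (Sub-fin (not ∘ two)) (↔-trans (↔-refl ⊎F.⊎-↔ Sub-fin one) (↔-sym Fin.+↔⊎))
        (λ (v , t) → code v (class _ t))
        (λ { {v , s} {w , t} e → Sub-≡ {B = not ∘ two} (code-injective v w (class _ s) (class _ t) e) })

    vertices-facets : ∀ {m} → HasSize (Facets P) m → Fin n → n ℕ.+ d ℕ.≤ 1 ℕ.+ m ℕ.+ count two
    vertices-facets {m} size i = begin
      n ℕ.+ d                                       ≤⟨ ℕ.+-monoˡ-≤ d vertices-≤ ⟩
      1 ℕ.+ count one ℕ.+ count two ℕ.+ d           ≡⟨ ≡.cong suc (rearrange (count one) (count two) d) ⟩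
      1 ℕ.+ (d ℕ.+ count one) ℕ.+ count two         ≤⟨ ℕ.+-monoˡ-≤ (count two) (s≤s (facets-≥ size i)) ⟩
      1 ℕ.+ m ℕ.+ count two                         ∎
      where
      open ℕ.≤-Reasoning
      rearrange : ∀ a b d → a ℕ.+ b ℕ.+ d ≡ d ℕ.+ a ℕ.+ b
      rearrange a b d = ≡.trans (ℕ.+-comm (a ℕ.+ b) d) (≡.sym (ℕ.+-assoc d a b))

-- Coherent arborescences and incoherent choice patterns.

module Arborescences
  (em : ExcludedMiddle 0ℓ) (ℝ : RealField)
  {d : ℕ} (P : Polytopes.Polytope ℝ d)
  (full : Polytopes.FullDimensional ℝ P) (simple : Polytopes.Simple ℝ P)
  {n : ℕ} (V : Fin n → Polytopes.Vertex ℝ P)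
  (V-injective : ∀ {i j} → Polytopes._≋_ ℝ (proj₁ (V i)) (proj₁ (V j)) → i ≡ j)
  (V-surjective : ∀ (v : Polytopes.Vertex ℝ P) → ∃[ i ] Polytopes._≋_ ℝ (proj₁ (V i)) (proj₁ v))
  {c : Polytopes.Point ℝ d} (gen : Polytopes.Generic ℝ P c)
  (η : Func (Polytopes.≋.≋-setoid ℝ d) (RealField.setoid ℝ)) (normal : Polytopes.IsNormalization ℝ P c η) where

  open Corners em ℝ
  open Counting
  open Sizes
  open FacetCount em ℝ P full simple V V-injective V-surjective
  open WithObjective gen

  -- Position zero is the choice of staying at the sink, position suc j that of the edge j.
  choices : (v : Fin n) → Fin (suc d) → Bool
  choices v zero = outdeg c v ℕ.≡ᵇ 0
  choices v (suc j) = outB c v j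

  count-choices : ∀ v → count (choices v) ≡ 1 ℕ.⊔ outdeg c v
  count-choices v = bit+ (outdeg c v)
    where
    bit+ : ∀ x → bit (x ℕ.≡ᵇ 0) ℕ.+ x ≡ 1 ℕ.⊔ x
    bit+ zero = ≡.refl
    bit+ (suc x) = ≡.refl

  Choice : Fin n → Set
  Choice v = Sub (choices v)

  Code : Set
  Code = Π Choice

  M : ℕ
  M = ℕΠ.sum (λ v → count (choices v))

  Code-fin : Code ↔ Fin M
  Code-fin = Π-fin (λ v → Sub-fin (choices v))

  target : ∀ v → Choice v → Fin n
  target v (zero , _) = v
  target v (suc j , _) = nb v j

  target-injective : ∀ v {x y} → target v x ≡ target v y → x ≡ y
  target-injective v {zero , _} {zero , _} _ = Sub-≡ {B = choices v} ≡.refl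
  target-injective v {zero , _} {suc j , _} e = contradiction (≡.sym e) (nb≢ v j)
  target-injective v {suc j , _} {zero , _} e = contradiction e (nb≢ v j)
  target-injective v {suc j , _} {suc k , _} e = Sub-≡ {B = choices v} (≡.cong suc (nb-injective v e))

  index-cong : ∀ {u u′ : Vertex P} → proj₁ u ≋ proj₁ u′ → index u ≡ index u′
  index-cong {u} {u′} e = V-injective λ m → ≈-trans (vtx-index u m) (≈-trans (e m) (≈-sym (vtx-index u′ m)))

  index-V : ∀ v → index (V v) ≡ v
  index-V v = V-injective (vtx-index (V v))

  arb : Code → Func (Vertices P) (Vertices P)
  arb x = record
    { to = λ u → V (target (index u) (look x (index u)))
    ; cong = λ {u} {u′} e m → ≈-reflexive (≡.cong (λ v → vtx (target v (look x v)) m) (index-cong {u} {u′} e))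
    }

  arb-V : ∀ x v → proj₁ (arb x ⟨$⟩ V v) ≋ vtx (target v (look x v))
  arb-V x v m = ≈-reflexive (≡.cong (λ v → vtx (target v (look x v)) m) (index-V v))

  arb-injective : ∀ {x y} → (∀ u → proj₁ (arb x ⟨$⟩ u) ≋ proj₁ (arb y ⟨$⟩ u)) → x ≡ y
  arb-injective {x} {y} e = look-ext {F = Choice} λ v → target-injective v (V-injective λ m →
    ≈-trans (≈-sym (arb-V x v m)) (≈-trans (e (V v) m) (arb-V y v m)))

  sink-opt : ∀ v → outdeg c v ≡ 0 → IsOpt P c (V v)
  sink-opt v sink u with index u Fin.≟ v
  ... | yes e = inj₂ (·-congˡ c λ m → ≈-trans (≈-sym (vtx-index u m)) (≈-reflexive (≡.cong (λ i → vtx i m) e)))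
  ... | no ¬e = inj₁ (proj₂ <-resp-≈ (·-congˡ c (vtx-index u)) (sink-top v sink (index u) ¬e))

  out-not-opt : ∀ v j → T (outB c v j) → ¬ IsOpt P c (V v)
  out-not-opt v j t opt = ≤⇒≯ (opt (V (nb v j))) (<?-sound t)

  nb-Nb : ∀ v j → T (outB c v j) → Nb P c (V v) (V (nb v j))
  nb-Nb v j t = nb-adjacent v j , <?-sound t

  module _ (A : Func (Vertices P) (Vertices P)) (coh : IsCoherent P c η A) where

    choose : ∀ v → Σ[ x ∈ Choice v ] vtx (target v x) ≋ proj₁ (A ⟨$⟩ V v)
    choose v with outdeg c v ℕ.≟ 0
    ... | yes sink = (zero , ℕ.≡⇒≡ᵇ _ 0 sink) , λ m → ≈-sym (proj₁ (proj₂ coh) (V v) (sink-opt v sink) m)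
    ... | no ¬sink =
      let j₀ , t₀ = element (outB c v) (Fin.fromℕ< (ℕ.n≢0⇒n>0 ¬sink))
          ((adj , up) , _) , _ = proj₂ (proj₂ coh) (V v) (out-not-opt v j₀ t₀)
          a = A ⟨$⟩ V v
          j , e = adjacent-nb (index a) v (move adj)
          at : ∀ m → vtx (nb v j) m ≈ proj₁ a m
          at m = ≈-trans (≈-reflexive (≡.cong (λ i → vtx i m) (≡.sym e))) (vtx-index a m)
      in (suc j , <?-complete (proj₁ <-resp-≈ (·-congˡ c (λ m → ≈-sym (at m))) up)) , at
      where
      move : ∀ {a} → Adjacent P a (V v) → Adjacent P (V (index a)) (V v)
      move {a} (a≉v , F , F-edge , a∈F , v∈F) =
        (λ e → a≉v λ m → ≈-trans (≈-sym (vtx-index a m)) (e m)) ,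
        F , F-edge , facePoints-resp F (λ m → ≈-sym (vtx-index a m)) a∈F , v∈F

    encode : Code
    encode = tab (λ v → proj₁ (choose v))

    arb-encode : ∀ u → proj₁ (arb encode ⟨$⟩ u) ≋ proj₁ (A ⟨$⟩ u)
    arb-encode u m = ≈-trans
      (≈-reflexive (≡.cong (λ x → vtx (target (index u) x) m) (look-tab {F = Choice} (λ v → proj₁ (choose v)) (index u))))
      (≈-trans (proj₂ (choose (index u)) m) (Func.cong A (vtx-index u) m))

  -- The value of 0# ⁻¹ need not respect ≈, so slopes are compared at out-neighbours only.
  slope-cong : ∀ w v {u u′} → Nb P c v u → proj₁ u ≋ proj₁ u′ → slope P c η w v u ≈ slope P c η w v u′
  slope-cong w v {u} {u′} u∈Nb e = *-cong (·-congˡ w e′) (⁻¹-cong (normal u v u∈Nb) (Func.cong η e′))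
    where
    e′ : proj₁ u ⊖ proj₁ v ≋ proj₁ u′ ⊖ proj₁ v
    e′ m = +-congʳ (e m)

  Nb-resp : ∀ v {u u′} → proj₁ u ≋ proj₁ u′ → Nb P c v u → Nb P c v u′
  Nb-resp v e ((u≉v , F , F-edge , u∈F , v∈F) , up) =
    ((λ e′ → u≉v λ m → ≈-trans (e m) (e′ m)) , F , F-edge , facePoints-resp F e u∈F , v∈F) ,
    proj₁ <-resp-≈ (·-congˡ c e) up

  coherent-resp : ∀ A B → (∀ u → proj₁ (A ⟨$⟩ u) ≋ proj₁ (B ⟨$⟩ u)) → IsCoherent P c η A → IsCoherent P c η B
  coherent-resp A B e (w , fixed , unique) = w ,
    (λ v opt m → ≈-trans (≈-sym (e v m)) (fixed v opt m)) ,
    λ v ¬opt → let (Av∈ , max) , only = unique v ¬opt in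
      (Nb-resp v {A ⟨$⟩ v} {B ⟨$⟩ v} (e v) Av∈ ,
       λ u u∈ → ≤-trans (max u u∈) (inj₂ (slope-cong w v {A ⟨$⟩ v} {B ⟨$⟩ v} Av∈ (e v)))) ,
      λ u u-max m → ≈-trans (only u u-max m) (e v m)

  -- Coherence asks for a real weight, so excluded middle turns it into a Boolean; coherent and
  -- incoherent codes are then complementary counts.
  coherent? : Code → Bool
  coherent? x = ⌊ em {P = IsCoherent P c η (arb x)} ⌋

  N : ℕ
  N = count (coherent? ∘ Inverse.from Code-fin)

  coherent-size : HasSize (CoherentArborescences P c η) N
  coherent-size = size-via (Subtype-fin Code-fin coherent?) (CoherentArborescences P c η)
    (λ (x , t) → arb x , toWitness t)
    (λ {(x , s)} {(y , t)} e → same (arb-injective e))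
    (λ (A , coh) → (encode A coh , fromWitness (coherent-resp A (arb (encode A coh))
        (λ u m → ≈-sym (arb-encode A coh u m)) coh)) , arb-encode A coh)
    where
    same : ∀ {x y} {s : T (coherent? x)} {t : T (coherent? y)} → x ≡ y → (x , s) ≡ (y , t)
    same {s = s} {t} ≡.refl = ≡.cong (_ ,_) (T-irrelevant s t)

  -- A neighbour attaining the same slope would be a second maximizer.
  strict-maximum : ∀ {v w a} → IsUniqueMaximizer P (Nb P c (V v)) (slope P c η w (V v)) a →
    ∀ i j → T (outB c v i) → T (outB c v j) → i ≢ j → proj₁ a ≋ vtx (nb v i) →
    slope P c η w (V v) (V (nb v j)) < slope P c η w (V v) (V (nb v i))
  strict-maximum {v} {w} {a} ((a∈ , max) , only) i j ti tj i≢j e = strict (max (V (nb v j)) (nb-Nb v j tj))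
    where
    a≈i : slope P c η w (V v) a ≈ slope P c η w (V v) (V (nb v i))
    a≈i = slope-cong w (V v) {a} {V (nb v i)} a∈ e
    strict : slope P c η w (V v) (V (nb v j)) ≤ slope P c η w (V v) a → _
    strict (inj₁ p) = proj₁ <-resp-≈ a≈i p
    strict (inj₂ z) = contradiction (nb-injective v (V-injective λ m → ≈-trans (≈-sym (e m))
      (≈-sym (only (V (nb v j)) (nb-Nb v j tj , λ u u∈ → ≤-trans (max u u∈) (inj₂ (≈-sym z))) m)))) i≢j

  -- The filler in `branching` at vertices of out-degree at most one, where there is nothing to
  -- decide.
  some-choice : ∀ v → Choice v
  some-choice v with outdeg c v ℕ.≟ 0
  ... | yes sink = zero , ℕ.≡⇒≡ᵇ _ 0 sink
  ... | no ¬sink = let j , t = element (outB c v) (Fin.fromℕ< (ℕ.n≢0⇒n>0 ¬sink)) in suc j , t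

  module _ (b : Sub two) where
    private
      v = proj₁ b
      pair = count≥2 (outB c v) (ℕ.<ᵇ⇒< 1 (outdeg c v) (proj₂ b))

    branch : Bool → Sub (outB c v)
    branch s = if s then proj₁ pair else proj₁ (proj₂ pair)

    branch-≢ : ∀ s → proj₁ (branch s) ≢ proj₁ (branch (not s))
    branch-≢ true = proj₂ (proj₂ pair)
    branch-≢ false = proj₂ (proj₂ pair) ∘ ≡.sym

    branch-choice : Bool → Choice v
    branch-choice s = suc (proj₁ (branch s)) , proj₂ (branch s)

    branch-injective : ∀ {s s′} → branch-choice s ≡ branch-choice s′ → s ≡ s′
    branch-injective {true} {true} _ = ≡.refl
    branch-injective {true} {false} e = contradiction (Fin.suc-injective (≡.cong proj₁ e)) (branch-≢ true)
    branch-injective {false} {true} e = contradiction (Fin.suc-injective (≡.cong proj₁ e)) (branch-≢ false)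
    branch-injective {false} {false} _ = ≡.refl

    private
      arm : Bool → Point d
      arm s m = (vtx u ⊖ vtx v) m * (η ⟨$⟩ (vtx u ⊖ vtx v)) ⁻¹
        where u = nb v (proj₁ (branch s))

      arm-slope : ∀ w s → w · arm s ≈ slope P c η w (V v) (V (nb v (proj₁ (branch s))))
      arm-slope w s = ≈-trans
        (sum-cong-≋ (λ m → solve 3 (λ x y z → x :* (y :* z) := x :* y :* z) ≈-refl (w m) ((vtx u ⊖ vtx v) m) q))
        (≈-sym (*-distribʳ-sum q (λ m → w m * (vtx u ⊖ vtx v) m)))
        where
        u = nb v (proj₁ (branch s))
        q = (η ⟨$⟩ (vtx u ⊖ vtx v)) ⁻¹

    -- Pairing with `w` gives the difference of the slopes of the two branches. The vector itself
    -- does not involve `w`, because the normalization enters only as a scalar for each edge.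
    slope-difference : Point d
    slope-difference = arm true ⊖ arm false

    slope-difference-· : ∀ w → w · slope-difference ≈
      slope P c η w (V v) (V (nb v (proj₁ (branch true)))) - slope P c η w (V v) (V (nb v (proj₁ (branch false))))
    slope-difference-· w = ≈-trans (·-⊖ w (arm true) (arm false)) (+-cong (arm-slope w true) (-‿cong (arm-slope w false)))

  signed : Bool → Carrier → Carrier
  signed s x = if s then x else - x

  module _ {k} (e : Sub two ↔ Fin k) where

    private
      pick : (Fin k → Bool) → ∀ v → Dec (T (two v)) → Choice v
      pick β v (yes t) = branch-choice (v , t) (β (Inverse.to e (v , t)))
      pick β v (no _) = some-choice v

      pick-yes : ∀ β ((v , t) : Sub two) t? → pick β v t? ≡ branch-choice (v , t) (β (Inverse.to e (v , t)))
      pick-yes β (v , t) (yes t′) = ≡.cong (λ t → branch-choice (v , t) (β (Inverse.to e (v , t)))) (T-irrelevant t′ t)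
      pick-yes β (v , t) (no ¬t) = contradiction t ¬t

    branching : (Fin k → Bool) → Code
    branching β = tab (λ v → pick β v (Bool.T? (two v)))

    private
      site : Fin k → Sub two
      site = Inverse.from e

    look-branching : ∀ β i → look (branching β) (proj₁ (site i)) ≡ branch-choice (site i) (β i)
    look-branching β i = ≡.trans (look-tab {F = Choice} (λ v → pick β v (Bool.T? (two v))) (proj₁ (site i)))
      (≡.trans (pick-yes β (site i) (Bool.T? (two (proj₁ (site i)))))
        (≡.cong (branch-choice (site i) ∘ β) (Inverse.strictlyInverseˡ e i)))

    branching-injective : ∀ {β β′} → branching β ≡ branching β′ → ∀ i → β i ≡ β′ i
    branching-injective {β} {β′} eq i = branch-injective (site i)
      (≡.trans (≡.sym (look-branching β i)) (≡.trans (≡.cong (λ x → look x (proj₁ (site i))) eq) (look-branching β′ i)))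

    -- The weight of a coherent arborescence strictly prefers the chosen branch to the other one,
    -- which fixes the sign of its pairing with the slope difference.
    branching-sign : ∀ β (coh : IsCoherent P c η (arb (branching β))) i →
      0# < signed (β i) (proj₁ coh · slope-difference (site i))
    branching-sign β (w , _ , unique) i = sign (β i) (≡.subst
        (λ x → proj₁ (arb (branching β) ⟨$⟩ V v) ≋ vtx (target v x)) (look-branching β i) (arb-V (branching β) v))
      where
      b = site i
      v = proj₁ b
      out = λ s → proj₂ (branch b s)
      f : Bool → Carrier
      f s = slope P c η w (V v) (V (nb v (proj₁ (branch b s))))
      max : ∀ s → proj₁ (arb (branching β) ⟨$⟩ V v) ≋ vtx (nb v (proj₁ (branch b s))) → f (not s) < f s
      max s = strict-maximum {v} {w} {arb (branching β) ⟨$⟩ V v}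
        (unique (V v) (out-not-opt v _ (out true))) _ _ (out s) (out (not s)) (branch-≢ b s)
      sign : ∀ s → proj₁ (arb (branching β) ⟨$⟩ V v) ≋ vtx (nb v (proj₁ (branch b s))) →
             0# < signed s (w · slope-difference b)
      sign true eq = pos-resp (≈-sym (slope-difference-· b w)) (pos-diff (max true eq))
      sign false eq = pos-resp (≈-sym (≈-trans (-‿cong (slope-difference-· b w))
        (solve 2 (λ x y → :- (x :- y) := y :- x) ≈-refl (f true) (f false)))) (pos-diff (max false eq))

  module _ {t} (e : Sub two ↔ Fin (suc d ℕ.+ t)) where
    private
      γ : Vector (Point d) (suc d)
      γ a = slope-difference (Inverse.from e (a ↑ˡ t))

      relation = dependent γ ℕ.≤-refl
      α = proj₁ relation

      -- Along the d + 1 dependent sites the choices follow the signs of a linear relation, or all the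
      -- opposite signs; of the other t sites at most one deviates.
      choicePattern : Bool → Fin (suc t) → Fin (suc d ℕ.+ t) → Bool
      choicePattern s x i = [ (λ a → s xor (0# <? α a)) , (λ r → ⌊ suc r Fin.≟ x ⌋) ]′ (Fin.splitAt (suc d) i)

      pattern-left : ∀ s x a → choicePattern s x (a ↑ˡ t) ≡ s xor (0# <? α a)
      pattern-left s x a rewrite Fin.splitAt-↑ˡ (suc d) a t = ≡.refl

      pattern-right : ∀ s x r → choicePattern s x (suc d ↑ʳ r) ≡ ⌊ suc r Fin.≟ x ⌋
      pattern-right s x r rewrite Fin.splitAt-↑ʳ (suc d) t r = ≡.refl

      -- By `combine`, the terms of the relation paired with `w` are, up to one common sign,
      -- products of two nonnegative factors, positive where `α` is nonzero; yet they sum to zero.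
      -- Where `α a` is zero the sign test yields `false`, which is harmless because that term
      -- vanishes.
      incoherent : ∀ s x → ¬ IsCoherent P c η (arb (branching e (choicePattern s x)))
      incoherent s x coh = pos≉0 (sum-pos nn (proj₁ (proj₁ (proj₂ relation))) (pos (proj₁ (proj₁ (proj₂ relation))) (proj₂ (proj₁ (proj₂ relation))))) total
        where
        w = proj₁ coh
        term : Vector Carrier (suc d)
        term a = α a * w · γ a
        sum-term : sum term ≈ 0#
        sum-term = ≈-trans (≈-sym (·-combination w α γ)) (≈-trans (·-congˡ w (proj₂ (proj₂ relation))) (·-0ᵖ w))
        total : sum (λ a → signed (not s) (term a)) ≈ 0#
        total = flip s
          where
          flip : ∀ s → sum (λ a → signed (not s) (term a)) ≈ 0#
          flip false = sum-term
          flip true = ≈-trans (sum-neg term) (≈-trans (-‿cong sum-term) -0#≈0#)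
        combine : ∀ s σ {x y} → signed σ x * signed (s xor σ) y ≈ signed (not s) (x * y)
        combine false false = solve 2 (λ x y → :- x :* :- y := x :* y) ≈-refl _ _
        combine false true = ≈-refl
        combine true false = solve 2 (λ x y → :- x :* y := :- (x :* y)) ≈-refl _ _
        combine true true = solve 2 (λ x y → x :* :- y := :- (x :* y)) ≈-refl _ _
        w-sign : ∀ a → 0# < signed (s xor (0# <? α a)) (w · γ a)
        w-sign a = ≡.subst (λ β → 0# < signed β (w · γ a)) (pattern-left s x a) (branching-sign e (choicePattern s x) coh (a ↑ˡ t))
        α-sign : ∀ a → 0# ≤ signed (0# <? α a) (α a)
        α-sign a with compare 0# (α a)
        ... | tri< p _ _ = inj₁ p
        ... | tri≈ _ z _ = nn-neg (inj₂ (≈-sym z))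
        ... | tri> _ _ p = nn-neg (inj₁ p)
        α-sign′ : ∀ a → ¬ (α a ≈ 0#) → 0# < signed (0# <? α a) (α a)
        α-sign′ a nz with compare 0# (α a)
        ... | tri< p _ _ = p
        ... | tri≈ _ z _ = contradiction (≈-sym z) nz
        ... | tri> _ _ p = neg-pos p
        nn : ∀ a → 0# ≤ signed (not s) (term a)
        nn a = nn-resp (combine s (0# <? α a)) (nn*nn (α-sign a) (inj₁ (w-sign a)))
        pos : ∀ a → ¬ (α a ≈ 0#) → 0# < signed (not s) (term a)
        pos a nz = pos-resp (combine s (0# <? α a)) (*-pos (α-sign′ a nz) (w-sign a))

      xor-cancel : ∀ {s s′} b → s xor b ≡ s′ xor b → s ≡ s′
      xor-cancel {false} {false} b _ = ≡.refl
      xor-cancel {true} {true} b _ = ≡.refl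
      xor-cancel {false} {true} false ()
      xor-cancel {false} {true} true ()
      xor-cancel {true} {false} false ()
      xor-cancel {true} {false} true ()

      hot-injective : ∀ {x x′ : Fin (suc t)} → (∀ r → ⌊ suc r Fin.≟ x ⌋ ≡ ⌊ suc r Fin.≟ x′ ⌋) → x ≡ x′
      hot-injective {zero} {zero} _ = ≡.refl
      hot-injective {zero} {suc y} eq = contradiction (≡.subst T (≡.sym (eq y)) (fromWitness {a? = suc y Fin.≟ suc y} ≡.refl)) (λ f → case toWitness {a? = suc y Fin.≟ zero} f of λ ())
      hot-injective {suc x} {x′} eq = toWitness (≡.subst T (eq x) (fromWitness {a? = suc x Fin.≟ suc x} ≡.refl))

    incoherent-count : 2 ℕ.* suc t ℕ.≤ count (not ∘ coherent? ∘ Inverse.from Code-fin)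
    incoherent-count = injection⇒≤
      (↔-trans (↔-sym Fin.2↔Bool ×F.×-↔ ↔-refl) (↔-sym Fin.*↔×))
      (Subtype-fin Code-fin (not ∘ coherent?))
      (λ (s , x) → branching e (choicePattern s x) , not-T (λ c → incoherent s x (toWitness c)))
      (λ { {s , x} {s′ , x′} eq → let same = branching-injective e (≡.cong proj₁ eq) in ≡.cong₂ _,_
        -- The global sign is read off at one dependent site, the deviating site, if any, at the
        -- remaining `t`.
        (xor-cancel (0# <? α zero) (≡.trans (≡.sym (pattern-left s x zero)) (≡.trans (same (zero ↑ˡ t)) (pattern-left s′ x′ zero))))
        (hot-injective λ r → ≡.trans (≡.sym (pattern-right s x r)) (≡.trans (same (suc d ↑ʳ r)) (pattern-right s′ x′ r))) })

  module _ (h : Vector ℕ (suc d)) (isH : IsHVector P h) {m} (facets : HasSize (Facets P) m) (i₀ : Fin n) where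

    M≡hProduct : M ≡ hProduct h
    M≡hProduct = ≡.trans (ℕΠ.sum-cong-≗ {n} count-choices) (≡.sym (hProduct-outdeg gen h isH))

    N+incoherent : N ℕ.+ count (not ∘ coherent? ∘ Inverse.from Code-fin) ≡ hProduct h
    N+incoherent = ≡.trans (count-complement (coherent? ∘ Inverse.from Code-fin)) M≡hProduct

    -- Negative terms are moved across to stay within the naturals. `by-size` gives a bound with
    -- `2 * suc m`, which is two below the right-hand side, hence strictness.
    coherent-bound : N ℕ.+ 2 ℕ.* n ℕ.< hProduct h ℕ.+ 2 ℕ.* m ℕ.+ 4
    coherent-bound = ℕ.≤-trans (s≤s (by-size (suc d ℕ.≤? count two)))
      (ℕ.≤-trans (ℕ.n≤1+n _) (ℕ.≤-reflexive (shift (hProduct h) m)))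
      where
      open ℕ.≤-Reasoning
      shift : ∀ H m → 2 ℕ.+ (H ℕ.+ 2 ℕ.* suc m) ≡ H ℕ.+ 2 ℕ.* m ℕ.+ 4
      shift = solve-∀
      n+d≤ : n ℕ.+ d ℕ.≤ 1 ℕ.+ m ℕ.+ count two
      n+d≤ = vertices-facets facets i₀
      by-size : Dec (suc d ℕ.≤ count two) → N ℕ.+ 2 ℕ.* n ℕ.≤ hProduct h ℕ.+ 2 ℕ.* suc m
      -- With at most `d` branching vertices the facet count gives n ≤ m + 1, and bounding `N` by
      -- the number of all codes is enough.
      by-size (no few) = ℕ.+-mono-≤
        (ℕ.≤-trans (ℕ.m≤m+n N _) (ℕ.≤-reflexive N+incoherent))
        (ℕ.*-monoʳ-≤ 2 (ℕ.+-cancelʳ-≤ d n (suc m) (ℕ.≤-trans n+d≤ (ℕ.+-monoʳ-≤ (suc m) (ℕ.s≤s⁻¹ (ℕ.≰⇒> few))))))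
      by-size (yes many) = begin
        N ℕ.+ 2 ℕ.* n                                        ≤⟨ ℕ.+-monoʳ-≤ N (ℕ.*-monoʳ-≤ 2 n≤) ⟩
        N ℕ.+ 2 ℕ.* (suc m ℕ.+ suc t)                        ≡⟨ regroup N m t ⟩
        N ℕ.+ 2 ℕ.* suc t ℕ.+ 2 ℕ.* suc m                    ≤⟨ ℕ.+-monoˡ-≤ (2 ℕ.* suc m) (ℕ.+-monoʳ-≤ N (incoherent-count sites)) ⟩
        N ℕ.+ count (not ∘ coherent? ∘ Inverse.from Code-fin) ℕ.+ 2 ℕ.* suc m
                                                             ≡⟨ ≡.cong (ℕ._+ 2 ℕ.* suc m) N+incoherent ⟩
        hProduct h ℕ.+ 2 ℕ.* suc m                           ∎
        where
        t = count two ℕ.∸ suc d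
        size : count two ≡ suc d ℕ.+ t
        size = ≡.sym (ℕ.m+[n∸m]≡n many)
        sites : Sub two ↔ Fin (suc d ℕ.+ t)
        sites = ≡.subst (λ k → Sub two ↔ Fin k) size (Sub-fin two)
        regroup : ∀ N m t → N ℕ.+ 2 ℕ.* (suc m ℕ.+ suc t) ≡ N ℕ.+ 2 ℕ.* suc t ℕ.+ 2 ℕ.* suc m
        regroup = solve-∀
        swap : ∀ d t m → suc m ℕ.+ (suc d ℕ.+ t) ≡ suc m ℕ.+ suc t ℕ.+ d
        swap = solve-∀
        n≤ : n ℕ.≤ suc m ℕ.+ suc t
        n≤ = ℕ.+-cancelʳ-≤ d n _ (ℕ.≤-trans n+d≤ (ℕ.≤-reflexive (≡.trans (≡.cong (suc m ℕ.+_) size) (swap d t m))))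

theorem5p2 : ExcludedMiddle 0ℓ → (ℝ : RealField) → let open Polytopes ℝ in
    (d n m : ℕ) → n ℕ.> d ℕ.+ 1 → d ℕ.+ 1 ℕ.≥ 4 →
    (P : Polytope d) → FullDimensional P → Simple P →
    HasSize (Vertices P) n → HasSize (Facets P) m →
    (h : Vector ℕ (suc d)) → IsHVector P h →
    (c : Point d) → Generic P c →
    (η : Func (≋.≋-setoid d) (RealField.setoid ℝ)) → IsNormalization P c η →
    ∃[ N ] (HasSize (CoherentArborescences P c η) N ×
    + N ℤ.< + hProduct h ℤ.- + 2 ℤ.* (+ n ℤ.- + m ℤ.- + 2))
theorem5p2 em ℝ d n m n>d+1 _ P full simple vertices facets h isH c gen η normal =
  N , coherent-size , bound
  where
  open Polytopes ℝ
  V = Bijection.to vertices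
  V-surjective : ∀ (v : Vertex P) → ∃[ i ] proj₁ (V i) ≋ proj₁ v
  V-surjective v = proj₁ (Bijection.surjective vertices v) , proj₂ (Bijection.surjective vertices v) ≡.refl
  open Arborescences em ℝ P full simple V (Bijection.injective vertices) V-surjective {c} gen η normal
  regroup : ∀ H m n → (H ℤ.+ + 2 ℤ.* m ℤ.+ + 4) ℤ.- + 2 ℤ.* n ≡ H ℤ.- + 2 ℤ.* (n ℤ.- m ℤ.- + 2)
  regroup = ℤSolver.solve-∀
  cancel : ∀ N n → (N ℤ.+ + 2 ℤ.* n) ℤ.- + 2 ℤ.* n ≡ N
  cancel = ℤSolver.solve-∀
  bound : + N ℤ.< + hProduct h ℤ.- + 2 ℤ.* (+ n ℤ.- + m ℤ.- + 2)
  -- `2 * n` is subtracted again over the integers, where n - m - 2 may be negative.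
  bound = ≡.subst₂ ℤ._<_ (cancel (+ N) (+ n)) (regroup (+ hProduct h) (+ m) (+ n))
    (ℤ.+-monoˡ-< (ℤ.- (+ 2 ℤ.* + n)) (≡.subst₂ ℤ._<_
      (≡.cong (λ x → + N ℤ.+ x) (ℤ.pos-* 2 n))
      (≡.cong (λ x → + hProduct h ℤ.+ x ℤ.+ + 4) (ℤ.pos-* 2 m))
      (ℤ.+<+ (coherent-bound h isH facets (Fin.fromℕ< (ℕ.≤-<-trans z≤n n>d+1))))))
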